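{- Constrained Ultrametric Violation Distance (CUVD) admits a fixed-parameter tractable (FPT) algorithm with running time $\mathcal{O}\big(9^k\cdot k\cdot |X|^{2}\big)$.
   Context: An instance of CUVD consists of an integer $k\ge 0$ (the parameter) and a 4-tuple $(X,\mathsf{dist},\tau_\ell,\tau_u)$, where $X$ is a finite set of points and $\mathsf{dist},\tau_\ell,\tau_u\colon X\times X\to\mathbb{R}_{\ge 0}$ are symmetric functions with $\mathsf{dist}(x,x)=\tau_\ell(x,x)=\tau_u(x,x)=0$ for all $x\in X$ (the function $\mathsf{dist}$ is not required to satisfy the triangle inequality). A metric space $(X,\mathsf{dist}')$ is an ultrametric space if $\mathsf{dist}'(x,z)\le\max\{\mathsf{dist}'(x,y),\mathsf{dist}'(y,z)\}$ for all distinct $x,y,z\in X$. The task is to decide whether there is an ultrametric space $(X,\mathsf{dist}')$ on the same point set such that $\tau_\ell(x,y)\le\mathsf{dist}'(x,y)\le\tau_u(x,y)$ for all $x,y\in X$ and the distance matrices $D$ of $\mathsf{dist}$ and $D'$ of $\mathsf{dist}'$ satisfy $\|D-D'\|_0\le 2k$, where $\|D-D'\|_0$ is the number of non-zero entries of $D-D'$ (equivalently, $\mathsf{dist}'$ differs from $\mathsf{dist}$ on at most $k$ unordered pairs of points). -}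

module Defs where

open import Algebra.Structures using (IsCommutativeRing)
import Algebra.Construct.NaturalChoice.Max as Max
open import Data.Bool.Base using (Bool; true; false; not; _∧_)
open import Data.Fin.Base using (Fin; fromℕ<)
open import Data.List.Base using (length; filter; cartesianProduct; allFin)
open import Data.Nat.Base as ℕ using (ℕ; suc)
import Data.Nat.Properties as ℕ
open import Data.Product.Base using (∃-syntax; _×_; _,_)
open import Data.Vec.Functional using (Vector; concat; _++_)
import Function.Metric.Structures as Metric
open import Level using (0ℓ)
open import Relation.Binary.Bundles using (TotalOrder)
open import Relation.Binary.Core using (Rel)
open import Relation.Binary.PropositionalEquality using (_≡_; _≢_)
open import Relation.Binary.Structures using (IsDecTotalOrder)
open import Relation.Nullary using (¬_; yes; no; does; ¬?)

------------------------------------------------------------------------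
-- The real numbers

-- ℝ is given axiomatically, as a Dedekind-complete ordered field, which
-- classically determines it up to isomorphism.  Decidability of ≈ and ≤ is
-- a theorem only classically; it is what gives a meaning to the
-- comparison instruction of a machine computing with reals.

record RealNumbers : Set₁ where
  infix  4 _≈_ _≤_
  infixl 6 _+_ _-_
  infixl 7 _*_
  infix  8 -_
  field
    Carrier           : Set
    _≈_ _≤_           : Rel Carrier 0ℓ
    _+_ _*_           : Carrier → Carrier → Carrier
    -_                : Carrier → Carrier
    0# 1#             : Carrier
    isCommutativeRing : IsCommutativeRing _≈_ _+_ _*_ -_ 0# 1#
    0≉1               : ¬ (0# ≈ 1#)
    inverse           : ∀ x → ¬ (x ≈ 0#) → ∃[ y ] x * y ≈ 1#
    isDecTotalOrder   : IsDecTotalOrder _≈_ _≤_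
    +-monoʳ-≤         : ∀ z {x y} → x ≤ y → z + x ≤ z + y
    *-nonNegative     : ∀ {x y} → 0# ≤ x → 0# ≤ y → 0# ≤ x * y
    supremum          : (P : Carrier → Set) →
                        ∃[ x ] P x →
                        ∃[ b ] (∀ x → P x → x ≤ b) →
                        ∃[ s ] (∀ x → P x → x ≤ s)
                             × (∀ b → (∀ x → P x → x ≤ b) → s ≤ b)

  open IsDecTotalOrder isDecTotalOrder public
    using (_≟_; _≤?_; isTotalOrder)

  totalOrder : TotalOrder 0ℓ 0ℓ 0ℓ
  totalOrder = record { isTotalOrder = isTotalOrder }

  open Max totalOrder public using (_⊔_)

  _-_ : Carrier → Carrier → Carrier
  x - y = x + (- y)

------------------------------------------------------------------------
-- Programs of a random access machine with two unbounded memories, one of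
-- natural numbers ("words") and one of reals, both indirectly addressable.
-- Words can only be added, subtracted (truncated at 0) and compared; reals
-- can only be copied and compared.

infix  9 `_
infixl 6 _⊕_ _⊖_
infix  5 _<ʷ_ _≤ʳ_
infixr 4 _and_
infix  3 W[_]≔_ R[_]≔R[_]
infix  3 if_then_else_ while_loop_
infixr 2 _︔_

data Expr : Set where
  `_      : ℕ → Expr
  W[_]    : Expr → Expr
  _⊕_ _⊖_ : Expr → Expr → Expr

-- a ≤ʳ b compares the reals stored at the addresses a and b.
data Test : Set where
  _<ʷ_ _≤ʳ_ : Expr → Expr → Test
  neg_      : Test → Test
  _and_     : Test → Test → Test

data Program : Set where
  skip          : Program
  W[_]≔_        : Expr → Expr → Program
  R[_]≔R[_]     : Expr → Expr → Program
  _︔_           : Program → Program → Program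
  if_then_else_ : Test → Program → Program → Program
  while_loop_     : Test → Program → Program

-- Unit cost: every literal, memory access, arithmetic operation, comparison
-- and connective takes one step.

cost : Expr → ℕ
cost (` _)   = 1
cost W[ e ]  = 1 ℕ.+ cost e
cost (e ⊕ f) = 1 ℕ.+ cost e ℕ.+ cost f
cost (e ⊖ f) = 1 ℕ.+ cost e ℕ.+ cost f

costᵗ : Test → ℕ
costᵗ (e <ʷ f)  = 1 ℕ.+ cost e ℕ.+ cost f
costᵗ (e ≤ʳ f)  = 3 ℕ.+ cost e ℕ.+ cost f
costᵗ (neg b)   = 1 ℕ.+ costᵗ b
costᵗ (b and c) = 1 ℕ.+ costᵗ b ℕ.+ costᵗ c

write : {A : Set} → (ℕ → A) → ℕ → A → (ℕ → A)
write m a x b with b ℕ.≟ a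
... | yes _ = x
... | no  _ = m b

module _ (ℝ : RealNumbers) where

  private module ℝ = RealNumbers ℝ

  record State : Set where
    constructor ⟪_,_⟫
    field
      words : ℕ → ℕ
      reals : ℕ → ℝ.Carrier

  open State

  eval : Expr → State → ℕ
  eval (` m)   σ = m
  eval W[ e ]  σ = words σ (eval e σ)
  eval (e ⊕ f) σ = eval e σ ℕ.+ eval f σ
  eval (e ⊖ f) σ = eval e σ ℕ.∸ eval f σ

  evalᵗ : Test → State → Bool
  evalᵗ (e <ʷ f)  σ = does (eval e σ ℕ.<? eval f σ)
  evalᵗ (e ≤ʳ f)  σ = does (reals σ (eval e σ) ℝ.≤? reals σ (eval f σ))
  evalᵗ (neg b)   σ = not (evalᵗ b σ)
  evalᵗ (b and c) σ = evalᵗ b σ ∧ evalᵗ c σ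

  -- Run p σ τ t: started in state σ, the program p halts in state τ after
  -- t steps.
  data Run : Program → State → State → ℕ → Set where
    skip       : ∀ {σ} → Run skip σ σ 1
    assignʷ    : ∀ {σ e f} →
                 Run (W[ e ]≔ f) σ
                     ⟪ write (words σ) (eval e σ) (eval f σ) , reals σ ⟫
                     (1 ℕ.+ cost e ℕ.+ cost f)
    assignʳ    : ∀ {σ e f} →
                 Run (R[ e ]≔R[ f ]) σ
                     ⟪ words σ , write (reals σ) (eval e σ) (reals σ (eval f σ)) ⟫
                     (2 ℕ.+ cost e ℕ.+ cost f)
    seq        : ∀ {p q σ σ′ σ″ t u} →
                 Run p σ σ′ t → Run q σ′ σ″ u →
                 Run (p ︔ q) σ σ″ (t ℕ.+ u)
    if-true    : ∀ {b p q σ σ′ t} → evalᵗ b σ ≡ true → Run p σ σ′ t →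
                 Run (if b then p else q) σ σ′ (1 ℕ.+ costᵗ b ℕ.+ t)
    if-false   : ∀ {b p q σ σ′ t} → evalᵗ b σ ≡ false → Run q σ σ′ t →
                 Run (if b then p else q) σ σ′ (1 ℕ.+ costᵗ b ℕ.+ t)
    while-stop : ∀ {b p σ} → evalᵗ b σ ≡ false →
                 Run (while b loop p) σ σ (1 ℕ.+ costᵗ b)
    while-step : ∀ {b p σ σ′ σ″ t u} → evalᵗ b σ ≡ true →
                 Run p σ σ′ t → Run (while b loop p) σ′ σ″ u →
                 Run (while b loop p) σ σ″ (1 ℕ.+ costᵗ b ℕ.+ t ℕ.+ u)

  Accepting : State → Set
  Accepting σ = words σ 0 ≡ 1

------------------------------------------------------------------------
-- Constrained Ultrametric Violation Distance

  Matrix : ℕ → Set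
  Matrix n = Fin n → Fin n → ℝ.Carrier

  record IsDissimilarity {n} (f : Matrix n) : Set where
    field
      nonNegative : ∀ x y → ℝ.0# ℝ.≤ f x y
      symmetric   : ∀ x y → f x y ℝ.≈ f y x
      diagonal    : ∀ x → f x x ℝ.≈ ℝ.0#

  -- The set of points is X = Fin n; k is the parameter.
  record Instance : Set where
    field
      k n                : ℕ
      dist τₗ τᵤ         : Matrix n
      dist-dissimilarity : IsDissimilarity dist
      τₗ-dissimilarity   : IsDissimilarity τₗ
      τᵤ-dissimilarity   : IsDissimilarity τᵤ

  IsMetric : ∀ {n} → Matrix n → Set
  IsMetric = Metric.IsGeneralMetric _≡_ ℝ._≈_ ℝ._≤_ ℝ.0# ℝ._+_

  record IsUltrametric {n} (d : Matrix n) : Set where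
    field
      isMetric : IsMetric d
      strong   : ∀ {x y z} → x ≢ y → y ≢ z → x ≢ z →
                 d x z ℝ.≤ d x y ℝ.⊔ d y z

  _⊖ᴹ_ : ∀ {n} → Matrix n → Matrix n → Matrix n
  (D ⊖ᴹ D′) x y = D x y ℝ.- D′ x y

  ‖_‖₀ : ∀ {n} → Matrix n → ℕ
  ‖_‖₀ {n} D =
    length (filter (λ (x , y) → ¬? (D x y ℝ.≟ ℝ.0#))
                   (cartesianProduct (allFin n) (allFin n)))

  YesInstance : Instance → Set
  YesInstance I = ∃[ dist′ ]
      IsUltrametric dist′
    × (∀ x y → τₗ x y ℝ.≤ dist′ x y × dist′ x y ℝ.≤ τᵤ x y)
    × ‖ dist ⊖ᴹ dist′ ‖₀ ℕ.≤ 2 ℕ.* k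
    where open Instance I

  -- Initially words 0 and 1 hold n and k, and the real memory starts with
  -- the matrices dist, τₗ and τᵤ, one after the other in row-major order.
  -- All other cells are 0.

  load : ∀ {m} → Vector ℝ.Carrier m → ℕ → ℝ.Carrier
  load {m} v a with a ℕ.<? m
  ... | yes a<m = v (fromℕ< a<m)
  ... | no  _   = ℝ.0#

  input : Instance → State
  input I = ⟪ registers , load (concat dist ++ concat τₗ ++ concat τᵤ) ⟫
    where
    open Instance I
    registers : ℕ → ℕ
    registers 0             = n
    registers 1             = k
    registers (suc (suc _)) = 0

{-# OPTIONS --safe #-}

-- Keep a matrix L of tentative lower bounds, initially dist where that obeys
-- the constraints and τₗ elsewhere.  While L has a triple x, y, z with
-- L x z > max (L x y) (L y z), take one of maximal height L x z.  In every
-- ultrametric solution either x z takes a smaller value, so that L x z may be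
-- lowered to τₗ x z, or one of x y, y z takes a value of at least L x z.
-- Because the heights never increase, a pair raised once is never raised
-- again, so each of the at most k modified pairs is repaired at most twice:
-- a solution is reached by one of the 3 ^ (2 k) = 9 ^ k sequences of 2 k
-- choices.  The machine tries all of them, at a cost of O(n²) per repair, since
-- a violation of maximal height can be read off a run of Prim's algorithm.
module Submission where

open import Defs
import Algebra.Construct.NaturalChoice.Max as Max
import Algebra.Properties.Group as GroupProperties
open import Algebra.Bundles using (CommutativeRing)
open import Data.Bool.Base using (Bool; true; false; T; not; _∧_; _∨_)
  renaming (if_then_else_ to when_then_else_)
open import Data.Fin using (#_)
open import Data.Fin.Base as Fin using (Fin; toℕ; fromℕ)
import Data.Fin.Properties as Fin
open import Data.List.Base
  using (_∷_; _++_; length; filter; cartesianProduct; tabulate; allFin)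
  renaming (map to mapᴸ)
import Data.List.Properties as List
open import Data.Nat.Base
open import Data.Nat.DivMod
  using (_/_; _%_; m%n<n; m≡m%n+[m/n]*n; [m+kn]%n≡m%n; m<n⇒m%n≡m)
open import Data.Nat.Properties
open import Data.Nat.Tactic.RingSolver using (solve-∀)
open import Data.Product.Base using (∃-syntax; _×_; _,_; proj₁; proj₂; uncurry)
open import Data.Sum.Base as Sum using (_⊎_; inj₁; inj₂)
open import Data.Unit.Base using (tt)
import Data.Vec.Functional as Vector
import Data.Vec.Functional.Properties as Vector
open import Function.Bundles using (_⇔_; mk⇔)
import Function.Metric.Structures as Metric
open import Level using (0ℓ)
open import Relation.Binary.Definitions using (tri<; tri≈; tri>)
open import Relation.Binary.PropositionalEquality hiding ([_])
import Relation.Binary.Reasoning.Setoid as ≈-Reasoning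
open import Relation.Binary.Structures using (IsDecTotalOrder)
open import Relation.Nullary
  using (¬_; Dec; yes; no; does; _×-dec_; _⊎-dec_; contradiction)
open import Relation.Nullary.Decidable using (dec-true; dec-false)
open import Relation.Nullary.Reflects using (ofʸ; ofⁿ)
open import Relation.Unary using (Pred; Decidable)

-- Iteration, memories and sums

-- The number 2 k of repairs comes from a potential. An ordered pair has status 0, 1 or 2; a repair
-- raises the status of both orientations of a pair; only the at most 2 k ordered pairs changed by
-- the solution leave status 0. An entry outside its bounds is changed by every solution, so it
-- starts at 1. Heights cannot increase since a repair replaces entries up to the current height h
-- by entries up to h, which leaves the graph of pairs with entry at most t unchanged for all t from
-- h on. For this reason ultrametricity is phrased by thresholds t, not by maxima.
--
-- The search may leave zeros off the diagonal, which a metric forbids. It tolerates them; the final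
-- check refuses pairs with `τᵤ` zero and counts pairs with `dist` zero as changed, and a small
-- positive number is put in afterwards.
--
-- To keep machine states out of this argument, the program is written in a language of bounded
-- loops, compiled by a translation that is proved correct once, with a step count computed from the
-- syntax. Each statement is then compared with a pure function on matrices.

iter : {A : Set} → (ℕ → A → A) → ℕ → A → A
iter f zero    a = a
iter f (suc j) a = f j (iter f j a)

iter-induction : {A : Set} {f : ℕ → A → A} {a : A} (I : ℕ → A → Set) (m : ℕ) →
  I 0 a → (∀ {j a} → j < m → I j a → I (suc j) (f j a)) → I m (iter f m a)
iter-induction I zero    base step = base
iter-induction I (suc m) base step =
  step ≤-refl (iter-induction I m base (λ j<m → step (m≤n⇒m≤1+n j<m)))

module _ {A : Set} where

  write-same : ∀ (m : ℕ → A) a x {b} → b ≡ a → write m a x b ≡ x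
  write-same m a x {b} b≡a with b ≟ a
  ... | yes _   = refl
  ... | no  b≢a = contradiction b≡a b≢a

  write-other : ∀ (m : ℕ → A) a x {b} → b ≢ a → write m a x b ≡ m b
  write-other m a x {b} b≢a with b ≟ a
  ... | yes b≡a = contradiction b≡a b≢a
  ... | no  _   = refl

  write-cong : ∀ (m m′ : ℕ → A) a x {b} → m b ≡ m′ b →
               write m a x b ≡ write m′ a x b
  write-cong m m′ a x {b} eq with b ≟ a
  ... | yes _ = refl
  ... | no  _ = eq

module _ {A : Set} {x y : A} where

  when-true : ∀ {b} → b ≡ true → (when b then x else y) ≡ x
  when-true refl = refl

  when-false : ∀ {b} → b ≡ false → (when b then x else y) ≡ y
  when-false refl = refl

below-suc : ∀ {j} (P : ℕ → Set) → (∀ x → x < j → P x) → P j → ∀ x → x < suc j → P x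
below-suc P below at x x<1+j with m≤n⇒m<n∨m≡n (s≤s⁻¹ x<1+j)
... | inj₁ x<j  = below x x<j
... | inj₂ refl = at

sum : ℕ → (ℕ → ℕ) → ℕ
sum zero    f = 0
sum (suc n) f = f 0 + sum n (λ i → f (suc i))

-- `sum` peels off the first index, whereas a counting loop adds the last one; this converts between
-- the two.
sum-last : ∀ n f → sum (suc n) f ≡ sum n f + f n
sum-last zero    f = +-comm (f 0) 0
sum-last (suc n) f = trans (cong (f 0 +_) (sum-last n (λ i → f (suc i))))
                           (sym (+-assoc (f 0) _ _))

sum-mono : ∀ n {f g} → (∀ i → i < n → f i ≤ g i) → sum n f ≤ sum n g
sum-mono zero    f≤g = z≤n
sum-mono (suc n) f≤g =
  +-mono-≤ (f≤g 0 z<s) (sum-mono n (λ i i<n → f≤g (suc i) (s<s i<n)))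

sum-strict : ∀ n {f g} a → a < n → (∀ i → i < n → f i ≤ g i) → f a < g a →
             sum n f < sum n g
sum-strict (suc n) zero    a<n       f≤g fa<ga =
  +-mono-<-≤ fa<ga (sum-mono n (λ i i<n → f≤g (suc i) (s<s i<n)))
sum-strict (suc n) (suc a) (s<s a<n) f≤g fa<ga =
  +-mono-≤-< (f≤g 0 z<s)
             (sum-strict n a a<n (λ i i<n → f≤g (suc i) (s<s i<n)) fa<ga)

-- The function `h` between `f` and `g` has already moved at `a` but not yet at `b`, so both halves
-- of the chain are strict. The gain of 2 accounts for the two orientations of a repaired pair.
sum-strict₂ : ∀ n {f g} a b → a < n → b < n → a ≢ b →
              (∀ i → i < n → f i ≤ g i) → f a < g a → f b < g b →
              2 + sum n f ≤ sum n g
sum-strict₂ n {f} {g} a b a<n b<n a≢b f≤g fa<ga fb<gb =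
  <-≤-trans (s<s (sum-strict n a a<n f≤h fa<ha)) (sum-strict n b b<n h≤g hb<gb)
  where
  h : ℕ → ℕ
  h = write f a (g a)
  fa<ha : f a < h a
  fa<ha = subst (f a <_) (sym (write-same f a (g a) refl)) fa<ga
  hb<gb : h b < g b
  hb<gb = subst (_< g b) (sym (write-other f a (g a) (≢-sym a≢b))) fb<gb
  f≤h : ∀ i → i < n → f i ≤ h i
  f≤h i i<n with i ≟ a
  ... | yes refl = f≤g i i<n
  ... | no  _    = ≤-refl
  h≤g : ∀ i → i < n → h i ≤ g i
  h≤g i i<n with i ≟ a
  ... | yes refl = ≤-refl
  ... | no  _    = f≤g i i<n

sum-zero : ∀ n {f} → sum n f ≡ 0 → ∀ i → i < n → f i ≡ 0
sum-zero (suc n) {f} eq zero    i<n       = m+n≡0⇒m≡0 (f 0) eq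
sum-zero (suc n) {f} eq (suc i) (s<s i<n) = sum-zero n (m+n≡0⇒n≡0 (f 0) eq) i i<n

sum-*ˡ : ∀ n c f → sum n (λ i → c * f i) ≡ c * sum n f
sum-*ˡ zero    c f = sym (*-zeroʳ c)
sum-*ˡ (suc n) c f = trans (cong (c * f 0 +_) (sum-*ˡ n c (λ i → f (suc i))))
                           (sym (*-distribˡ-+ c (f 0) _))

sum-≤-length : ∀ n f → (∀ i → f i ≤ 1) → sum n f ≤ n
sum-≤-length zero    f f≤1 = z≤n
sum-≤-length (suc n) f f≤1 = +-mono-≤ (f≤1 0) (sum-≤-length n _ (λ i → f≤1 (suc i)))

⟦_⟧ : Bool → ℕ
⟦ true  ⟧ = 1
⟦ false ⟧ = 0

⟦_⟧≤1 : ∀ b → ⟦ b ⟧ ≤ 1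
⟦ true  ⟧≤1 = ≤-refl
⟦ false ⟧≤1 = z≤n

-- A structured language compiled to the machine

-- The two memories are split into arrays: cell i of word array a lies at
-- address a + 16 i and cell i of real array a at a + 8 i beyond the input.
-- Word array 14 holds constants and word array 15 the loop counters; a
-- scalar is cell 0 of an array.

data Term (d : ℕ) : Set where
  lit     : ℕ → Term d
  con     : ℕ → Term d
  loop    : Fin d → Term d
  _[_]    : Fin 14 → Term d → Term d
  _⊞_ _⊟_ : Term d → Term d → Term d

data Cond (d : ℕ) : Set where
  _≺_         : Term d → Term d → Cond d
  _[_]≼_[_]   : Fin 8 → Term d → Fin 8 → Term d → Cond d
  !_          : Cond d → Cond d
  _&_         : Cond d → Cond d → Cond d

infixl 20 _[_]
infixl 10 _⊞_ _⊟_
infix  8  _≺_ _[_]≼_[_]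
infix  7  !_
infixr 6  _&_
infix  4  _[_]≔_ _[_]←_[_] _[_]←input_
infix  4  branch for
infixr 3  _▹_

-- The index counts the enclosing loops and so picks a fresh counter for the next one. A loop runs
-- as often as a constant says that no statement can alter; hence every statement halts, and `time`
-- is a function of the syntax and the constants.
data Stmt : ℕ → Set where
  nop          : ∀ {d} → Stmt d
  _[_]≔_       : ∀ {d} → Fin 14 → Term d → Term d → Stmt d
  _[_]←_[_]    : ∀ {d} → Fin 8 → Term d → Fin 8 → Term d → Stmt d
  _[_]←input_  : ∀ {d} → Fin 8 → Term d → Term d → Stmt d
  _▹_          : ∀ {d} → Stmt d → Stmt d → Stmt d
  branch       : ∀ {d} → Cond d → Stmt d → Stmt d → Stmt d
  for          : ∀ {d} → ℕ → Stmt (suc d) → Stmt d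

double : ℕ → ℕ
double m = m + m

-- The machine has no multiplication. With a power of two as stride, an address is computed by a
-- fixed number of additions.
slot : ℕ → ℕ → ℕ
slot a i = a + double (double (double (double i)))

rslot : ℕ → ℕ → ℕ
rslot a i = a + double (double (double i))

doubleᵉ : Expr → Expr
doubleᵉ e = e ⊕ e

slotᵉ : ℕ → Expr → Expr
slotᵉ a e = ` a ⊕ doubleᵉ (doubleᵉ (doubleᵉ (doubleᵉ e)))

-- The work area for reals starts behind the three input matrices; constant
-- 2 is the size of one of them.
baseᵉ : Expr
baseᵉ = W[ ` slot 14 2 ] ⊕ W[ ` slot 14 2 ] ⊕ W[ ` slot 14 2 ]

rslotᵉ : ℕ → Expr → Expr
rslotᵉ a e = baseᵉ ⊕ (` a ⊕ doubleᵉ (doubleᵉ (doubleᵉ e)))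

term : ∀ {d} → Term d → Expr
term (lit m)  = ` m
term (con c)  = W[ ` slot 14 c ]
term (loop x) = W[ ` slot 15 (toℕ x) ]
term (a [ e ]) = W[ slotᵉ (toℕ a) (term e) ]
term (e ⊞ f)  = term e ⊕ term f
term (e ⊟ f)  = term e ⊖ term f

cond : ∀ {d} → Cond d → Test
cond (e ≺ f)             = term e <ʷ term f
cond (a [ e ]≼ b [ f ]) = rslotᵉ (toℕ a) (term e) ≤ʳ rslotᵉ (toℕ b) (term f)
cond (! c)               = neg cond c
cond (c & c′)            = cond c and cond c′

counter : ℕ → Expr
counter d = ` slot 15 d

compile : ∀ {d} → Stmt d → Program
compile nop                  = skip
compile (a [ e ]≔ f)         = W[ slotᵉ (toℕ a) (term e) ]≔ term f
compile (a [ e ]← b [ f ])   =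
  R[ rslotᵉ (toℕ a) (term e) ]≔R[ rslotᵉ (toℕ b) (term f) ]
-- Nothing is known about the reals from `baseᵉ` on as input, so the guard, repeated in `exec`,
-- spares the compiler proof a side condition on the address.
compile (a [ e ]←input f)    =
  if term f <ʷ baseᵉ then R[ rslotᵉ (toℕ a) (term e) ]≔R[ term f ] else skip
compile (s ▹ s′)             = compile s ︔ compile s′
compile (branch c s s′)      = if cond c then compile s else compile s′
compile (for {d} c s)        =
  W[ counter d ]≔ ` 0 ︔
  while W[ counter d ] <ʷ W[ ` slot 14 c ] loop
    (compile s ︔ W[ counter d ]≔ W[ counter d ] ⊕ ` 1)

-- κ c is the value of constant c.
time : ∀ {d} → (ℕ → ℕ) → Stmt d → ℕ
time κ nop                = 1
time κ (a [ e ]≔ f)       = 1 + cost (slotᵉ (toℕ a) (term e)) + cost (term f)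
time κ (a [ e ]← b [ f ]) =
  2 + cost (rslotᵉ (toℕ a) (term e)) + cost (rslotᵉ (toℕ b) (term f))
time κ (a [ e ]←input f)  =
  1 + costᵗ (term f <ʷ baseᵉ) +
  (2 + cost (rslotᵉ (toℕ a) (term e)) + cost (term f))
time κ (s ▹ s′)           = time κ s + time κ s′
time κ (branch c s s′)    = 1 + costᵗ (cond c) + (time κ s + time κ s′)
-- Resetting the counter takes 3 steps and the last, failing test 6; each pass pays 6 for its test
-- and 6 for the increment.
time κ (for c s)          = 9 + κ c * (12 + time κ s)

-- Disjointness of the arrays

double-injective : ∀ {i j} → double i ≡ double j → i ≡ j
double-injective {i} {j} eq = *-cancelˡ-≡ i j 2 (begin
  i + (i + 0) ≡⟨ cong (i +_) (+-identityʳ i) ⟩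
  i + i       ≡⟨ eq ⟩
  j + j       ≡⟨ cong (j +_) (+-identityʳ j) ⟨
  j + (j + 0) ∎)
  where open ≡-Reasoning

double-* : ∀ i c → double (i * c) ≡ i * (c + c)
double-* i c = sym (*-distribˡ-+ i c c)

8i : ∀ i → double (double (double i)) ≡ i * 8
8i i = begin
  double (double (double i))       ≡⟨ cong (λ m → double (double (double m))) (*-identityʳ i) ⟨
  double (double (double (i * 1))) ≡⟨ cong (λ m → double (double m)) (double-* i 1) ⟩
  double (double (i * 2))          ≡⟨ cong double (double-* i 2) ⟩
  double (i * 4)                   ≡⟨ double-* i 4 ⟩
  i * 8                            ∎
  where open ≡-Reasoning

16i : ∀ i → double (double (double (double i))) ≡ i * 16
16i i = trans (cong double (8i i)) (double-* i 8)

-- The residue of an address modulo the stride 16 is the number of the array; what remains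
-- determines the cell.
slot-injective : ∀ a b i j → a < 16 → b < 16 → slot a i ≡ slot b j → a ≡ b × i ≡ j
slot-injective a b i j a<16 b<16 eq = a≡b ,
  double-injective (double-injective (double-injective (double-injective
    (+-cancelˡ-≡ a _ _ (trans eq (cong (_+ _) (sym a≡b)))))))
  where
  residue : ∀ a i → a < 16 → slot a i % 16 ≡ a
  residue a i a<16 = trans (cong (λ m → (a + m) % 16) (16i i))
                           (trans ([m+kn]%n≡m%n a i 16) (m<n⇒m%n≡m a<16))
  a≡b : a ≡ b
  a≡b = trans (sym (residue a i a<16)) (trans (cong (_% 16) eq) (residue b j b<16))

rslot-injective : ∀ a b i j → a < 8 → b < 8 → rslot a i ≡ rslot b j → a ≡ b × i ≡ j
rslot-injective a b i j a<8 b<8 eq = a≡b ,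
  double-injective (double-injective (double-injective
    (+-cancelˡ-≡ a _ _ (trans eq (cong (_+ _) (sym a≡b))))))
  where
  residue : ∀ a i → a < 8 → rslot a i % 8 ≡ a
  residue a i a<8 = trans (cong (λ m → (a + m) % 8) (8i i))
                          (trans ([m+kn]%n≡m%n a i 8) (m<n⇒m%n≡m a<8))
  a≡b : a ≡ b
  a≡b = trans (sym (residue a i a<8)) (trans (cong (_% 8) eq) (residue b j b<8))

base : (ℕ → ℕ) → ℕ
base κ = κ 2 + κ 2 + κ 2

update : ∀ {m} {A : Set} → (Fin m → ℕ → A) → Fin m → ℕ → A → Fin m → ℕ → A
update f a i x b = when does (a Fin.≟ b) then write (f b) i x else f b

small : ∀ (a : Fin 14) → toℕ a < 16
small a = <-trans (Fin.toℕ<n a) (s≤s (n≤1+n 14))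

14<16 : 14 < 16
14<16 = s≤s (n≤1+n 14)

-- Semantics of statements and correctness of the compiler

module Semantics (ℝ : RealNumbers) where

  private module ℝ = RealNumbers ℝ
  open State

  record Memory : Set where
    constructor memory
    field
      word : Fin 14 → ℕ → ℕ
      real : Fin 8 → ℕ → ℝ.Carrier

  open Memory public

  -- κ holds the constants, ρ the values of the enclosing loop counters.
  module _ (κ : ℕ → ℕ) (inp : ℕ → ℝ.Carrier) where

    value : ∀ {d} → (ℕ → ℕ) → Term d → Memory → ℕ
    value ρ (lit m)  μ = m
    value ρ (con c)  μ = κ c
    value ρ (loop x) μ = ρ (toℕ x)
    value ρ (a [ e ]) μ = word μ a (value ρ e μ)
    value ρ (e ⊞ f)  μ = value ρ e μ + value ρ f μ
    value ρ (e ⊟ f)  μ = value ρ e μ ∸ value ρ f μ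

    holds : ∀ {d} → (ℕ → ℕ) → Cond d → Memory → Bool
    holds ρ (e ≺ f) μ = does (value ρ e μ <? value ρ f μ)
    holds ρ (a [ e ]≼ b [ f ]) μ =
      does (real μ a (value ρ e μ) ℝ.≤? real μ b (value ρ f μ))
    holds ρ (! c) μ = not (holds ρ c μ)
    holds ρ (c & c′) μ = holds ρ c μ ∧ holds ρ c′ μ

    exec : ∀ {d} → (ℕ → ℕ) → Stmt d → Memory → Memory
    exec ρ nop μ = μ
    exec ρ (a [ e ]≔ f) μ =
      memory (update (word μ) a (value ρ e μ) (value ρ f μ)) (real μ)
    exec ρ (a [ e ]← b [ f ]) μ =
      memory (word μ) (update (real μ) a (value ρ e μ) (real μ b (value ρ f μ)))
    exec ρ (a [ e ]←input f) μ =
      when does (value ρ f μ <? base κ)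
      then memory (word μ) (update (real μ) a (value ρ e μ) (inp (value ρ f μ)))
      else μ
    exec ρ (s ▹ s′) μ = exec ρ s′ (exec ρ s μ)
    exec ρ (branch c s s′) μ = when holds ρ c μ then exec ρ s μ else exec ρ s′ μ
    exec ρ (for {d} c s) μ = iter (λ j → exec (write ρ d j) s) (κ c) μ

    record Represents (d : ℕ) (ρ : ℕ → ℕ) (σ : State ℝ) (μ : Memory) : Set where
      field
        constants : ∀ c → words σ (slot 14 c) ≡ κ c
        -- The counters from `d` on hold leftovers of finished inner loops, about which nothing is
        -- claimed.
        counters  : ∀ x → x < d → words σ (slot 15 x) ≡ ρ x
        wordCells : ∀ a i → words σ (slot (toℕ a) i) ≡ word μ a i
        realCells : ∀ a i → reals σ (base κ + rslot (toℕ a) i) ≡ real μ a i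
        inputs    : ∀ b → b < base κ → reals σ b ≡ inp b

    open Represents public

    module _ {d ρ σ μ} (rep : Represents d ρ σ μ) where

      eval-term : ∀ e → eval ℝ (term e) σ ≡ value ρ e μ
      eval-term (lit m)  = refl
      eval-term (con c)  = constants rep c
      eval-term (loop x) = counters rep (toℕ x) (Fin.toℕ<n x)
      eval-term (a [ e ]) = trans (cong (λ i → words σ (slot (toℕ a) i)) (eval-term e))
                                  (wordCells rep a _)
      eval-term (e ⊞ f)  = cong₂ _+_ (eval-term e) (eval-term f)
      eval-term (e ⊟ f)  = cong₂ _∸_ (eval-term e) (eval-term f)

      eval-base : eval ℝ baseᵉ σ ≡ base κ
      eval-base = cong (λ m → m + m + m) (constants rep 2)

      eval-slot : ∀ a e → eval ℝ (slotᵉ a (term e)) σ ≡ slot a (value ρ e μ)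
      eval-slot a e = cong (slot a) (eval-term e)

      eval-rslot : ∀ a e → eval ℝ (rslotᵉ a (term e)) σ ≡ base κ + rslot a (value ρ e μ)
      eval-rslot a e = cong₂ (λ b i → b + rslot a i) eval-base (eval-term e)

      real-read : ∀ a e → reals σ (eval ℝ (rslotᵉ (toℕ a) (term e)) σ) ≡
                  real μ a (value ρ e μ)
      real-read a e = trans (cong (reals σ) (eval-rslot (toℕ a) e)) (realCells rep a _)

      eval-cond : ∀ c → evalᵗ ℝ (cond c) σ ≡ holds ρ c μ
      eval-cond (e ≺ f) = cong₂ (λ x y → does (x <? y)) (eval-term e) (eval-term f)
      eval-cond (a [ e ]≼ b [ f ]) =
        cong₂ (λ x y → does (x ℝ.≤? y)) (real-read a e) (real-read b f)
      eval-cond (! c) = cong not (eval-cond c)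
      eval-cond (c & c′) = cong₂ _∧_ (eval-cond c) (eval-cond c′)

      represents-word : ∀ a i x {p} → p ≡ slot (toℕ a) i → Represents d ρ
        ⟪ write (words σ) p x , reals σ ⟫ (memory (update (word μ) a i x) (real μ))
      represents-word a i x refl = record
        { constants = λ c → trans (outside 14 c (<⇒≢ (Fin.toℕ<n a)) 14<16)
                                  (constants rep c)
        ; counters  = λ y y<d →
            trans (outside 15 y (<⇒≢ (<-trans (Fin.toℕ<n a) (n<1+n 14))) ≤-refl)
                  (counters rep y y<d)
        ; wordCells = inside
        ; realCells = realCells rep
        ; inputs    = inputs rep
        }
        where
        outside : ∀ b j → toℕ a ≢ b → b < 16 →
                  write (words σ) (slot (toℕ a) i) x (slot b j) ≡ words σ (slot b j)
        outside b j a≢b b<16 = write-other (words σ) _ x λ eq →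
          a≢b (sym (proj₁ (slot-injective b (toℕ a) j i b<16 (small a) eq)))
        inside : ∀ b j → write (words σ) (slot (toℕ a) i) x (slot (toℕ b) j) ≡
                 update (word μ) a i x b j
        inside b j with a Fin.≟ b
        ... | no a≢b =
              trans (outside (toℕ b) j (λ eq → a≢b (Fin.toℕ-injective eq)) (small b))
                    (wordCells rep b j)
        ... | yes refl with j ≟ i
        ...   | yes refl = write-same (words σ) (slot (toℕ a) i) x refl
        ...   | no j≢i   = trans (write-other (words σ) _ x λ eq →
                  j≢i (proj₂ (slot-injective (toℕ a) (toℕ a) j i (small a) (small a) eq)))
                  (wordCells rep b j)

      represents-real : ∀ a i x {p y} → p ≡ base κ + rslot (toℕ a) i → y ≡ x →
        Represents d ρ ⟪ words σ , write (reals σ) p y ⟫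
                       (memory (word μ) (update (real μ) a i x))
      represents-real a i x refl refl = record
        { constants = constants rep
        ; counters  = counters rep
        ; wordCells = wordCells rep
        ; realCells = inside
        ; inputs    = λ b b<base → trans
            (write-other (reals σ) _ x (<⇒≢ (<-≤-trans b<base (m≤m+n (base κ) _))))
            (inputs rep b b<base)
        }
        where
        inside : ∀ b j → write (reals σ) (base κ + rslot (toℕ a) i) x
                               (base κ + rslot (toℕ b) j) ≡
                 update (real μ) a i x b j
        inside b j with a Fin.≟ b
        ... | no a≢b = trans (write-other (reals σ) _ x λ eq →
                a≢b (Fin.toℕ-injective (sym (proj₁ (rslot-injective (toℕ b) (toℕ a) j i
                  (Fin.toℕ<n b) (Fin.toℕ<n a) (+-cancelˡ-≡ (base κ) _ _ eq))))))
                (realCells rep b j)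
        ... | yes refl with j ≟ i
        ...   | yes refl = write-same (reals σ) (base κ + rslot (toℕ a) i) x refl
        ...   | no j≢i   = trans (write-other (reals σ) _ x λ eq →
                  j≢i (proj₂ (rslot-injective (toℕ a) (toℕ a) j i (Fin.toℕ<n a) (Fin.toℕ<n a)
                    (+-cancelˡ-≡ (base κ) _ _ eq))))
                  (realCells rep b j)

      represents-counter : ∀ {i j} → i ≡ j → Represents (suc d) (write ρ d j)
        ⟪ write (words σ) (slot 15 d) i , reals σ ⟫ μ
      represents-counter {j = j} refl = record
        { constants = λ c → trans (other λ eq → 14≢15
            (proj₁ (slot-injective 14 15 c d 14<16 ≤-refl eq))) (constants rep c)
        ; counters  = current
        ; wordCells = λ a i → trans (other λ eq → <⇒≢
            (<-trans (Fin.toℕ<n a) (n<1+n 14))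
            (proj₁ (slot-injective (toℕ a) 15 i d (small a) ≤-refl eq))) (wordCells rep a i)
        ; realCells = realCells rep
        ; inputs    = inputs rep
        }
        where
        14≢15 : 14 ≢ 15
        14≢15 ()
        other : ∀ {p} → p ≢ slot 15 d →
                write (words σ) (slot 15 d) j p ≡ words σ p
        other = write-other (words σ) (slot 15 d) j
        current : ∀ x → x < suc d →
                  write (words σ) (slot 15 d) j (slot 15 x) ≡ write ρ d j x
        current x x<1+d with x ≟ d
        ... | yes refl = write-same (words σ) (slot 15 d) j refl
        ... | no x≢d   =
              trans (other λ eq → x≢d (proj₂ (slot-injective 15 15 x d ≤-refl ≤-refl eq)))
                    (counters rep x (≤∧≢⇒< (s≤s⁻¹ x<1+d) x≢d))

    forget-counter : ∀ {d ρ j σ μ} → Represents (suc d) (write ρ d j) σ μ →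
                     Represents d ρ σ μ
    forget-counter {d} {ρ} {j} rep = record
      { constants = constants rep
      ; counters  = λ x x<d → trans (counters rep x (m≤n⇒m≤1+n x<d))
                                    (write-other ρ d j (<⇒≢ x<d))
      ; wordCells = wordCells rep
      ; realCells = realCells rep
      ; inputs    = inputs rep
      }

    current-counter : ∀ {d ρ j σ μ} → Represents (suc d) (write ρ d j) σ μ →
                      words σ (slot 15 d) ≡ j
    current-counter {d} {ρ} {j} rep =
      trans (counters rep d ≤-refl) (write-same ρ d j refl)

    Correct : ∀ {d} → Stmt d → Set
    Correct {d} s = ∀ {ρ σ μ} → Represents d ρ σ μ →
      ∃[ τ ] ∃[ t ] Run ℝ (compile s) σ τ t × Represents d ρ τ (exec ρ s μ) × t ≤ time κ s

    module _ {d} (c : ℕ) (s : Stmt (suc d)) (correct : Correct s) where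

      private
        body : Program
        body = compile s ︔ W[ counter d ]≔ W[ counter d ] ⊕ ` 1

        loop-correct : ∀ {ρ μ} r j {σ} → j + r ≡ κ c →
          Represents (suc d) (write ρ d j) σ (iter (λ j → exec (write ρ d j) s) j μ) →
          ∃[ τ ] ∃[ t ] Run ℝ (while W[ counter d ] <ʷ W[ ` slot 14 c ] loop body) σ τ t
            × Represents d ρ τ (iter (λ j → exec (write ρ d j) s) (κ c) μ)
            × t ≤ 6 + r * (12 + time κ s)
        loop-correct {ρ} {μ} zero j {σ} j≡κ rep = σ , 6 ,
          while-stop (dec-false (_ <? _) λ lt →
            <-irrefl (trans (sym (+-identityʳ j)) j≡κ)
                     (subst₂ _<_ (current-counter rep) (constants rep c) lt)) ,
          subst (λ m → Represents d ρ σ (iter (λ j → exec (write ρ d j) s) m μ))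
                (trans (sym (+-identityʳ j)) j≡κ) (forget-counter rep) ,
          ≤-refl
        loop-correct {ρ} {μ} (suc r) j {σ} j+r≡κ rep
          with σ₁ , t₁ , run₁ , rep₁ , t₁≤ ← correct rep
          with σ₂ , t₂ , run₂ , rep₂ , t₂≤ ← loop-correct r (suc j)
                 (trans (sym (+-suc j r)) j+r≡κ)
                 (represents-counter (forget-counter rep₁)
                   (trans (cong (_+ 1) (current-counter rep₁)) (+-comm j 1)))
          = σ₂ , _ ,
            while-step (dec-true (_ <? _) (subst₂ _<_ (sym (current-counter rep))
                          (sym (constants rep c))
                          (subst (j <_) j+r≡κ (m<m+n j z<s))))
                       (seq run₁ assignʷ) run₂ , rep₂ ,
            bound t₁ t₂ t₁≤ t₂≤
          where
          open ≤-Reasoning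
          shuffle : ∀ b m → 6 + (b + 6) + (6 + m) ≡ 6 + (12 + b + m)
          shuffle = solve-∀
          bound : ∀ t₁ t₂ → t₁ ≤ time κ s → t₂ ≤ 6 + r * (12 + time κ s) →
                  6 + (t₁ + 6) + t₂ ≤ 6 + suc r * (12 + time κ s)
          bound t₁ t₂ t₁≤ t₂≤ = begin
            6 + (t₁ + 6) + t₂
              ≤⟨ +-mono-≤ (+-monoʳ-≤ 6 (+-monoˡ-≤ 6 t₁≤)) t₂≤ ⟩
            6 + (time κ s + 6) + (6 + r * (12 + time κ s))
              ≡⟨ shuffle (time κ s) (r * (12 + time κ s)) ⟩
            6 + suc r * (12 + time κ s) ∎

      for-correct : Correct (for c s)
      for-correct {ρ} {σ} {μ} rep
        with τ , t , run , rep′ , t≤ ← loop-correct (κ c) 0 refl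
               (represents-counter rep {j = 0} refl)
        = τ , _ , seq assignʷ run , rep′ , +-monoʳ-≤ 3 t≤

    compile-correct : ∀ {d} (s : Stmt d) → Correct s
    compile-correct nop rep = _ , _ , skip , rep , ≤-refl
    compile-correct (a [ e ]≔ f) {ρ} {σ} {μ} rep = _ , _ , assignʷ ,
      subst (λ x → Represents _ ρ ⟪ write (words σ) _ x , reals σ ⟫
                     (exec ρ (a [ e ]≔ f) μ))
            (sym (eval-term rep f))
            (represents-word rep a (value ρ e μ) (value ρ f μ) (eval-slot rep (toℕ a) e)) ,
      ≤-refl
    compile-correct (a [ e ]← b [ f ]) {ρ} {σ} {μ} rep = _ , _ , assignʳ ,
      represents-real rep a (value ρ e μ) _ (eval-rslot rep (toℕ a) e) (real-read rep b f) ,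
      ≤-refl
    compile-correct (a [ e ]←input f) {ρ} {σ} {μ} rep
      with value ρ f μ <ᵇ base κ in eq
    ... | true = _ , _ , if-true (trans test eq) assignʳ ,
      represents-real rep a (value ρ e μ) _ (eval-rslot rep (toℕ a) e)
        (trans (cong (reals σ) (eval-term rep f))
               (inputs rep _ (<ᵇ⇒< _ _ (subst T (sym eq) tt)))) ,
      ≤-refl
      where
      test : evalᵗ ℝ (term f <ʷ baseᵉ) σ ≡ (value ρ f μ <ᵇ base κ)
      test = cong₂ _<ᵇ_ (eval-term rep f) (eval-base rep)
    ... | false = _ , _ , if-false (trans test eq) skip ,
      rep , +-monoʳ-≤ (1 + costᵗ (term f <ʷ baseᵉ)) (s≤s z≤n)
      where
      test : evalᵗ ℝ (term f <ʷ baseᵉ) σ ≡ (value ρ f μ <ᵇ base κ)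
      test = cong₂ _<ᵇ_ (eval-term rep f) (eval-base rep)
    compile-correct (s ▹ s′) rep
      with _ , _ , run , rep₁ , t≤ ← compile-correct s rep
      with _ , _ , run′ , rep₂ , t′≤ ← compile-correct s′ rep₁
      = _ , _ , seq run run′ , rep₂ , +-mono-≤ t≤ t′≤
    compile-correct (branch c s s′) {ρ} {σ} {μ} rep
      with holds ρ c μ in eq
    ... | true with _ , _ , run , rep′ , t≤ ← compile-correct s rep =
          _ , _ , if-true (trans (eval-cond rep c) eq) run , rep′ ,
          +-monoʳ-≤ (1 + costᵗ (cond c)) (m≤n⇒m≤n+o _ t≤)
    ... | false with _ , _ , run , rep′ , t≤ ← compile-correct s′ rep =
          _ , _ , if-false (trans (eval-cond rep c) eq) run , rep′ ,
          +-monoʳ-≤ (1 + costᵗ (cond c)) (m≤n⇒m≤o+n _ t≤)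
    compile-correct (for c s) = for-correct c s (compile-correct s)

-- Frame conditions

writesWord : ∀ {d} → Fin 14 → Stmt d → Bool
writesWord a nop = false
writesWord a (b [ e ]≔ f) = does (b Fin.≟ a)
writesWord a (b [ e ]← c [ f ]) = false
writesWord a (b [ e ]←input f) = false
writesWord a (s ▹ s′) = writesWord a s ∨ writesWord a s′
writesWord a (branch c s s′) = writesWord a s ∨ writesWord a s′
writesWord a (for c s) = writesWord a s

writesReal : ∀ {d} → Fin 8 → Stmt d → Bool
writesReal a nop = false
writesReal a (b [ e ]≔ f) = false
writesReal a (b [ e ]← c [ f ]) = does (b Fin.≟ a)
writesReal a (b [ e ]←input f) = does (b Fin.≟ a)
writesReal a (s ▹ s′) = writesReal a s ∨ writesReal a s′
writesReal a (branch c s s′) = writesReal a s ∨ writesReal a s′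
writesReal a (for c s) = writesReal a s

∨-false : ∀ {a b} → a ∨ b ≡ false → a ≡ false × b ≡ false
∨-false {false} eq = refl , eq

update-other : ∀ {m} {A : Set} (f : Fin m → ℕ → A) a i x b →
               does (a Fin.≟ b) ≡ false → update f a i x b ≡ f b
update-other f a i x b eq rewrite eq = refl

module _ (ℝ : RealNumbers) (κ : ℕ → ℕ) (inp : ℕ → RealNumbers.Carrier ℝ) where

  open Semantics ℝ

  -- The premise is a computation on the syntax, so for a concrete statement it is proved by `refl`.
  word-frame : ∀ a {d} ρ (s : Stmt d) μ → writesWord a s ≡ false →
               word (exec κ inp ρ s μ) a ≡ word μ a
  word-frame a ρ nop μ fr = refl
  word-frame a ρ (b [ e ]≔ f) μ fr = update-other (word μ) b _ _ a fr
  word-frame a ρ (b [ e ]← c [ f ]) μ fr = refl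
  word-frame a ρ (b [ e ]←input f) μ fr with value κ inp ρ f μ <ᵇ base κ
  ... | true  = refl
  ... | false = refl
  word-frame a ρ (s ▹ s′) μ fr =
    trans (word-frame a ρ s′ _ (proj₂ (∨-false fr)))
          (word-frame a ρ s μ (proj₁ (∨-false fr)))
  word-frame a ρ (branch c s s′) μ fr with holds κ inp ρ c μ
  ... | true  = word-frame a ρ s μ (proj₁ (∨-false fr))
  ... | false = word-frame a ρ s′ μ (proj₂ (∨-false {writesWord a s} fr))
  word-frame a ρ (for c s) μ fr = iter-induction (λ _ μ′ → word μ′ a ≡ word μ a) (κ c)
    refl (λ _ eq → trans (word-frame a _ s _ fr) eq)

  real-frame : ∀ a {d} ρ (s : Stmt d) μ → writesReal a s ≡ false →
               real (exec κ inp ρ s μ) a ≡ real μ a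
  real-frame a ρ nop μ fr = refl
  real-frame a ρ (b [ e ]≔ f) μ fr = refl
  real-frame a ρ (b [ e ]← c [ f ]) μ fr = update-other (real μ) b _ _ a fr
  real-frame a ρ (b [ e ]←input f) μ fr with value κ inp ρ f μ <ᵇ base κ
  ... | true  = update-other (real μ) b _ _ a fr
  ... | false = refl
  real-frame a ρ (s ▹ s′) μ fr =
    trans (real-frame a ρ s′ _ (proj₂ (∨-false fr)))
          (real-frame a ρ s μ (proj₁ (∨-false fr)))
  real-frame a ρ (branch c s s′) μ fr with holds κ inp ρ c μ
  ... | true  = real-frame a ρ s μ (proj₁ (∨-false fr))
  ... | false = real-frame a ρ s′ μ (proj₂ (∨-false {writesReal a s} fr))
  real-frame a ρ (for c s) μ fr = iter-induction (λ _ μ′ → real μ′ a ≡ real μ a) (κ c)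
    refl (λ _ eq → trans (real-frame a _ s _ fr) eq)

-- Running times read off the syntax

-- The exponents of |X|, k and the number of attempts in a monomial.
Degree : Set
Degree = ℕ × ℕ × ℕ

-- The constants 0 to 4 of the search are |X|, k, the square of |X|, 2 k + 1 and 9 ^ k (see
-- `searchConstants`). The factor 3 of constant 3 comes from bounding 2 k + 1 by three times the
-- maximum of 1 and k.
conDegree : ℕ → Degree
conDegree 0 = 1 , 0 , 0
conDegree 1 = 0 , 1 , 0
conDegree 2 = 2 , 0 , 0
conDegree 3 = 0 , 1 , 0
conDegree _ = 0 , 0 , 1

conFactor : ℕ → ℕ
conFactor 3 = 3
conFactor _ = 1

degree : ∀ {d} → Stmt d → Degree
degree (s ▹ s′) with degree s | degree s′
... | i , j , l | i′ , j′ , l′ = i ⊔ i′ , j ⊔ j′ , l ⊔ l′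
degree (branch c s s′) with degree s | degree s′
... | i , j , l | i′ , j′ , l′ = i ⊔ i′ , j ⊔ j′ , l ⊔ l′
degree (for c s) with conDegree c | degree s
... | i , j , l | i′ , j′ , l′ = i + i′ , j + j′ , l + l′
degree _ = 0 , 0 , 0

factor : ∀ {d} → Stmt d → ℕ
factor (s ▹ s′)        = factor s + factor s′
factor (branch c s s′) = 1 + costᵗ (cond c) + (factor s + factor s′)
factor (for c s)       = 9 + conFactor c * (12 + factor s)
factor s               = time (λ _ → 0) s

module _ (a b p : ℕ) .{{_ : NonZero a}} .{{_ : NonZero b}} .{{_ : NonZero p}} where

  monomial : Degree → ℕ
  monomial (i , j , l) = a ^ i * b ^ j * p ^ l

  1≤monomial : ∀ δ → 1 ≤ monomial δ
  1≤monomial (i , j , l) = *-mono-≤ (*-mono-≤ (m^n>0 a i) (m^n>0 b j)) (m^n>0 p l)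

  monomial-mono : ∀ {i j l i′ j′ l′} → i ≤ i′ → j ≤ j′ → l ≤ l′ →
                  monomial (i , j , l) ≤ monomial (i′ , j′ , l′)
  monomial-mono i≤ j≤ l≤ =
    *-mono-≤ (*-mono-≤ (^-monoʳ-≤ a i≤) (^-monoʳ-≤ b j≤)) (^-monoʳ-≤ p l≤)

  monomial-* : ∀ i j l i′ j′ l′ →
    monomial (i , j , l) * monomial (i′ , j′ , l′) ≡ monomial (i + i′ , j + j′ , l + l′)
  monomial-* i j l i′ j′ l′
    rewrite ^-distribˡ-+-* a i i′ | ^-distribˡ-+-* b j j′ | ^-distribˡ-+-* p l l′ =
    rearrange (a ^ i) (b ^ j) (p ^ l) (a ^ i′) (b ^ j′) (p ^ l′)
    where
    rearrange : ∀ x y z x′ y′ z′ →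
                x * y * z * (x′ * y′ * z′) ≡ x * x′ * (y * y′) * (z * z′)
    rearrange = solve-∀

  module _ (κ : ℕ → ℕ) (κ≤ : ∀ c → κ c ≤ conFactor c * monomial (conDegree c)) where

    private
      atom : ∀ m → m ≤ m * monomial (0 , 0 , 0)
      atom m = m≤m*n m (monomial (0 , 0 , 0))

      join : ∀ {t t′ f f′ i j l i′ j′ l′} →
             t ≤ f * monomial (i , j , l) → t′ ≤ f′ * monomial (i′ , j′ , l′) →
             t + t′ ≤ (f + f′) * monomial (i ⊔ i′ , j ⊔ j′ , l ⊔ l′)
      join {t} {t′} {f} {f′} {i} {j} {l} {i′} {j′} {l′} t≤ t′≤ = begin
        t + t′             ≤⟨ +-mono-≤ t≤ t′≤ ⟩
        f * monomial (i , j , l) + f′ * monomial (i′ , j′ , l′)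
          ≤⟨ +-mono-≤ (*-monoʳ-≤ f (monomial-mono {i} {j} {l} (m≤m⊔n i i′) (m≤m⊔n j j′) (m≤m⊔n l l′)))
                      (*-monoʳ-≤ f′ (monomial-mono (m≤n⊔m i i′) (m≤n⊔m j j′) (m≤n⊔m l l′))) ⟩
        f * m + f′ * m     ≡⟨ *-distribʳ-+ m f f′ ⟨
        (f + f′) * m       ∎
        where
        open ≤-Reasoning
        m = monomial (i ⊔ i′ , j ⊔ j′ , l ⊔ l′)

    -- Nesting adds exponents and sequencing takes their maximum. The bases are nonzero, so a
    -- smaller power is absorbed by a larger one, and all constants gather in `factor`.
    time≤ : ∀ {d} (s : Stmt d) → time κ s ≤ factor s * monomial (degree s)
    time≤ nop = atom 1
    time≤ (a [ e ]≔ f) = atom (time (λ _ → 0) (a [ e ]≔ f))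
    time≤ (a [ e ]← b [ f ]) = atom (time (λ _ → 0) (a [ e ]← b [ f ]))
    time≤ (a [ e ]←input f) = atom (time (λ _ → 0) (a [ e ]←input f))
    time≤ (s ▹ s′) with degree s | time≤ s | degree s′ | time≤ s′
    ... | i , j , l | s≤ | i′ , j′ , l′ | s′≤ =
      join {f = factor s} {factor s′} {i} {j} {l} {i′} {j′} {l′} s≤ s′≤
    time≤ (branch c s s′) with degree s | time≤ s | degree s′ | time≤ s′
    ... | i , j , l | s≤ | i′ , j′ , l′ | s′≤ = begin
      m + (time κ s + time κ s′)
        ≤⟨ join {f = m} {factor s + factor s′} {0} {0} {0} {i ⊔ i′} {j ⊔ j′} {l ⊔ l′} (atom m)
             (join {f = factor s} {factor s′} {i} {j} {l} {i′} {j′} {l′} s≤ s′≤) ⟩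
      (m + (factor s + factor s′)) * monomial (i ⊔ i′ , j ⊔ j′ , l ⊔ l′) ∎
      where
      open ≤-Reasoning
      m = 1 + costᵗ (cond c)
    time≤ (for c s) with conDegree c | κ≤ c | degree s | time≤ s
    ... | i , j , l | κ≤c | i′ , j′ , l′ | s≤ = begin
      9 + κ c * (12 + time κ s)
        ≤⟨ +-mono-≤ (m≤m*n 9 (x * y)) (*-mono-≤ κ≤c (+-mono-≤ (m≤m*n 12 y) s≤)) ⟩
      9 * (x * y) + f * x * (12 * y + g * y)
        ≡⟨ collect f g x y ⟩
      (9 + f * (12 + g)) * (x * y)
        ≡⟨ cong ((9 + f * (12 + g)) *_) (monomial-* i j l i′ j′ l′) ⟩
      (9 + f * (12 + g)) * monomial (i + i′ , j + j′ , l + l′) ∎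
      where
      open ≤-Reasoning
      x = monomial (i , j , l)
      y = monomial (i′ , j′ , l′)
      f = conFactor c
      g = factor s
      instance
        y≢0 : NonZero y
        y≢0 = >-nonZero (1≤monomial (i′ , j′ , l′))
        xy≢0 : NonZero (x * y)
        xy≢0 = m*n≢0 x y {{>-nonZero (1≤monomial (i , j , l))}} {{y≢0}}
      collect : ∀ f g x y → 9 * (x * y) + f * x * (12 * y + g * y) ≡
                            (9 + f * (12 + g)) * (x * y)
      collect = solve-∀

-- Detecting a violated triangle of maximal height

module Order (ℝ : RealNumbers) where

  commutativeRing : CommutativeRing 0ℓ 0ℓ
  commutativeRing = record { isCommutativeRing = RealNumbers.isCommutativeRing ℝ }

  open RealNumbers ℝ public using () renaming (Carrier to C; _≤_ to _≼_; _≤?_ to _≼?_)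
  open IsDecTotalOrder (RealNumbers.isDecTotalOrder ℝ) public
    using () renaming (refl to ≼-refl; trans to ≼-trans; total to ≼-total;
                       antisym to ≼-antisym; reflexive to ≼-reflexive)

  ⋠⇒≽ : ∀ {x y} → ¬ x ≼ y → y ≼ x
  ⋠⇒≽ {x} {y} x⋠y with ≼-total x y
  ... | inj₁ x≼y = contradiction x≼y x⋠y
  ... | inj₂ y≼x = y≼x

  -- The witness is the larger of `y` and `z`. It serves as the threshold at which a strict
  -- violation contradicts a statement about all `t`.
  ⋠-max : ∀ {x y z} → ¬ x ≼ y → ¬ x ≼ z → ∃[ t ] y ≼ t × z ≼ t × ¬ x ≼ t
  ⋠-max {x} {y} {z} x⋠y x⋠z with ≼-total y z
  ... | inj₁ y≼z = z , y≼z , ≼-refl , x⋠z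
  ... | inj₂ z≼y = y , ≼-refl , z≼y , x⋠y

<ᵇ-mono : ∀ a b c d → (a < b → c < d) → ⟦ a <ᵇ b ⟧ ≤ ⟦ c <ᵇ d ⟧
<ᵇ-mono a b c d f with a <ᵇ b | <ᵇ-reflects-< a b
... | _ | ofⁿ _ = z≤n
... | _ | ofʸ p rewrite dec-true (c <? d) (f p) = ≤-refl

module Detection (ℝ : RealNumbers) (n : ℕ) where

  open Order ℝ

  -- The long side joins `c₂` to `c₀` and the short sides meet in `c₁`. A value of `c₀` of at least
  -- `n` encodes that no violation was found.
  record Conflict : Set where
    constructor conflict
    field
      top      : C
      c₀ c₁ c₂ : ℕ

  open Conflict public

  -- Prim's algorithm.  A vertex x lies in the tree iff n ≤ parent x.  The
  -- key of an outer vertex is its distance to the tree, attained at its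
  -- parent; the key of a tree vertex x is the largest distance at which a
  -- vertex was attached to the tree since x was.
  record Prim : Set where
    constructor prim
    field
      parent : ℕ → ℕ
      key    : ℕ → C
      worst  : Conflict

  open Prim public

  outer : (ℕ → ℕ) → ℕ → Bool
  outer parent x = does (parent x <? n)

  -- The default `n`, which is no vertex, tells that the tree already spans all points.
  pick : (ℕ → ℕ) → (ℕ → C) → ℕ → ℕ
  pick parent key m = iter (λ x b →
    when outer parent x ∧ not (does (b <? n) ∧ does (key b ≼? key x))
    then x else b) m n

  module _ (L : ℕ → ℕ → C) where

    module _ (parent : ℕ → ℕ) (key : ℕ → C) (v : ℕ) where

      -- During its visit `v` still counts as outer. Its own key thus drops to at most `L v v`,
      -- which no entry of a `Symmetric` matrix undercuts: since `v` was attached, nothing else has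
      -- been.
      newKey : ℕ → C
      newKey x = when outer parent x
                 then (when does (key x ≼? L v x) then key x else L v x)
                 else (when does (key x ≼? key v) then key v else key x)

      newParent : ℕ → ℕ
      newParent x = when outer parent x
                    then (when does (key x ≼? L v x) then parent x else v)
                    else parent x

      scan : (ℕ → C) → ℕ → Conflict → Conflict
      scan K x c = when outer parent x then c else
        (when not (does (L v x ≼? K x)) ∧ not (does (L v x ≼? top c))
         then conflict (L v x) x (parent v) v else c)

    visit : ℕ → Prim → Prim
    visit v (prim parent key worst) =
      prim (write (newParent parent key v) v n) (newKey parent key v)
           (iter (scan parent key v (newKey parent key v)) n worst)

    advance : Prim → Prim
    advance s = let v = pick (parent s) (key s) n in
      when does (v <? n) then visit v s else s

    start : Prim
    -- A diagonal entry is a lower bound of all entries and thus replaces minus infinity as the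
    -- height of the empty record.
    start = prim (write (λ _ → 0) 0 n) (L 0) (conflict (L 0 0) n 0 0)

    -- Opaque, since unfolding the iteration makes conversion checks explode.
    opaque
      detect : Conflict
      detect = worst (iter (λ _ → advance) n start)

      detect-≡ : detect ≡ worst (iter (λ _ → advance) n start)
      detect-≡ = refl

    record Valid (c : Conflict) : Set where
      field
        c₀<n   : c₀ c < n
        c₁<n   : c₁ c < n
        c₂<n   : c₂ c < n
        height : top c ≡ L (c₂ c) (c₀ c)
        side₀₁ : ¬ top c ≼ L (c₀ c) (c₁ c)
        side₁₂ : ¬ top c ≼ L (c₁ c) (c₂ c)

    -- In the second case the recorded height is still below every entry, so that `Ultra` at this
    -- height is the full ultrametric inequality.
    Sound : Conflict → Set
    Sound c = Valid c ⊎ (n ≤ c₀ c × (∀ {x y} → x < n → y < n → top c ≼ L x y))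

    -- Raising all entries of L to at least h makes it an ultrametric.
    Ultra : C → Set
    Ultra h = ∀ {x y z} → x < n → y < n → z < n →
              ∀ {t} → L x y ≼ t → L y z ≼ t → h ≼ t → L x z ≼ t

    record Symmetric : Set where
      field
        sym≼  : ∀ {x y} → x < n → y < n → L x y ≼ L y x
        diag≼ : ∀ {v x y} → v < n → x < n → y < n → L v v ≼ L x y

    pick-least : ∀ parent key → let b = pick parent key n in
      (b ≡ n × ∀ {x} → x < n → n ≤ parent x) ⊎
      (b < n × parent b < n × ∀ {x} → x < n → parent x < n → key b ≼ key x)
    pick-least parent key with iter-induction I n none (λ {j} {b} → step j b)
      where
      I : ℕ → ℕ → Set
      I j b = (b ≡ n × ∀ x → x < j → n ≤ parent x) ⊎
              (b < n × parent b < n × ∀ x → x < j → parent x < n → key b ≼ key x)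
      none : I 0 n
      none = inj₁ (refl , λ _ ())
      step : ∀ j b → j < n → I j b →
             I (suc j) (when outer parent j ∧ not (does (b <? n) ∧ does (key b ≼? key j))
                        then j else b)
      step j b j<n I with parent j <ᵇ n | <ᵇ-reflects-< (parent j) n
      step j b j<n (inj₁ (b≡n , ins)) | _ | ofⁿ ≮n =
        inj₁ (b≡n , below-suc (λ x → n ≤ parent x) ins (≮⇒≥ ≮n))
      step j b j<n (inj₂ (b<n , out , le)) | _ | ofⁿ ≮n =
        inj₂ (b<n , out , below-suc (λ x → parent x < n → key b ≼ key x) le
                            (λ <n → contradiction <n ≮n))
      step j b j<n I | _ | ofʸ <n with b <ᵇ n | <ᵇ-reflects-< b n
      step j b j<n (inj₂ (b<n , _)) | _ | ofʸ <n | _ | ofⁿ b≮n = contradiction b<n b≮n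
      step j b j<n (inj₁ (b≡n , ins)) | _ | ofʸ <n | _ | ofⁿ b≮n =
        inj₂ (j<n , <n , below-suc (λ x → parent x < n → key j ≼ key x)
                (λ x x<j out → contradiction (ins x x<j) (<⇒≱ out)) (λ _ → ≼-refl))
      step j b j<n (inj₁ (refl , _)) | _ | ofʸ <n | _ | ofʸ b<n = contradiction b<n (<-irrefl refl)
      step j b j<n (inj₂ (_ , out , le)) | _ | ofʸ <n | _ | ofʸ b<n with key b ≼? key j
      ... | yes b≼j = inj₂ (b<n , out ,
              below-suc (λ x → parent x < n → key b ≼ key x) le (λ _ → b≼j))
      ... | no  b⋠j = inj₂ (j<n , <n , below-suc (λ x → parent x < n → key j ≼ key x)
              (λ x x<j o → ≼-trans (⋠⇒≽ b⋠j) (le x x<j o)) (λ _ → ≼-refl))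
    ... | inj₁ (b≡n , ins) = inj₁ (b≡n , λ {x} → ins x)
    ... | inj₂ (b<n , out , le) = inj₂ (b<n , out , λ {x} → le x)

    -- On the tree, the key of `x` is the minimax path distance from `x` to the vertex attached
    -- last. `key≼` is then the strong triangle inequality of minimax distances. `≼key` holds
    -- because an entry exceeding the minimax distance of its endpoints has been recorded and lies
    -- below the top. `inner≼` is the greedy property: every attachment made after that of `x` was
    -- no longer than an edge from `x` to a vertex that is still outer.
    record Invariant (s : Prim) : Set where
      field
        ultra   : ∀ {x y z} → x < n → y < n → z < n →
                  n ≤ parent s x → n ≤ parent s y → n ≤ parent s z →
                  ∀ {t} → L x y ≼ t → L y z ≼ t → top (worst s) ≼ t → L x z ≼ t
        key≼    : ∀ {x y} → x < n → y < n → n ≤ parent s x → n ≤ parent s y →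
                  ∀ {t} → L x y ≼ t → key s y ≼ t → key s x ≼ t
        ≼key    : ∀ {x y} → x < n → y < n → n ≤ parent s x → n ≤ parent s y →
                  ∀ {t} → key s x ≼ t → key s y ≼ t → top (worst s) ≼ t → L x y ≼ t
        inner≼  : ∀ {x w} → x < n → w < n → n ≤ parent s x → parent s w < n →
                  key s x ≼ L x w
        outer≼  : ∀ {x w} → x < n → w < n → n ≤ parent s x → parent s w < n →
                  key s w ≼ L x w
        attained : ∀ {w} → w < n → parent s w < n →
                  n ≤ parent s (parent s w) × L (parent s w) w ≼ key s w
        sound   : Sound (worst s)

    module _ (L-sym : Symmetric) where

      open Symmetric L-sym

      start-invariant : 0 < n → Invariant start
      start-invariant 0<n = record
        { ultra   = λ x<n y<n z<n x∈ y∈ z∈ p q r → ultra x<n z<n x∈ z∈ r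
        ; key≼    = λ x<n y<n x∈ y∈ {t} p q → subst (λ z → L 0 z ≼ t) (sym (root x<n x∈))
                      (≼-trans (diag≼ 0<n 0<n y<n) q)
        ; ≼key    = λ x<n y<n x∈ y∈ p q r → ultra x<n y<n x∈ y∈ r
        ; inner≼  = λ {x} {w} x<n w<n x∈ _ → subst (λ z → L 0 z ≼ L x w) (sym (root x<n x∈))
                      (diag≼ 0<n x<n w<n)
        ; outer≼  = λ {x} {w} x<n w<n x∈ _ →
                      subst (λ z → L 0 w ≼ L z w) (sym (root x<n x∈)) ≼-refl
        ; attained = attained
        ; sound   = inj₂ (≤-refl , diag≼ 0<n)
        }
        where
        root : ∀ {x} → x < n → n ≤ write (λ _ → 0) 0 n x → x ≡ 0
        root {x} x<n x∈ with x ≟ 0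
        ... | yes x≡0 = x≡0
        ... | no  _   = contradiction (<-≤-trans x<n x∈) λ ()
        ultra : ∀ {x z t} → x < n → z < n →
                n ≤ write (λ _ → 0) 0 n x → n ≤ write (λ _ → 0) 0 n z →
                L 0 0 ≼ t → L x z ≼ t
        ultra x<n z<n x∈ z∈ r with refl ← root x<n x∈ | refl ← root z<n z∈ = r
        attained : ∀ {w} → w < n → write (λ _ → 0) 0 n w < n →
          n ≤ write (λ _ → 0) 0 n (write (λ _ → 0) 0 n w) ×
          L (write (λ _ → 0) 0 n w) w ≼ L 0 w
        attained {w} w<n out with w ≟ 0
        ... | yes _ = contradiction out (<-irrefl refl)
        ... | no  _ = ≤-refl , ≼-refl

      module _ {par ky wr} (inv : Invariant (prim par ky wr)) {v} (v<n : v < n)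
               (v-outer : par v < n)
               (least : ∀ {x} → x < n → par x < n → ky v ≼ ky x) where

        open Invariant inv

        private
          s = prim par ky wr
          s′ = visit v s

          K = newKey par ky v

        key-inner : ∀ {x} → n ≤ par x → ky x ≼ K x
        key-inner {x} x∈ with par x <ᵇ n | <ᵇ-reflects-< (par x) n
        ... | _ | ofʸ x∉ = contradiction x∈ (<⇒≱ x∉)
        ... | _ | ofⁿ  _  with ky x ≼? ky v
        ...   | yes p = p
        ...   | no  _ = ≼-refl

        key-inner′ : ∀ {x} → n ≤ par x → ky v ≼ K x
        key-inner′ {x} x∈ with par x <ᵇ n | <ᵇ-reflects-< (par x) n
        ... | _ | ofʸ x∉ = contradiction x∈ (<⇒≱ x∉)
        ... | _ | ofⁿ  _  with ky x ≼? ky v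
        ...   | yes _ = ≼-refl
        ...   | no  p = ⋠⇒≽ p

        key-lub : ∀ {x t} → n ≤ par x → ky x ≼ t → ky v ≼ t → K x ≼ t
        key-lub {x} x∈ p q with par x <ᵇ n | <ᵇ-reflects-< (par x) n
        ... | _ | ofʸ x∉ = contradiction x∈ (<⇒≱ x∉)
        ... | _ | ofⁿ  _  with ky x ≼? ky v
        ...   | yes _ = q
        ...   | no  _ = p

        key-outer : ∀ {x} → par x < n → K x ≼ ky x
        key-outer {x} x∉ with par x <ᵇ n | <ᵇ-reflects-< (par x) n
        ... | _ | ofⁿ x∈ = contradiction x∉ x∈
        ... | _ | ofʸ _ with ky x ≼? L v x
        ...   | yes _ = ≼-refl
        ...   | no  p = ⋠⇒≽ p

        key-outer′ : ∀ {x} → par x < n → K x ≼ L v x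
        key-outer′ {x} x∉ with par x <ᵇ n | <ᵇ-reflects-< (par x) n
        ... | _ | ofⁿ x∈ = contradiction x∉ x∈
        ... | _ | ofʸ _ with ky x ≼? L v x
        ...   | yes p = p
        ...   | no  _ = ≼-refl

        inside : ∀ {x} → n ≤ parent s′ x → x ≡ v ⊎ n ≤ par x
        inside {x} x∈ with x ≟ v
        ... | yes x≡v = inj₁ x≡v
        ... | no  _   with par x <ᵇ n | <ᵇ-reflects-< (par x) n
        ...   | _ | ofⁿ x∉ = inj₂ (≮⇒≥ x∉)
        ...   | _ | ofʸ x∉ with ky x ≼? L v x
        ...     | yes _ = contradiction x∈ (<⇒≱ x∉)
        ...     | no  _ = contradiction x∈ (<⇒≱ v<n)

        inside-v : n ≤ parent s′ v
        inside-v = ≤-reflexive (sym (write-same (newParent par ky v) v n refl))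

        inside-old : ∀ {x} → n ≤ par x → n ≤ parent s′ x
        inside-old {x} x∈ with x ≟ v
        ... | yes _ = ≤-refl
        ... | no  _ with par x <ᵇ n | <ᵇ-reflects-< (par x) n
        ...   | _ | ofⁿ  _  = x∈
        ...   | _ | ofʸ x∉ = contradiction x∈ (<⇒≱ x∉)

        outside : ∀ {x} → parent s′ x < n → par x < n
        outside {x} x∉ with par x <ᵇ n | <ᵇ-reflects-< (par x) n
        ... | _ | ofʸ p = p
        ... | _ | ofⁿ  p = contradiction (inside-old (≮⇒≥ p)) (<⇒≱ x∉)

        visit-attained : ∀ {w} → w < n → parent s′ w < n →
          n ≤ parent s′ (parent s′ w) × L (parent s′ w) w ≼ K w
        visit-attained {w} w<n w∉ with w ≟ v
        ... | yes _ = contradiction w∉ (<-irrefl refl)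
        ... | no  _ with par w <ᵇ n | <ᵇ-reflects-< (par w) n
        ...   | _ | ofⁿ  p = contradiction w∉ p
        ...   | _ | ofʸ p with ky w ≼? L v w
        ...     | no  _ = inside-v , ≼-refl
        ...     | yes _ = inside-old (proj₁ (attained w<n p)) , proj₂ (attained w<n p)

        -- The scan depends on the new keys only through these two lower bounds, so they are made
        -- abstract.
        module _ (K : ℕ → C) (key-inner : ∀ {x} → n ≤ par x → ky x ≼ K x)
                 (key-inner′ : ∀ {x} → n ≤ par x → ky v ≼ K x) where

          Scanned : ℕ → Conflict → Set
          Scanned j c = top wr ≼ top c × Sound c ×
            (∀ x → x < j → n ≤ par x → ∀ {t} → K x ≼ t → top c ≼ t → L v x ≼ t)

          -- The edge from `v` to its parent is at most `ky v`, hence at most `K x`, and `L v x`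
          -- exceeds that. The edge from `x` to the parent was examined earlier: by `≼key` it is
          -- bounded by keys that are at most `K x` or by the recorded top, and `L v x` exceeds
          -- both. So the parent is the third vertex of a violated triangle, without any search for
          -- it.
          valid : ∀ {x c} → x < n → n ≤ par x → top wr ≼ top c →
                  ¬ L v x ≼ K x → ¬ L v x ≼ top c →
                  Valid (conflict (L v x) x (par v) v)
          valid {x} {c} x<n x∈ wr≼c vx⋠K vx⋠c = record
            { c₀<n   = x<n
            ; c₁<n   = v-outer
            ; c₂<n   = v<n
            ; height = refl
            ; side₀₁ = λ le → let (t , K≼t , c≼t , vx⋠t) = ⋠-max vx⋠K vx⋠c
                                  kv≼t = ≼-trans (key-inner′ x∈) K≼t in
                vx⋠t (≼-trans le (≼key x<n v-outer x∈ p∈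
                  (≼-trans (key-inner x∈) K≼t)
                  (≼-trans (inner≼ v-outer v<n p∈ v-outer) (≼-trans pv≼ kv≼t))
                  (≼-trans wr≼c c≼t)))
            ; side₁₂ = λ le → vx⋠K (≼-trans le (≼-trans pv≼ (key-inner′ x∈)))
            }
            where
            p∈ = proj₁ (attained v<n v-outer)
            pv≼ = proj₂ (attained v<n v-outer)

          scanned-step : ∀ {j c} → j < n → Scanned j c → Scanned (suc j) (scan par ky v K j c)
          scanned-step {j} {c} j<n (wr≼c , snd , below) with par j <ᵇ n | <ᵇ-reflects-< (par j) n
          ... | _ | ofʸ j∉ = wr≼c , snd , below-suc _ below (λ j∈ → contradiction j∈ (<⇒≱ j∉))
          ... | _ | ofⁿ j∈ with L v j ≼? K j
          ...   | yes vj≼K = wr≼c , snd , below-suc _ below (λ _ K≼t _ → ≼-trans vj≼K K≼t)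
          ...   | no vj⋠K with L v j ≼? top c
          ...     | yes vj≼c = wr≼c , snd , below-suc _ below (λ _ _ c≼t → ≼-trans vj≼c c≼t)
          ...     | no vj⋠c = ≼-trans wr≼c (⋠⇒≽ vj⋠c) ,
                    inj₁ (valid {c = c} j<n (≮⇒≥ j∈) wr≼c vj⋠K vj⋠c) ,
                    below-suc _ (λ x x<j x∈ K≼t c≼t →
                                   below x x<j x∈ K≼t (≼-trans (⋠⇒≽ vj⋠c) c≼t))
                                (λ _ _ c≼t → c≼t)

        private
          scanned : Scanned K key-inner key-inner′ n (worst s′)
          scanned = iter-induction (Scanned K key-inner key-inner′) n (≼-refl , sound , λ _ ())
                      (scanned-step K key-inner key-inner′)

          wr≼ : ∀ {t} → top (worst s′) ≼ t → top wr ≼ t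
          wr≼ = ≼-trans (proj₁ scanned)

          ≼K : ∀ {x} → x < n → n ≤ par x → ∀ {t} → K x ≼ t → top (worst s′) ≼ t → L v x ≼ t
          ≼K {x} = proj₂ (proj₂ scanned) x

          K≼ : ∀ {x} → x < n → n ≤ par x → K x ≼ L x v
          K≼ x<n x∈ = key-lub x∈ (inner≼ x<n v<n x∈ v-outer) (outer≼ x<n v<n x∈ v-outer)

          ky≼ : ∀ {x t} → x < n → n ≤ par x → L x v ≼ t → ky x ≼ t
          ky≼ x<n x∈ = ≼-trans (inner≼ x<n v<n x∈ v-outer)

          Kv≼ : ∀ {x y} → x < n → y < n → K v ≼ L x y
          Kv≼ x<n y<n = ≼-trans (key-outer′ v-outer) (diag≼ v<n x<n y<n)

          vv≼Kv : ∀ {t} → K v ≼ t → L v v ≼ t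
          vv≼Kv with par v <ᵇ n | <ᵇ-reflects-< (par v) n
          ... | _ | ofⁿ v∈ = contradiction v-outer v∈
          ... | _ | ofʸ _ with ky v ≼? L v v
          ...   | yes _ = ≼-trans (≼-trans (diag≼ v<n v-outer v<n) (proj₂ (attained v<n v-outer)))
          ...   | no  _ = λ p → p

          flip≼ : ∀ {x y t} → x < n → y < n → L x y ≼ t → L y x ≼ t
          flip≼ x<n y<n = ≼-trans (sym≼ y<n x<n)

        visit-invariant : Invariant s′
        visit-invariant = record
          { ultra   = λ x<n y<n z<n x∈ y∈ z∈ →
                        ultra′ x<n y<n z<n (inside x∈) (inside y∈) (inside z∈)
          ; key≼    = λ x<n y<n x∈ y∈ → key≼′ x<n y<n (inside x∈) (inside y∈)
          ; ≼key    = λ x<n y<n x∈ y∈ → ≼key′ x<n y<n (inside x∈) (inside y∈)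
          ; inner≼  = λ x<n w<n x∈ w∉ → inner≼′ x<n w<n (inside x∈) (outside w∉)
          ; outer≼  = λ x<n w<n x∈ w∉ → outer≼′ x<n w<n (inside x∈) (outside w∉)
          ; attained = visit-attained
          ; sound   = proj₁ (proj₂ scanned)
          }
          where
          ultra′ : ∀ {x y z} → x < n → y < n → z < n →
            x ≡ v ⊎ n ≤ par x → y ≡ v ⊎ n ≤ par y → z ≡ v ⊎ n ≤ par z →
            ∀ {t} → L x y ≼ t → L y z ≼ t → top (worst s′) ≼ t → L x z ≼ t
          ultra′ x<n y<n z<n (inj₂ x∈) (inj₂ y∈) (inj₂ z∈) p q r =
            ultra x<n y<n z<n x∈ y∈ z∈ p q (wr≼ r)
          ultra′ x<n y<n z<n (inj₁ refl) (inj₁ refl) _ p q r = q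
          ultra′ x<n y<n z<n _ (inj₁ refl) (inj₁ refl) p q r = p
          ultra′ x<n y<n z<n (inj₁ refl) (inj₂ y∈) (inj₁ refl) p q r =
            ≼-trans (diag≼ v<n v<n y<n) p
          ultra′ x<n y<n z<n (inj₂ x∈) (inj₁ refl) (inj₂ z∈) p q r =
            ≼key x<n z<n x∈ z∈ (ky≼ x<n x∈ p) (ky≼ z<n z∈ (flip≼ v<n z<n q)) (wr≼ r)
          -- The path from `v` over `y` to `z` bounds the new key of `z` by `t`, and the scan has
          -- compared `L v z` with this key.
          ultra′ x<n y<n z<n (inj₁ refl) (inj₂ y∈) (inj₂ z∈) p q r =
            ≼K z<n z∈ (key-lub z∈
              (key≼ z<n y<n z∈ y∈ (flip≼ y<n z<n q) (ky≼ y<n y∈ (flip≼ v<n y<n p)))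
              (≼-trans (outer≼ y<n v<n y∈ v-outer) (flip≼ v<n y<n p))) r
          ultra′ x<n y<n z<n (inj₂ x∈) (inj₂ y∈) (inj₁ refl) p q r =
            flip≼ v<n x<n (≼K x<n x∈ (key-lub x∈
              (key≼ x<n y<n x∈ y∈ p (ky≼ y<n y∈ q))
              (≼-trans (outer≼ y<n v<n y∈ v-outer) q)) r)
          key≼′ : ∀ {x y} → x < n → y < n → x ≡ v ⊎ n ≤ par x → y ≡ v ⊎ n ≤ par y →
                  ∀ {t} → L x y ≼ t → K y ≼ t → K x ≼ t
          key≼′ x<n y<n (inj₁ refl) _ p q = ≼-trans (Kv≼ v<n y<n) p
          key≼′ x<n y<n (inj₂ x∈) (inj₁ refl) p q = ≼-trans (K≼ x<n x∈) p
          key≼′ x<n y<n (inj₂ x∈) (inj₂ y∈) p q =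
            key-lub x∈ (key≼ x<n y<n x∈ y∈ p (≼-trans (key-inner y∈) q))
                       (≼-trans (key-inner′ y∈) q)
          ≼key′ : ∀ {x y} → x < n → y < n → x ≡ v ⊎ n ≤ par x → y ≡ v ⊎ n ≤ par y →
                  ∀ {t} → K x ≼ t → K y ≼ t → top (worst s′) ≼ t → L x y ≼ t
          ≼key′ x<n y<n (inj₁ refl) (inj₁ refl) p q r = vv≼Kv p
          ≼key′ x<n y<n (inj₁ refl) (inj₂ y∈) p q r = ≼K y<n y∈ q r
          ≼key′ x<n y<n (inj₂ x∈) (inj₁ refl) p q r = flip≼ v<n x<n (≼K x<n x∈ p r)
          ≼key′ x<n y<n (inj₂ x∈) (inj₂ y∈) p q r =
            ≼key x<n y<n x∈ y∈ (≼-trans (key-inner x∈) p) (≼-trans (key-inner y∈) q) (wr≼ r)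
          inner≼′ : ∀ {x w} → x < n → w < n → x ≡ v ⊎ n ≤ par x → par w < n → K x ≼ L x w
          inner≼′ x<n w<n (inj₁ refl) w∉ = Kv≼ v<n w<n
          -- Here the choice of a least key enters: attaching `v` is no longer than reaching `w`
          -- would have been.
          inner≼′ x<n w<n (inj₂ x∈) w∉ = key-lub x∈ (inner≼ x<n w<n x∈ w∉)
            (≼-trans (least w<n w∉) (outer≼ x<n w<n x∈ w∉))
          outer≼′ : ∀ {x w} → x < n → w < n → x ≡ v ⊎ n ≤ par x → par w < n → K w ≼ L x w
          outer≼′ x<n w<n (inj₁ refl) w∉ = key-outer′ w∉
          outer≼′ x<n w<n (inj₂ x∈) w∉ = ≼-trans (key-outer w∉) (outer≼ x<n w<n x∈ w∉)

        visit-count : sum n (λ x → ⟦ outer (parent s′) x ⟧) < sum n (λ x → ⟦ outer par x ⟧)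
        visit-count = sum-strict n v v<n fewer strictly
          where
          fewer : ∀ x → x < n → ⟦ outer (parent s′) x ⟧ ≤ ⟦ outer par x ⟧
          fewer x x<n = <ᵇ-mono (parent s′ x) n (par x) n outside
          strictly : ⟦ outer (parent s′) v ⟧ < ⟦ outer par v ⟧
          strictly = subst₂ (λ a b → ⟦ a ⟧ < ⟦ b ⟧)
            (sym (dec-false (parent s′ v <? n) (≤⇒≯ inside-v)))
            (sym (dec-true (par v <? n) v-outer)) ≤-refl

      prim-correct : let c = worst (iter (λ _ → advance) n start) in
                     Ultra (top c) × Sound c
      prim-correct with n ≟ 0
      ... | yes refl = (λ ()) , inj₂ (z≤n , λ ())
      ... | no  n≢0  = (λ x<n y<n z<n → ultra x<n y<n z<n (all x<n) (all y<n) (all z<n)) , sound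
        where
        outers : Prim → ℕ
        outers s = sum n (λ x → ⟦ outer (parent s) x ⟧)
        I : ℕ → Prim → Set
        -- Every step attaches a vertex while one is left, so after `n` steps none is outer.
        I j s = Invariant s × (outers s + j ≤ n ⊎ outers s ≡ 0)
        empty : ∀ s → outers s ≡ 0 → ∀ {x} → x < n → n ≤ parent s x
        empty s eq {x} x<n = ≮⇒≥ λ p → 1≢0 (trans (sym (cong ⟦_⟧ (dec-true (parent s x <? n) p)))
                                                  (sum-zero n eq x x<n))
          where
          1≢0 : 1 ≢ 0
          1≢0 ()
        step : ∀ {j s} → j < n → I j s → I (suc j) (advance s)
        step {j} {s@(prim par ky wr)} j<n (inv , count) with pick-least par ky
        ... | inj₁ (b≡n , all∈) rewrite dec-false (pick par ky n <? n) (<-irrefl b≡n) =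
          inv , inj₂ (n≤0⇒n≡0 (≤-trans (sum-mono n λ x x<n →
                  ≤-reflexive (cong ⟦_⟧ (dec-false (par x <? n) (≤⇒≯ (all∈ x<n)))))
                  (≤-reflexive (trans (sum-*ˡ n 0 (λ _ → 0)) refl))))
        ... | inj₂ (b<n , b∉ , le) rewrite dec-true (pick par ky n <? n) b<n =
          visit-invariant inv b<n b∉ le , count′ count
          where
          fewer = visit-count inv b<n b∉ le
          count′ : outers s + j ≤ n ⊎ outers s ≡ 0 → _
          count′ (inj₁ p) = inj₁ (≤-trans (≤-reflexive (+-suc (outers (visit (pick par ky n) s)) j))
                                          (≤-trans (+-monoˡ-≤ j fewer) p))
          count′ (inj₂ p) = contradiction (subst (outers (visit (pick par ky n) s) <_) p fewer) λ ()
        last : Prim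
        last = iter (λ _ → advance) n start
        final : I n last
        final = iter-induction I n
          (start-invariant (n≢0⇒n>0 n≢0) ,
           inj₁ (≤-trans (≤-reflexive (+-identityʳ _))
                         (sum-≤-length n _ (λ _ → ⟦ _ ⟧≤1))))
          (λ {j} {s} → step {j} {s})
        open Invariant (proj₁ final)
        all : ∀ {x} → x < n → n ≤ parent last x
        all with proj₂ final
        ... | inj₂ none = empty last none
        ... | inj₁ p    = empty last (n≤0⇒n≡0 (+-cancelʳ-≤ n _ 0 p))

      opaque
        unfolding detect

        detect-correct : Ultra (top detect) × Sound detect
        detect-correct = prim-correct

-- The search tree

Edge : ℕ → ℕ → ℕ → ℕ → Set
Edge a b x y = (x ≡ a × y ≡ b) ⊎ (x ≡ b × y ≡ a)

edge? : ∀ a b x y → Dec (Edge a b x y)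
edge? a b x y = (x ≟ a ×-dec y ≟ b) ⊎-dec (x ≟ b ×-dec y ≟ a)

module _ {A : Set} where

  overwrite : ℕ → ℕ → (ℕ → ℕ → A) → (ℕ → ℕ → A) → ℕ → ℕ → A
  overwrite a b f g x y with edge? a b x y
  ... | yes _ = f x y
  ... | no  _ = g x y

  overwrite-case : ∀ a b f g x y (P : A → Set) →
    (Edge a b x y → P (f x y)) → (¬ Edge a b x y → P (g x y)) →
    P (overwrite a b f g x y)
  overwrite-case a b f g x y P on off with edge? a b x y
  ... | yes e = on e
  ... | no ¬e = off ¬e

  overwrite-on : ∀ a b f g x y → Edge a b x y → overwrite a b f g x y ≡ f x y
  overwrite-on a b f g x y e = overwrite-case a b f g x y (_≡ f x y)
    (λ _ → refl) (λ ¬e → contradiction e ¬e)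

  overwrite-off : ∀ a b f g x y → ¬ Edge a b x y → overwrite a b f g x y ≡ g x y
  overwrite-off a b f g x y ¬e = overwrite-case a b f g x y (_≡ g x y)
    (λ e → contradiction e ¬e) (λ _ → refl)

flip-edge : ∀ {a b x y} → Edge a b x y → Edge a b y x
flip-edge (inj₁ (p , q)) = inj₂ (q , p)
flip-edge (inj₂ (p , q)) = inj₁ (q , p)

sum² : ℕ → (ℕ → ℕ → ℕ) → ℕ
sum² n f = sum n (λ x → sum n (f x))

sum²-mono : ∀ n {f g} → (∀ x y → x < n → y < n → f x y ≤ g x y) → sum² n f ≤ sum² n g
sum²-mono n f≤g = sum-mono n (λ x x<n → sum-mono n (λ y y<n → f≤g x y x<n y<n))

sum²-zero : ∀ n {f} → sum² n f ≡ 0 → ∀ {x y} → x < n → y < n → f x y ≡ 0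
sum²-zero n eq x<n y<n = sum-zero n (sum-zero n eq _ x<n) _ y<n

sum²-*ˡ : ∀ n c f → sum² n (λ x y → c * f x y) ≤ c * sum² n f
sum²-*ˡ n c f = ≤-trans (sum-mono n (λ x _ → ≤-reflexive (sum-*ˡ n c (f x))))
                        (≤-reflexive (sum-*ˡ n c (λ x → sum n (f x))))

sum²-edge : ∀ n {f g} a b → a < n → b < n → a ≢ b →
  (∀ x y → x < n → y < n → f x y ≤ g x y) → f a b < g a b → f b a < g b a →
  2 + sum² n f ≤ sum² n g
sum²-edge n a b a<n b<n a≢b f≤g ab ba = sum-strict₂ n a b a<n b<n a≢b
  (λ x x<n → sum-mono n (λ y y<n → f≤g x y x<n y<n))
  (sum-strict n b b<n (λ y y<n → f≤g a y a<n y<n) ab)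
  (sum-strict n a a<n (λ y y<n → f≤g b y b<n y<n) ba)

-- Spelled with the connectives available in `Cond`, so that the test of the machine reduces to this
-- very term.
differ : ℕ → ℕ → Bool
differ x y = not (not (does (x <? y)) ∧ not (does (y <? x)))

differ-≢ : ∀ {x y} → x ≢ y → differ x y ≡ true
differ-≢ {x} {y} x≢y with <-cmp x y
... | tri< lt _ _ rewrite dec-true (x <? y) lt = refl
... | tri≈ _ eq _ = contradiction eq x≢y
... | tri> _ _ gt rewrite dec-true (y <? x) gt with x <ᵇ y
...   | true  = refl
...   | false = refl

differ-≡ : ∀ x → differ x x ≡ false
differ-≡ x rewrite dec-false (x <? x) (<-irrefl refl) = refl

module Search (ℝ : RealNumbers) (n k : ℕ)
              (D l u : ℕ → ℕ → RealNumbers.Carrier ℝ) where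

  open Order ℝ
  open Detection ℝ n
  open RealNumbers ℝ using (0#; 1#; -_; _-_; 0≉1)
    renaming (_+_ to _+ʳ_; +-monoʳ-≤ to +ʳ-mono)

  record Dissimilarity (f : ℕ → ℕ → C) : Set where
    field
      0≼    : ∀ {x y} → x < n → y < n → 0# ≼ f x y
      sym≼  : ∀ {x y} → x < n → y < n → f x y ≼ f y x
      diag≼ : ∀ {x} → x < n → f x x ≼ 0#

  symmetric : ∀ {f} → Dissimilarity f → Symmetric f
  symmetric dis = record
    { sym≼  = sym≼
    ; diag≼ = λ v<n x<n y<n → ≼-trans (diag≼ v<n) (0≼ x<n y<n)
    }
    where open Dissimilarity dis

  inRange : ℕ → ℕ → Bool
  inRange x y = does (l x y ≼? D x y) ∧ does (D x y ≼? u x y)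

  initial : ℕ → ℕ → C
  initial x y = when inRange x y then D x y else l x y

  end₁ end₂ : ℕ → Conflict → ℕ
  end₁ q c = when does (1 <? q) then c₀ c else (when does (0 <? q) then c₂ c else c₀ c)
  end₂ q c = when does (1 <? q) then c₂ c else c₁ c

  -- Digits 0 and 1 raise one of the two short sides of the violated
  -- triangle to its height, digit 2 frees the long side.
  repair : ℕ → (ℕ → ℕ → C) → Conflict → ℕ → ℕ → C
  repair q L c = overwrite (end₁ q c) (end₂ q c)
    (λ x y → when does (1 <? q) then l x y else top c) L

  child : ℕ → (ℕ → ℕ → C) → (ℕ → ℕ → C)
  child q L = when does (c₀ (detect L) <? n) then repair q L (detect L) else L

  simulate : (ℕ → ℕ) → ℕ → (ℕ → ℕ → C)
  simulate w zero    = initial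
  simulate w (suc s) = child (w s) (simulate w s)

  simulate-cong : ∀ {w w′} s → (∀ i → i < s → w i ≡ w′ i) → simulate w s ≡ simulate w′ s
  simulate-cong zero    eq = refl
  simulate-cong (suc s) eq =
    cong₂ child (eq s ≤-refl) (simulate-cong s (λ i i<s → eq i (m≤n⇒m≤1+n i<s)))

  -- The machine has no real constants; the diagonal entry `D 0 0` plays the part of zero. Distinct
  -- points of a metric space have positive distance. Hence an upper bound of zero between distinct
  -- points rules out every solution, and a zero of `D` between them must be changed even where `L`
  -- agrees with `D`.
  bad flagged : (ℕ → ℕ → C) → ℕ → ℕ → Bool
  bad L x y = not (does (l x y ≼? L x y) ∧ does (L x y ≼? u x y) ∧
                   not (differ x y ∧ does (u x y ≼? D 0 0)))
  flagged L x y = not ((does (L x y ≼? D x y) ∧ does (D x y ≼? L x y)) ∧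
                       not (differ x y ∧ does (D x y ≼? D 0 0)))

  -- The machine runs 2 k + 1 rounds. The last one serves for its detection, which inspects the
  -- matrix left by 2 k repairs; if nothing is found, `child` returns that matrix unchanged.
  -- Therefore the sums can speak of the matrix one round later.
  Accepted : (ℕ → ℕ) → Set
  Accepted w = n ≤ c₀ (detect (simulate w (2 * k))) ×
    sum² n (λ x y → ⟦ bad (simulate w (suc (2 * k))) x y ⟧) < 1 ×
    sum² n (λ x y → ⟦ flagged (simulate w (suc (2 * k))) x y ⟧) < suc (2 * k)

  changed : (ℕ → ℕ → C) → ℕ → ℕ → Bool
  changed d x y = not (does (D x y ≼? d x y) ∧ does (d x y ≼? D x y))

  unchanged : ∀ d {x y} → D x y ≼ d x y → d x y ≼ D x y → changed d x y ≡ false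
  unchanged d {x} {y} p q with D x y ≼? d x y | d x y ≼? D x y
  ... | yes _ | yes _ = refl
  ... | yes _ | no ¬q = contradiction q ¬q
  ... | no ¬p | _     = contradiction p ¬p

  not-flagged : ∀ L {x y} → flagged L x y ≡ false →
                L x y ≼ D x y × D x y ≼ L x y × (x ≢ y → ¬ D x y ≼ D 0 0)
  not-flagged L {x} {y} eq with L x y ≼? D x y | D x y ≼? L x y | D x y ≼? D 0 0
  ... | yes p | yes q | no ¬r = p , q , λ _ → ¬r
  ... | yes p | yes q | yes _ = p , q , λ x≢y → contradiction
        (trans (sym (cong (λ b → not (not (b ∧ true))) (differ-≢ x≢y))) eq) λ ()

  record Solution (d : ℕ → ℕ → C) : Set where
    field
      dissimilarity : Dissimilarity d
      positive      : ∀ {x y} → x < n → y < n → x ≢ y → ¬ d x y ≼ 0#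
      ultra         : ∀ {x y z} → x < n → y < n → z < n →
                      ∀ {t} → d x y ≼ t → d y z ≼ t → d x z ≼ t
      lower         : ∀ {x y} → x < n → y < n → l x y ≼ d x y
      upper         : ∀ {x y} → x < n → y < n → d x y ≼ u x y
      few           : sum² n (λ x y → ⟦ changed d x y ⟧) ≤ 2 * k

  module _ (D-dis : Dissimilarity D) (l-dis : Dissimilarity l) (u-dis : Dissimilarity u) where

    private
      module D = Dissimilarity D-dis
      module l = Dissimilarity l-dis
      module u = Dissimilarity u-dis

    data Cell (x y : ℕ) : Set where
      kept  : l x y ≼ D x y → D x y ≼ u x y → inRange x y ≡ true → Cell x y
      freed : ¬ (l x y ≼ D x y × D x y ≼ u x y) → inRange x y ≡ false → Cell x y

    cell : ∀ x y → Cell x y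
    cell x y with l x y ≼? D x y in eq | D x y ≼? u x y in eq′
    ... | yes p | yes q = kept p q (cong₂ (λ a b → does a ∧ does b) eq eq′)
    ... | yes _ | no ¬q = freed (λ (_ , q) → ¬q q) (cong₂ (λ a b → does a ∧ does b) eq eq′)
    ... | no ¬p | _     = freed (λ (p , _) → ¬p p)
                                (cong (λ a → does a ∧ does (D x y ≼? u x y)) eq)

    initial-dissimilarity : Dissimilarity initial
    initial-dissimilarity = record
      { 0≼ = λ {x} {y} x<n y<n → 0≼ (cell x y) x<n y<n
      ; sym≼ = λ {x} {y} x<n y<n → sym≼ (cell x y) (cell y x) x<n y<n
      ; diag≼ = λ {x} x<n → diag≼ (cell x x) x<n
      }
      where
      0≼ : ∀ {x y} → Cell x y → x < n → y < n → 0# ≼ initial x y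
      0≼ (kept _ _ eq)  x<n y<n = subst (0# ≼_) (sym (when-true eq)) (D.0≼ x<n y<n)
      0≼ (freed _ eq)   x<n y<n = subst (0# ≼_) (sym (when-false eq)) (l.0≼ x<n y<n)
      diag≼ : ∀ {x} → Cell x x → x < n → initial x x ≼ 0#
      diag≼ (kept _ _ eq)  x<n = subst (_≼ 0#) (sym (when-true eq)) (D.diag≼ x<n)
      diag≼ (freed _ eq)   x<n = subst (_≼ 0#) (sym (when-false eq)) (l.diag≼ x<n)
      sym≼ : ∀ {x y} → Cell x y → Cell y x → x < n → y < n → initial x y ≼ initial y x
      sym≼ (kept _ _ eq) (kept _ _ eq′) x<n y<n = subst₂ _≼_ (sym (when-true eq)) (sym (when-true eq′)) (D.sym≼ x<n y<n)
      sym≼ (freed _ eq) (freed _ eq′) x<n y<n = subst₂ _≼_ (sym (when-false eq)) (sym (when-false eq′)) (l.sym≼ x<n y<n)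
      sym≼ (kept p q _) (freed ¬pq _) x<n y<n = contradiction
        (≼-trans (l.sym≼ y<n x<n) (≼-trans p (D.sym≼ x<n y<n)) ,
         ≼-trans (D.sym≼ y<n x<n) (≼-trans q (u.sym≼ x<n y<n))) ¬pq
      sym≼ (freed ¬pq _) (kept p q _) x<n y<n = contradiction
        (≼-trans (l.sym≼ x<n y<n) (≼-trans p (D.sym≼ y<n x<n)) ,
         ≼-trans (D.sym≼ x<n y<n) (≼-trans q (u.sym≼ y<n x<n))) ¬pq

    module _ {L c} (L-dis : Dissimilarity L) (v : Valid L c) where

      open Valid v
      private module L = Dissimilarity L-dis

      c₀≢c₁ : c₀ c ≢ c₁ c
      c₀≢c₁ refl = side₁₂ (subst (_≼ L (c₁ c) (c₂ c)) (sym height) (L.sym≼ c₂<n c₀<n))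

      c₂≢c₁ : c₂ c ≢ c₁ c
      c₂≢c₁ refl = side₀₁ (subst (_≼ L (c₀ c) (c₁ c)) (sym height) (L.sym≼ c₂<n c₀<n))

      c₀≢c₂ : c₀ c ≢ c₂ c
      c₀≢c₂ refl = side₀₁ (subst (_≼ L (c₀ c) (c₁ c)) (sym height)
        (≼-trans (L.diag≼ c₀<n) (L.0≼ c₀<n c₁<n)))

      0≼top : 0# ≼ top c
      0≼top = subst (0# ≼_) (sym height) (L.0≼ c₂<n c₀<n)

    overwrite-dissimilarity : ∀ {a b f L} → a ≢ b → Dissimilarity L →
      (∀ {x y} → x < n → y < n → 0# ≼ f x y) →
      (∀ {x y} → x < n → y < n → f x y ≼ f y x) →
      Dissimilarity (overwrite a b f L)
    overwrite-dissimilarity {a} {b} {f} {L} a≢b L-dis 0≼f f-sym = record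
      { 0≼    = λ {x} {y} x<n y<n → overwrite-case a b f L x y (0# ≼_)
                  (λ _ → 0≼f x<n y<n) (λ _ → L.0≼ x<n y<n)
      ; sym≼  = λ {x} {y} x<n y<n →
                  overwrite-case a b f L x y (_≼ overwrite a b f L y x)
                  (λ e → overwrite-case a b f L y x (f x y ≼_)
                    (λ _ → f-sym x<n y<n)
                    (λ ¬e → contradiction (flip-edge e) ¬e))
                  (λ ¬e → overwrite-case a b f L y x (L x y ≼_)
                    (λ e → contradiction (flip-edge e) ¬e)
                    (λ _ → L.sym≼ x<n y<n))
      ; diag≼ = λ {x} x<n → overwrite-case a b f L x x (_≼ 0#)
                  (λ { (inj₁ (refl , refl)) → contradiction refl a≢b
                     ; (inj₂ (refl , refl)) → contradiction refl a≢b })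
                  (λ _ → L.diag≼ x<n)
      }
      where module L = Dissimilarity L-dis

    repair-dissimilarity : ∀ q {L c} → Dissimilarity L → Valid L c →
                           Dissimilarity (repair q L c)
    repair-dissimilarity zero dis v =
      overwrite-dissimilarity (c₀≢c₁ dis v) dis (λ _ _ → 0≼top dis v) (λ _ _ → ≼-refl)
    repair-dissimilarity (suc zero) dis v =
      overwrite-dissimilarity (c₂≢c₁ dis v) dis (λ _ _ → 0≼top dis v) (λ _ _ → ≼-refl)
    repair-dissimilarity (suc (suc q)) dis v =
      overwrite-dissimilarity (c₀≢c₂ dis v) dis l.0≼ l.sym≼

    child-valid : ∀ q {L} → Valid L (detect L) → child q L ≡ repair q L (detect L)
    child-valid q {L} v = when-true
      (dec-true (c₀ (detect L) <? n) (Valid.c₀<n v))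

    child-done : ∀ q {L} → n ≤ c₀ (detect L) → child q L ≡ L
    child-done q {L} n≤c₀ = when-false
      (dec-false (c₀ (detect L) <? n) (≤⇒≯ n≤c₀))

    child-dissimilarity : ∀ q {L} → Dissimilarity L → Dissimilarity (child q L)
    child-dissimilarity q {L} dis with proj₂ (detect-correct L (symmetric dis))
    ... | inj₁ v          = subst Dissimilarity (sym (child-valid q v)) (repair-dissimilarity q dis v)
    ... | inj₂ (n≤c₀ , _) = subst Dissimilarity (sym (child-done q n≤c₀)) dis

    simulate-dissimilarity : ∀ w s → Dissimilarity (simulate w s)
    simulate-dissimilarity w zero    = initial-dissimilarity
    simulate-dissimilarity w (suc s) = child-dissimilarity (w s) (simulate-dissimilarity w s)

    detect-none : ∀ {L} → Dissimilarity L → n ≤ c₀ (detect L) →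
      ∀ {x y z} → x < n → y < n → z < n → ∀ {t} → L x y ≼ t → L y z ≼ t → L x z ≼ t
    detect-none {L} dis n≤c₀ x<n y<n z<n p q with detect-correct L (symmetric dis)
    ... | ultra , inj₁ v = contradiction (Valid.c₀<n v) (≤⇒≯ n≤c₀)
    ... | ultra , inj₂ (_ , low) = ultra x<n y<n z<n p q (≼-trans (low x<n y<n) p)

    -- A solution d tells which digits to choose.  A cell has status 0 while
    -- it holds its original value, 1 once it is freed and 2 once it is
    -- raised; since violations are repaired in order of decreasing height, a
    -- raised cell never needs to be raised again.
    module Completeness {d : ℕ → ℕ → C} (sol : Solution d) where

      open Solution sol
      private module d = Dissimilarity dissimilarity

      Differs : ℕ → ℕ → Set
      Differs x y = ¬ (D x y ≼ d x y × d x y ≼ D x y)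

      record Follows (L : ℕ → ℕ → C) (st : ℕ → ℕ → ℕ) : Set where
        field
          status : ∀ {x y} → x < n → y < n →
            (st x y ≡ 0 × L x y ≡ D x y × l x y ≼ D x y × D x y ≼ u x y) ⊎
            (1 ≤ st x y × st x y ≤ 2 × Differs x y × L x y ≼ d x y)
          above  : ∀ {x y} → x < n → y < n → l x y ≼ L x y
          -- No violation is higher than an entry that has been raised; this will forbid raising it
          -- again.
          final  : ∀ {x y} → x < n → y < n → 2 ≤ st x y → Ultra L (L x y)

      -- An entry of `D` outside its bounds differs from every solution, so its cell counts as freed
      -- from the start.
      initial-status : ℕ → ℕ → ℕ
      initial-status x y = when inRange x y then 0 else 1

      initial-follows : Follows initial initial-status
      initial-follows = record
        { status = λ {x} {y} → status (cell x y)
        ; above  = λ {x} {y} → above (cell x y)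
        ; final  = λ {x} {y} _ _ 2≤st → contradiction 2≤st (below (cell x y))
        }
        where
        status : ∀ {x y} → Cell x y → x < n → y < n →
          (initial-status x y ≡ 0 × initial x y ≡ D x y × l x y ≼ D x y × D x y ≼ u x y) ⊎
          (1 ≤ initial-status x y × initial-status x y ≤ 2 × Differs x y × initial x y ≼ d x y)
        status (kept p q eq) x<n y<n = inj₁ (when-true eq , when-true eq , p , q)
        status {x} {y} (freed ¬pq eq) x<n y<n = inj₂
          (≤-reflexive (sym st≡1) , ≤-trans (≤-reflexive st≡1) (n≤1+n 1) ,
           (λ (D≼d , d≼D) → ¬pq (≼-trans (lower x<n y<n) d≼D , ≼-trans D≼d (upper x<n y<n))) ,
           subst (_≼ d x y) (sym (when-false eq)) (lower x<n y<n))
          where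
          st≡1 : initial-status x y ≡ 1
          st≡1 = when-false eq
        above : ∀ {x y} → Cell x y → x < n → y < n → l x y ≼ initial x y
        above (kept p q eq) _ _ = subst (l _ _ ≼_) (sym (when-true eq)) p
        above (freed _ eq)  _ _ = subst (l _ _ ≼_) (sym (when-false eq)) ≼-refl
        below : ∀ {x y} → Cell x y → ¬ 2 ≤ initial-status x y
        below (kept _ _ eq) 2≤st = contradiction (subst (2 ≤_) (when-true eq) 2≤st) λ ()
        below (freed _ eq)  2≤st = contradiction (subst (2 ≤_) (when-false eq) 2≤st) λ { (s≤s ()) }

      module _ {L st h} (follows : Follows L st) (ultraₕ : Ultra L h)
               (high : ∀ {x y} → x < n → y < n → 2 ≤ st x y → h ≼ L x y) where

        open Follows follows

        record Change (f : ℕ → ℕ → C) (r x y : ℕ) : Set where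
          field
            differs : Differs x y
            below-d : f x y ≼ d x y
            above-l : l x y ≼ f x y
            L≼h     : L x y ≼ h
            f≼h     : f x y ≼ h
            grows   : st x y < r
            raised  : 2 ≤ r → h ≼ f x y

        -- The changed entries are at most `h` before and after. For `t` from `h` on, the same pairs
        -- have an entry of at most `t` in both matrices, so `Ultra` at `h` is inherited: no
        -- violation above `h` can arise. All raised entries, old and new, are at least `h`, which
        -- gives `final`.
        change-follows : ∀ {a b f r} → a < n → b < n → a ≢ b → 1 ≤ r → r ≤ 2 →
          (∀ {x y} → Edge a b x y → Change f r x y) →
          Follows (overwrite a b f L) (overwrite a b (λ _ _ → r) st) ×
          2 + sum² n st ≤ sum² n (overwrite a b (λ _ _ → r) st)
        change-follows {a} {b} {f} {r} a<n b<n a≢b 1≤r r≤2 change = record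
          { status = λ {x} {y} x<n y<n → status′ x<n y<n (edge? a b x y)
          ; above  = λ {x} {y} x<n y<n → overwrite-case a b f L x y (l x y ≼_)
                       (λ e → above-l (change e)) (λ _ → above x<n y<n)
          ; final  = λ x<n y<n 2≤st x′<n y′<n z′<n p q r →
                       ultra′ x′<n y′<n z′<n p q (≼-trans (high′ x<n y<n 2≤st) r)
          } , sum²-edge n a b a<n b<n a≢b grow
                (strict (inj₁ (refl , refl))) (strict (inj₂ (refl , refl)))
          where
          open Change
          L′ : ℕ → ℕ → C
          L′ = overwrite a b f L
          st′ : ℕ → ℕ → ℕ
          st′ = overwrite a b (λ _ _ → r) st
          status′ : ∀ {x y} → x < n → y < n → Dec (Edge a b x y) →
            (st′ x y ≡ 0 × L′ x y ≡ D x y × l x y ≼ D x y × D x y ≼ u x y) ⊎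
            (1 ≤ st′ x y × st′ x y ≤ 2 × Differs x y × L′ x y ≼ d x y)
          status′ {x} {y} x<n y<n (yes e)
            rewrite overwrite-on a b f L x y e | overwrite-on a b (λ _ _ → r) st x y e =
            inj₂ (1≤r , r≤2 , differs (change e) , below-d (change e))
          status′ {x} {y} x<n y<n (no ¬e)
            rewrite overwrite-off a b f L x y ¬e | overwrite-off a b (λ _ _ → r) st x y ¬e =
            status x<n y<n
          high′ : ∀ {x y} → x < n → y < n → 2 ≤ st′ x y → h ≼ L′ x y
          high′ {x} {y} x<n y<n with edge? a b x y
          ... | yes e = raised (change e)
          ... | no ¬e = high x<n y<n
          ultra′ : Ultra L′ h
          ultra′ {x} {y} {z} x<n y<n z<n {t} p q h≼t =
            overwrite-case a b f L x z (_≼ t)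
              (λ e → ≼-trans (f≼h (change e)) h≼t)
              (λ _ → ultraₕ x<n y<n z<n (old x y p) (old y z q) h≼t)
            where
            old : ∀ x y → L′ x y ≼ t → L x y ≼ t
            old x y = overwrite-case a b f L x y (λ v → v ≼ t → L x y ≼ t)
              (λ e _ → ≼-trans (L≼h (change e)) h≼t) (λ _ p → p)
          grow : ∀ x y → x < n → y < n → st x y ≤ st′ x y
          grow x y _ _ = overwrite-case a b (λ _ _ → r) st x y (st x y ≤_)
            (λ e → <⇒≤ (grows (change e))) (λ _ → ≤-refl)
          strict : ∀ {x y} → Edge a b x y → st x y < st′ x y
          strict {x} {y} e = subst (st x y <_)
            (sym (overwrite-on a b (λ _ _ → r) st x y e)) (grows (change e))

      follow : ∀ {L st} → Dissimilarity L → Valid L (detect L) → Follows L st →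
        ∃[ q ] q < 3 × ∃[ st′ ] Follows (child q L) st′ × 2 + sum² n st ≤ sum² n st′
      follow {L} {st} dis v follows = choose (h ≼? d (c₀ c) (c₂ c))
        where
        open Follows follows
        open Valid v
        module L = Dissimilarity dis
        c = detect L
        h = top c
        ultraₕ : Ultra L h
        ultraₕ = proj₁ (detect-correct L (symmetric dis))
        height≼ : h ≼ L (c₀ c) (c₂ c)
        height≼ = subst (_≼ L (c₀ c) (c₂ c)) (sym height) (L.sym≼ c₂<n c₀<n)
        high : ∀ {x y} → x < n → y < n → 2 ≤ st x y → h ≼ L x y
        high {x} {y} x<n y<n 2≤st with h ≼? L x y
        ... | yes p = p
        -- If a raised entry were below `h`, some threshold below `h` would bound it and both short
        -- sides; `final` then bounds the long side as well, although it has height `h`.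
        ... | no ¬p with t , p₀₁ , p₁₂ , h⋠t ← ⋠-max side₀₁ side₁₂
                    with t′ , t≼t′ , L≼t′ , h⋠t′ ← ⋠-max h⋠t ¬p =
          contradiction (≼-trans height≼ (final x<n y<n 2≤st c₀<n c₁<n c₂<n
            (≼-trans p₀₁ t≼t′) (≼-trans p₁₂ t≼t′) L≼t′)) h⋠t′
        Result : Set
        Result = ∃[ q ] q < 3 × ∃[ st′ ] Follows (child q L) st′ × 2 + sum² n st ≤ sum² n st′
        conclude : ∀ q → q < 3 → ∀ st′ →
          Follows (repair q L c) st′ × 2 + sum² n st ≤ sum² n st′ → Result
        conclude q q<3 st′ (f , le) =
          q , q<3 , st′ , subst (λ L → Follows L st′) (sym (child-valid q v)) f , le
        raise : ∀ {x y} → x < n → y < n → ¬ h ≼ L x y → h ≼ d x y →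
                Change follows ultraₕ high (λ _ _ → h) 2 x y
        raise {x} {y} x<n y<n h⋠L h≼d = record
          { differs = differs
          ; below-d = h≼d
          ; above-l = ≼-trans (above x<n y<n) (⋠⇒≽ h⋠L)
          ; L≼h     = ⋠⇒≽ h⋠L
          ; f≼h     = ≼-refl
          ; grows   = ≰⇒> (λ 2≤st → h⋠L (high x<n y<n 2≤st))
          ; raised  = λ _ → ≼-refl
          }
          where
          differs : Differs x y
          differs with status x<n y<n
          ... | inj₁ (_ , L≡D , _) = λ (_ , d≼D) →
                  h⋠L (subst (h ≼_) (sym L≡D) (≼-trans h≼d d≼D))
          ... | inj₂ (_ , _ , diff , _) = diff
        free : ∀ {x y} → x < n → y < n → h ≼ L x y → L x y ≼ h → ¬ h ≼ d x y →
               Change follows ultraₕ high l 1 x y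
        free {x} {y} x<n y<n h≼L L≼h h⋠d with status x<n y<n
        -- Freed and raised entries are lower bounds of `d`, so a long side that exceeds `d` is
        -- still in its original state.
        ... | inj₂ (_ , _ , _ , L≼d) = contradiction (≼-trans h≼L L≼d) h⋠d
        ... | inj₁ (st≡0 , L≡D , _) = record
          { differs = λ (D≼d , _) → h⋠d (≼-trans h≼L (subst (_≼ d x y) (sym L≡D) D≼d))
          ; below-d = lower x<n y<n
          ; above-l = ≼-refl
          ; L≼h     = L≼h
          ; f≼h     = ≼-trans (above x<n y<n) L≼h
          ; grows   = subst (_< 1) (sym st≡0) ≤-refl
          ; raised  = λ { (s≤s ()) }
          }
        raise-edge : ∀ {a b} → a < n → b < n → ¬ h ≼ L a b → h ≼ d a b →
          ∀ {x y} → Edge a b x y → Change follows ultraₕ high (λ _ _ → h) 2 x y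
        raise-edge a<n b<n p q (inj₁ (refl , refl)) = raise a<n b<n p q
        raise-edge a<n b<n p q (inj₂ (refl , refl)) =
          raise b<n a<n (λ h≼L → p (≼-trans h≼L (L.sym≼ b<n a<n)))
                        (≼-trans q (d.sym≼ a<n b<n))
        free-edge : ¬ h ≼ d (c₀ c) (c₂ c) →
          ∀ {x y} → Edge (c₀ c) (c₂ c) x y → Change follows ultraₕ high l 1 x y
        free-edge p (inj₁ (refl , refl)) = free c₀<n c₂<n height≼
          (subst (L (c₀ c) (c₂ c) ≼_) (sym height) (L.sym≼ c₀<n c₂<n)) p
        free-edge p (inj₂ (refl , refl)) = free c₂<n c₀<n
          (≼-trans height≼ (L.sym≼ c₀<n c₂<n))
          (subst (L (c₂ c) (c₀ c) ≼_) (sym height) ≼-refl)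
          (λ h≼d → p (≼-trans h≼d (d.sym≼ c₂<n c₀<n)))
        choose : Dec (h ≼ d (c₀ c) (c₂ c)) → Result
        choose (no h⋠d) = conclude 2 ≤-refl _
          (change-follows follows ultraₕ high c₀<n c₂<n (c₀≢c₂ dis v) ≤-refl (n≤1+n 1)
            (free-edge h⋠d))
        choose (yes h≼d) with h ≼? d (c₀ c) (c₁ c) | h ≼? d (c₁ c) (c₂ c)
        ... | yes h≼d₀₁ | _ = conclude 0 z<s _
          (change-follows follows ultraₕ high c₀<n c₁<n (c₀≢c₁ dis v) (n≤1+n 1) ≤-refl
            (raise-edge c₀<n c₁<n side₀₁ h≼d₀₁))
        ... | no _ | yes h≼d₁₂ = conclude 1 (s<s z<s) _
          (change-follows follows ultraₕ high c₂<n c₁<n (c₂≢c₁ dis v) (n≤1+n 1) ≤-refl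
            (raise-edge c₂<n c₁<n (λ h≼L → side₁₂ (≼-trans h≼L (L.sym≼ c₂<n c₁<n)))
                                  (≼-trans h≼d₁₂ (d.sym≼ c₁<n c₂<n))))
        ... | no h⋠d₀₁ | no h⋠d₁₂ with t , p , q , h⋠t ← ⋠-max h⋠d₀₁ h⋠d₁₂ =
          contradiction (≼-trans h≼d (ultra c₀<n c₁<n c₂<n p q)) h⋠t

      -- At most 2 k ordered pairs are changed and each has status at most 2, so the total is at
      -- most 4 k. A repair adds at least 2, which leaves room for 2 k repairs.
      status≤ : ∀ {L st} → Follows L st → sum² n st ≤ 2 * (2 * k)
      status≤ {L} {st} follows = begin
        sum² n st                                    ≤⟨ sum²-mono n st≤ ⟩
        sum² n (λ x y → 2 * ⟦ changed d x y ⟧)       ≤⟨ sum²-*ˡ n 2 _ ⟩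
        2 * sum² n (λ x y → ⟦ changed d x y ⟧)       ≤⟨ *-monoʳ-≤ 2 few ⟩
        2 * (2 * k)                                  ∎
        where
        open ≤-Reasoning
        open Follows follows
        st≤ : ∀ x y → x < n → y < n → st x y ≤ 2 * ⟦ changed d x y ⟧
        st≤ x y x<n y<n with status x<n y<n
        ... | inj₁ (st≡0 , _) = subst (_≤ 2 * ⟦ changed d x y ⟧) (sym st≡0) z≤n
        ... | inj₂ (_ , st≤2 , diff , _) =
          ≤-trans st≤2 (≤-reflexive (cong (λ b → 2 * ⟦ b ⟧) (sym (differs⇒changed diff))))
          where
          differs⇒changed : Differs x y → changed d x y ≡ true
          differs⇒changed diff with D x y ≼? d x y | d x y ≼? D x y
          ... | yes p | yes q = contradiction (p , q) diff
          ... | yes _ | no _  = refl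
          ... | no _  | _     = refl

      -- Digits not yet chosen are kept at 0, so that a word of 2 k choices spells a number below 9
      -- ^ k. Once no violation is left, `progress` takes its second form and the remaining digits
      -- are arbitrary; 0 is chosen.
      record Path (s : ℕ) : Set where
        field
          digits   : ℕ → ℕ
          ternary  : ∀ i → digits i < 3
          beyond   : ∀ i → s ≤ i → digits i ≡ 0
          statuses : ℕ → ℕ → ℕ
          follows  : Follows (simulate digits s) statuses
          progress : 2 * s ≤ sum² n statuses ⊎ n ≤ c₀ (detect (simulate digits s))

      extend : ∀ {s} (π : Path s) (let open Path π) →
        ∃[ q ] q < 3 × ∃[ st ] Follows (child q (simulate digits s)) st ×
          (2 * suc s ≤ sum² n st ⊎ n ≤ c₀ (detect (child q (simulate digits s)))) →
        Path (suc s)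
      extend {s} π (q , q<3 , st , f , prog) = record
        { digits   = digits′
        ; ternary  = ternary′
        ; beyond   = λ i s<i → trans (write-other digits s q (≢-sym (<⇒≢ s<i)))
                                     (beyond i (<⇒≤ s<i))
        ; statuses = st
        ; follows  = subst (λ L → Follows L st) (sym same) f
        ; progress = subst (λ L → 2 * suc s ≤ sum² n st ⊎ n ≤ c₀ (detect L)) (sym same) prog
        }
        where
        open Path π
        digits′ : ℕ → ℕ
        digits′ = write digits s q
        same : simulate digits′ (suc s) ≡ child q (simulate digits s)
        same = cong₂ child (write-same digits s q refl)
          (simulate-cong s (λ i i<s → write-other digits s q (<⇒≢ i<s)))
        ternary′ : ∀ i → digits′ i < 3
        ternary′ i with i ≟ s
        ... | yes _ = q<3
        ... | no  _ = ternary i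

      path : ∀ s → Path s
      path zero = record
        { digits   = λ _ → 0
        ; ternary  = λ _ → z<s
        ; beyond   = λ _ _ → refl
        ; statuses = initial-status
        ; follows  = initial-follows
        ; progress = inj₁ z≤n
        }
      path (suc s) = extend π (next progress (proj₂ (detect-correct _ (symmetric dis))))
        where
        π = path s
        open Path π
        L = simulate digits s
        dis : Dissimilarity L
        dis = simulate-dissimilarity digits s
        stop : n ≤ c₀ (detect L) → ∃[ q ] q < 3 × ∃[ st ] Follows (child q L) st ×
          (2 * suc s ≤ sum² n st ⊎ n ≤ c₀ (detect (child q L)))
        stop n≤c₀ = 0 , z<s , statuses ,
          subst (λ L → Follows L statuses) (sym (child-done 0 n≤c₀)) follows ,
          inj₂ (subst (λ L → n ≤ c₀ (detect L)) (sym (child-done 0 n≤c₀)) n≤c₀)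
        next : 2 * s ≤ sum² n statuses ⊎ n ≤ c₀ (detect L) → Sound L (detect L) →
          ∃[ q ] q < 3 × ∃[ st ] Follows (child q L) st ×
          (2 * suc s ≤ sum² n st ⊎ n ≤ c₀ (detect (child q L)))
        next (inj₂ n≤c₀) _ = stop n≤c₀
        next (inj₁ _) (inj₂ (n≤c₀ , _)) = stop n≤c₀
        next (inj₁ 2s≤) (inj₁ v) with q , q<3 , st , f , le ← follow dis v follows =
          q , q<3 , st , f , inj₁ (≤-trans (≤-reflexive (*-suc 2 s)) (≤-trans (+-monoʳ-≤ 2 2s≤) le))

      -- A cell in its original state agrees with `D`. It could be flagged only for a zero of `D`
      -- off the diagonal, and there `d` is positive and so differs from `D`. Every other cell
      -- belongs to a changed pair.
      follows-good : ∀ {L st} → Follows L st →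
        sum² n (λ x y → ⟦ bad L x y ⟧) < 1 × sum² n (λ x y → ⟦ flagged L x y ⟧) < suc (2 * k)
      follows-good {L} {st} follows =
        s≤s (≤-trans (sum²-mono n not-bad) (≤-trans (sum²-*ˡ n 0 (λ _ _ → 0)) z≤n)) ,
        s≤s (≤-trans (sum²-mono n flagged≤) few)
        where
        open Follows follows
        0≼d : ∀ {x y} → x < n → y < n → D 0 0 ≼ 0#
        0≼d x<n y<n = D.diag≼ (≤-<-trans z≤n x<n)
        L≼u : ∀ {x y} → x < n → y < n → L x y ≼ u x y
        L≼u {x} {y} x<n y<n with status x<n y<n
        ... | inj₁ (_ , L≡D , _ , D≼u) = subst (_≼ u x y) (sym L≡D) D≼u
        ... | inj₂ (_ , _ , _ , L≼d)   = ≼-trans L≼d (upper x<n y<n)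
        -- The bound is written as a product so that `sum²-*ˡ` with factor 0 evaluates the sum of
        -- zeros.
        not-bad : ∀ x y → x < n → y < n → ⟦ bad L x y ⟧ ≤ 0 * 0
        not-bad x y x<n y<n with l x y ≼? L x y | L x y ≼? u x y | u x y ≼? D 0 0 | x ≟ y
        ... | no ¬p | _ | _ | _ = contradiction (above x<n y<n) ¬p
        ... | yes _ | no ¬q | _ | _ = contradiction (L≼u x<n y<n) ¬q
        ... | yes _ | yes _ | yes r | no x≢y =
          contradiction (≼-trans (upper x<n y<n) (≼-trans r (0≼d x<n y<n))) (positive x<n y<n x≢y)
        ... | yes _ | yes _ | yes _ | yes refl rewrite differ-≡ x = z≤n
        ... | yes _ | yes _ | no _  | _ with differ x y
        ...   | true  = z≤n
        ...   | false = z≤n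
        flagged≤ : ∀ x y → x < n → y < n → ⟦ flagged L x y ⟧ ≤ ⟦ changed d x y ⟧
        flagged≤ x y x<n y<n with D x y ≼? d x y | d x y ≼? D x y
        ... | no _  | _    = ⟦ flagged L x y ⟧≤1
        ... | yes _ | no _ = ⟦ flagged L x y ⟧≤1
        ... | yes D≼d | yes d≼D with status x<n y<n
        ...   | inj₂ (_ , _ , diff , _) = contradiction (D≼d , d≼D) diff
        ...   | inj₁ (_ , L≡D , _) with L x y ≼? D x y | D x y ≼? L x y | D x y ≼? D 0 0 | x ≟ y
        ...     | no ¬p | _ | _ | _ = contradiction (subst (_≼ D x y) (sym L≡D) ≼-refl) ¬p
        ...     | yes _ | no ¬q | _ | _ = contradiction (subst (D x y ≼_) (sym L≡D) ≼-refl) ¬q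
        ...     | yes _ | yes _ | yes r | no x≢y =
          contradiction (≼-trans d≼D (≼-trans r (0≼d x<n y<n))) (positive x<n y<n x≢y)
        ...     | yes _ | yes _ | yes _ | yes refl rewrite differ-≡ x = z≤n
        ...     | yes _ | yes _ | no _  | _ with differ x y
        ...       | true  = z≤n
        ...       | false = z≤n

      complete : ∃[ w ] (∀ i → w i < 3) × (∀ i → 2 * k ≤ i → w i ≡ 0) × Accepted w
      complete = digits , ternary , beyond , none , subst Good (sym same) (follows-good follows)
        where
        open Path (path (2 * k))
        L = simulate digits (2 * k)
        dis : Dissimilarity L
        dis = simulate-dissimilarity digits (2 * k)
        Good : (ℕ → ℕ → C) → Set
        Good L = sum² n (λ x y → ⟦ bad L x y ⟧) < 1 ×
                 sum² n (λ x y → ⟦ flagged L x y ⟧) < suc (2 * k)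
        none : n ≤ c₀ (detect L)
        none with progress | proj₂ (detect-correct L (symmetric dis))
        ... | inj₂ n≤c₀ | _               = n≤c₀
        ... | inj₁ _    | inj₂ (n≤c₀ , _) = n≤c₀
        -- One more repair would lift the total status to 4 k + 2, beyond `status≤`.
        ... | inj₁ full | inj₁ v with _ , _ , _ , f , le ← follow dis v follows =
          contradiction (≤-trans (≤-trans (+-monoʳ-≤ 2 full) le) (status≤ f)) (<⇒≱ (m≤n⇒m≤1+n ≤-refl))
        same : simulate digits (suc (2 * k)) ≡ L
        same = child-done (digits (2 * k)) none

    -- Conversely, an accepted matrix becomes a solution once its zero entries
    -- off the diagonal are replaced by a small positive number.
    module Soundness {w} (accepted : Accepted w) where

      private
        L = simulate w (2 * k)
        none = proj₁ accepted

        dis : Dissimilarity L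
        dis = simulate-dissimilarity w (2 * k)

        module L = Dissimilarity dis

        same : simulate w (suc (2 * k)) ≡ L
        same = child-done (w (2 * k)) none

      bad-sum : sum² n (λ x y → ⟦ bad L x y ⟧) < 1
      bad-sum = subst (λ L → sum² n (λ x y → ⟦ bad L x y ⟧) < 1) same (proj₁ (proj₂ accepted))

      flagged-sum : sum² n (λ x y → ⟦ flagged L x y ⟧) < suc (2 * k)
      flagged-sum = subst (λ L → sum² n (λ x y → ⟦ flagged L x y ⟧) < suc (2 * k)) same
                          (proj₂ (proj₂ accepted))

      good : ∀ {x y} → x < n → y < n →
             l x y ≼ L x y × L x y ≼ u x y × (x ≢ y → ¬ u x y ≼ D 0 0)
      good {x} {y} x<n y<n
        with l x y ≼? L x y | L x y ≼? u x y | u x y ≼? D 0 0 | sum²-zero n (n<1⇒n≡0 bad-sum) x<n y<n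
      ... | yes p | yes q | yes _ | eq = p , q , λ x≢y →
            contradiction (trans (sym (cong (λ b → ⟦ not (true ∧ true ∧ not (b ∧ true)) ⟧) (differ-≢ x≢y))) eq) λ ()
      ... | yes p | yes q | no ¬r | _ = p , q , λ _ → ¬r

      open Max (RealNumbers.totalOrder ℝ) using (x≤x⊔y; x≤y⊔x)
        renaming (_⊔_ to _⊔ʳ_; ⊔-lub to ⊔ʳ-lub)

      private
        -- One of 1 and -1 is positive, by translation invariance of the order alone: were both at
        -- most zero, then 1 would equal 0.
        positive-real : ∃[ ε ] ¬ ε ≼ 0#
        positive-real with 1# ≼? 0#
        ... | no  1⋠0 = 1# , 1⋠0
        ... | yes 1≼0 = - 1# , λ -1≼0 → 0≉1 (begin
          0#          ≈⟨ ring.-‿inverseʳ 1# ⟨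
          1# - 1#     ≈⟨ ring.+-congˡ (≼-antisym -1≼0 0≼-1) ⟩
          1# +ʳ 0#    ≈⟨ ring.+-identityʳ 1# ⟩
          1#          ∎)
          where
          module ring = CommutativeRing commutativeRing
          open ≈-Reasoning ring.setoid
          0≼-1 : 0# ≼ - 1#
          0≼-1 = ≼-trans (≼-reflexive (ring.sym (ring.-‿inverseˡ 1#)))
            (≼-trans (+ʳ-mono (- 1#) 1≼0) (≼-reflexive (ring.+-identityʳ (- 1#))))

      below-all : ∀ m (f : ℕ → C) {ε} → ¬ ε ≼ 0# →
        ∃[ δ ] ¬ δ ≼ 0# × δ ≼ ε × (∀ i → i < m → f i ≼ 0# ⊎ δ ≼ f i)
      below-all zero f {ε} ε>0 = ε , ε>0 , ≼-refl , λ _ ()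
      below-all (suc m) f {ε} ε>0 with below-all m f ε>0 | f m ≼? 0#
      ... | δ , δ>0 , δ≼ε , δ≼f | yes fm≼0 = δ , δ>0 , δ≼ε , below-suc _ δ≼f (inj₁ fm≼0)
      ... | δ , δ>0 , δ≼ε , δ≼f | no fm>0 with ≼-total δ (f m)
      ...   | inj₁ δ≼fm = δ , δ>0 , δ≼ε , below-suc _ δ≼f (inj₂ δ≼fm)
      ...   | inj₂ fm≼δ = f m , fm>0 , ≼-trans fm≼δ δ≼ε ,
              below-suc _ (λ i i<m → Sum.map₂ (≼-trans fm≼δ) (δ≼f i i<m)) (inj₂ ≼-refl)

      below-all² : ∀ m (f : ℕ → ℕ → C) {ε} → ¬ ε ≼ 0# →
        ∃[ δ ] ¬ δ ≼ 0# × δ ≼ ε × (∀ x y → x < m → y < n → f x y ≼ 0# ⊎ δ ≼ f x y)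
      below-all² zero f {ε} ε>0 = ε , ε>0 , ≼-refl , λ _ _ ()
      below-all² (suc m) f {ε} ε>0
        with δ , δ>0 , δ≼ε , δ≼f ← below-all² m f ε>0
        with δ′ , δ′>0 , δ′≼δ , δ′≼f ← below-all n (f m) δ>0
        = δ′ , δ′>0 , ≼-trans δ′≼δ δ≼ε , λ x y x<1+m → below-suc
            (λ x → ∀ y → y < n → f x y ≼ 0# ⊎ δ′ ≼ f x y)
            (λ x x<m y y<n → Sum.map₂ (≼-trans δ′≼δ) (δ≼f x y x<m y<n)) δ′≼f x x<1+m y

      -- Finitely many positive entries leave room for a positive `ε` below all of them. Being below
      -- those of `u`, it respects the upper bounds; being below those of `D`, it does not disturb
      -- pairs on which `L` agrees with a positive `D`.
      small-real : ∃[ ε ] ¬ ε ≼ 0# ×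
        (∀ x y → x < n → y < n → (u x y ≼ 0# ⊎ ε ≼ u x y) × (D x y ≼ 0# ⊎ ε ≼ D x y))
      small-real
        with _ , one>0 ← positive-real
        with δ , δ>0 , _ , δ≼u ← below-all² n u one>0
        with ε , ε>0 , ε≼δ , ε≼D ← below-all² n D δ>0
        = ε , ε>0 , λ x y x<n y<n →
            Sum.map₂ (≼-trans ε≼δ) (δ≼u x y x<n y<n) , ε≼D x y x<n y<n

      private
        ε = proj₁ small-real
        ε>0 = proj₁ (proj₂ small-real)
        ε≼ = proj₂ (proj₂ small-real)

      -- All small entries off the diagonal are lifted, not just the zeros: the maximum with a
      -- constant preserves the ultrametric inequality, which altering the zeros by an arbitrary
      -- positive number would not.
      solution : ℕ → ℕ → C
      solution x y with x ≟ y
      ... | yes _ = 0#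
      ... | no  _ = L x y ⊔ʳ ε

      private
        L≼solution : ∀ {x y t} → x < n → y < n → solution x y ≼ t → L x y ≼ t
        L≼solution {x} {y} x<n y<n p with x ≟ y
        ... | yes refl = ≼-trans (L.diag≼ x<n) p
        ... | no  _    = ≼-trans (x≤x⊔y _ _) p

        ε≼solution : ∀ {x y t} → x ≢ y → solution x y ≼ t → ε ≼ t
        ε≼solution {x} {y} x≢y p with x ≟ y
        ... | yes x≡y = contradiction x≡y x≢y
        ... | no  _   = ≼-trans (x≤y⊔x _ _) p

        solution≼ : ∀ {x y t} → x ≢ y → L x y ≼ t → ε ≼ t → solution x y ≼ t
        solution≼ {x} {y} x≢y p q with x ≟ y
        ... | yes x≡y = contradiction x≡y x≢y
        ... | no  _   = ⊔ʳ-lub p q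

        diagonal : ∀ x → solution x x ≡ 0#
        diagonal x with x ≟ x
        ... | yes _  = refl
        ... | no x≢x = contradiction refl x≢x

        0≼solution : ∀ {x y} → x < n → y < n → 0# ≼ solution x y
        0≼solution {x} {y} x<n y<n with x ≟ y
        ... | yes _ = ≼-refl
        ... | no  _ = ≼-trans (L.0≼ x<n y<n) (x≤x⊔y _ _)

      solution-dissimilarity : Dissimilarity solution
      solution-dissimilarity = record
        { 0≼    = 0≼solution
        ; sym≼  = λ {x} {y} x<n y<n → sym≼ x<n y<n (x ≟ y)
        ; diag≼ = λ {x} _ → subst (_≼ 0#) (sym (diagonal x)) ≼-refl
        }
        where
        sym≼ : ∀ {x y} → x < n → y < n → Dec (x ≡ y) → solution x y ≼ solution y x
        sym≼ x<n y<n (yes refl) = ≼-refl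
        sym≼ x<n y<n (no x≢y)   = solution≼ x≢y
          (≼-trans (L.sym≼ x<n y<n) (L≼solution y<n x<n ≼-refl))
          (ε≼solution (≢-sym x≢y) ≼-refl)

      sound : Solution solution
      sound = record
        { dissimilarity = solution-dissimilarity
        ; positive = λ x<n y<n x≢y p → ε>0 (ε≼solution x≢y p)
        ; ultra    = λ {x} {y} {z} x<n y<n z<n → ultra x<n y<n z<n (x ≟ z) (x ≟ y)
        ; lower    = λ {x} {y} x<n y<n →
                       ≼-trans (proj₁ (good x<n y<n)) (L≼solution x<n y<n ≼-refl)
        ; upper    = λ {x} {y} x<n y<n → upper x<n y<n (x ≟ y)
        ; few      = ≤-trans (sum²-mono n changed≤) (s≤s⁻¹ flagged-sum)
        }
        where
        ultra : ∀ {x y z} → x < n → y < n → z < n → Dec (x ≡ z) → Dec (x ≡ y) →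
                ∀ {t} → solution x y ≼ t → solution y z ≼ t → solution x z ≼ t
        ultra {x} x<n y<n z<n (yes refl) _ p q =
          subst (_≼ _) (sym (diagonal x)) (≼-trans (0≼solution x<n y<n) p)
        ultra x<n y<n z<n (no _) (yes refl) p q = q
        ultra x<n y<n z<n (no x≢z) (no x≢y) p q = solution≼ x≢z
          (detect-none dis none x<n y<n z<n (L≼solution x<n y<n p) (L≼solution y<n z<n q))
          (ε≼solution x≢y p)
        upper : ∀ {x y} → x < n → y < n → Dec (x ≡ y) → solution x y ≼ u x y
        upper {x} x<n y<n (yes refl) = subst (_≼ u x x) (sym (diagonal x)) (u.0≼ x<n y<n)
        upper {x} {y} x<n y<n (no x≢y) with proj₁ (ε≼ x y x<n y<n)
        ... | inj₂ ε≼u = solution≼ x≢y (proj₁ (proj₂ (good x<n y<n))) ε≼u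
        ... | inj₁ u≼0 = contradiction (≼-trans u≼0 (D.0≼ 0<n 0<n))
                                       (proj₂ (proj₂ (good x<n y<n)) x≢y)
          where
          0<n = ≤-<-trans z≤n x<n
        changed≤ : ∀ x y → x < n → y < n → ⟦ changed solution x y ⟧ ≤ ⟦ flagged L x y ⟧
        changed≤ x y x<n y<n with flagged L x y in eq
        ... | true  = ⟦ changed solution x y ⟧≤1
        ... | false = ≤-reflexive (cong ⟦_⟧ (uncurry (unchanged solution) (matching (x ≟ y))))
          where
          clear = not-flagged L eq
          matching : Dec (x ≡ y) → D x y ≼ solution x y × solution x y ≼ D x y
          matching (yes refl) = subst (D x x ≼_) (sym (diagonal x)) (D.diag≼ x<n) ,
                             subst (_≼ D x x) (sym (diagonal x)) (D.0≼ x<n x<n)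
          matching (no x≢y) with proj₂ (ε≼ x y x<n y<n)
          ... | inj₁ D≼0 = contradiction (≼-trans D≼0 (D.0≼ 0<n 0<n)) (proj₂ (proj₂ clear) x≢y)
            where
            0<n = ≤-<-trans z≤n x<n
          ... | inj₂ ε≼D = ≼-trans (proj₁ (proj₂ clear)) (L≼solution x<n y<n ≼-refl) ,
                           solution≼ x≢y (proj₁ clear) ε≼D

-- The program

-- Lockstep induction, comparing a loop on memories with the functional iteration that specifies it.
iter-relate : {A B : Set} {f : ℕ → A → A} {g : ℕ → B → B} {a : A} {b : B}
  (R : ℕ → A → B → Set) (m : ℕ) → R 0 a b →
  (∀ {j a b} → j < m → R j a b → R (suc j) (f j a) (g j b)) →
  R m (iter f m a) (iter g m b)
iter-relate R zero    base step = base
iter-relate R (suc m) base step =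
  step ≤-refl (iter-relate R m base (λ j<m → step (m≤n⇒m≤1+n j<m)))

when-relate : {A B : Set} (R : A → B → Set) {x x′ : A} {y y′ : B} {b b′ : Bool} →
  b ≡ b′ → (b ≡ true → R x y) → (b ≡ false → R x′ y′) →
  R (when b then x else x′) (when b′ then y else y′)
when-relate R {b = true}  refl p q = p refl
when-relate R {b = false} refl p q = q refl

-- Division with remainder: row-major addresses determine row and column. With 3 ^ m in place of `n`
-- it also splits off the leading digit of a numeral.
index-injective : ∀ {n x y a b} → y < n → b < n → x * n + y ≡ a * n + b → x ≡ a × y ≡ b
index-injective {n} {x} {y} {a} {b} y<n b<n eq =
  *-cancelʳ-≡ x a n (+-cancelʳ-≡ b _ _ (trans (cong (x * n +_) (sym y≡b)) eq)) , y≡b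
  where
  instance
    n≢0 : NonZero n
    n≢0 = >-nonZero (≤-<-trans z≤n y<n)
  residue : ∀ x y → y < n → (x * n + y) % n ≡ y
  residue x y y<n = trans (cong (_% n) (+-comm (x * n) y))
                          (trans ([m+kn]%n≡m%n y x n) (m<n⇒m%n≡m y<n))
  y≡b : y ≡ b
  y≡b = trans (sym (residue x y y<n)) (trans (cong (_% n) eq) (residue a b b<n))

output carry digit parent′ cur pred′ row v₀ v₁ v₂ end₁′ end₂′ row₂ count bads : Fin 14
output  = # 0
carry   = # 1
digit   = # 2
parent′ = # 3
cur     = # 4
pred′   = # 5
row     = # 6
v₀      = # 7
v₁      = # 8
v₂      = # 9
end₁′   = # 10
end₂′   = # 11
row₂    = # 12
count   = # 13
-- The array is shared with `cur`, which is idle while an attempt is checked.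
bads    = # 4

dist′ lower′ upper′ lo key′ best attach : Fin 8
dist′  = # 0
lower′ = # 1
upper′ = # 2
lo     = # 3
key′   = # 4
best   = # 5
attach = # 6

get : ∀ {d} → Fin 14 → Term d
get a = a [ lit 0 ]

-- Multiplies an index by `n` through additions: `n` is added in just those of the `n` passes whose
-- counter lies below the index. The linear cost is affordable once per visited vertex.
rowOf : ∀ {d} → Fin 14 → Fin 14 → Stmt d
rowOf {d} a b = a [ lit 0 ]≔ lit 0 ▹
  for 0 (branch (loop (fromℕ d) ≺ get b) (a [ lit 0 ]≔ get a ⊞ con 0) nop)

x₃ : Term 4
x₃ = loop (# 3)

pickS : Stmt 3
pickS = cur [ lit 0 ]≔ con 0 ▹
  for 0 (branch (parent′ [ x₃ ] ≺ con 0 & ! (get cur ≺ con 0 & key′ [ get cur ]≼ key′ [ x₃ ]))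
                (cur [ lit 0 ]≔ x₃) nop)

relaxOuter relaxInner scanS : Stmt 4
relaxOuter = branch (key′ [ x₃ ]≼ lo [ get row ⊞ x₃ ]) nop
  (key′ [ x₃ ]← lo [ get row ⊞ x₃ ] ▹ parent′ [ x₃ ]≔ get cur)
relaxInner = branch (key′ [ x₃ ]≼ attach [ lit 0 ]) (key′ [ x₃ ]← attach [ lit 0 ]) nop
scanS = branch (! (lo [ get row ⊞ x₃ ]≼ key′ [ x₃ ]) & ! (lo [ get row ⊞ x₃ ]≼ best [ lit 0 ]))
  (best [ lit 0 ]← lo [ get row ⊞ x₃ ] ▹ v₀ [ lit 0 ]≔ x₃ ▹
   v₁ [ lit 0 ]≔ get pred′ ▹ v₂ [ lit 0 ]≔ get cur) nop

visitLoop visitS advanceS : Stmt 3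
visitLoop = for 0 (branch (parent′ [ x₃ ] ≺ con 0) relaxOuter (relaxInner ▹ scanS))
visitS = rowOf row cur ▹
  -- The loop treats `cur` as an outer vertex and may overwrite its parent and key, so both are
  -- saved before; only after the loop does `cur` join the tree.
  pred′ [ lit 0 ]≔ parent′ [ get cur ] ▹ attach [ lit 0 ]← key′ [ get cur ] ▹
  visitLoop ▹ parent′ [ get cur ]≔ con 0
advanceS = pickS ▹ branch (get cur ≺ con 0) visitS nop

x₂ : Term 3
x₂ = loop (# 2)

detectCode : Stmt 2
detectCode =
  for 0 (parent′ [ x₂ ]≔ lit 0 ▹ key′ [ x₂ ]← lo [ x₂ ]) ▹
  parent′ [ lit 0 ]≔ con 0 ▹ best [ lit 0 ]← lo [ lit 0 ] ▹
  v₀ [ lit 0 ]≔ con 0 ▹ v₁ [ lit 0 ]≔ lit 0 ▹ v₂ [ lit 0 ]≔ lit 0 ▹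
  for 0 advanceS

-- Prim's algorithm on the machine

module Execution (ℝ : RealNumbers) (κ : ℕ → ℕ) (inp : ℕ → RealNumbers.Carrier ℝ) where

  open Order ℝ
  open Semantics ℝ

  private
    n = κ 0

  open Detection ℝ n

  row-value : ∀ {d} ρ a b → a ≢ b → ∀ μ → word μ b 0 ≤ n →
              word (exec κ inp ρ (rowOf {d} a b) μ) a 0 ≡ word μ b 0 * n
  row-value {d} ρ a b a≢b μ b≤n = final
    where
    B : ℕ
    B = word μ b 0
    I : ℕ → Memory → Set
    I j ν = word ν b 0 ≡ B × (j ≤ B × word ν a 0 ≡ j * n ⊎ B ≤ j × word ν a 0 ≡ B * n)
    start′ : Memory
    start′ = memory (update (word μ) a 0 0) (real μ)
    set-a : ∀ (ν : Memory) v → update (word ν) a 0 v a 0 ≡ v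
    set-a ν v rewrite dec-true (a Fin.≟ a) refl = refl
    keep-b : ∀ (ν : Memory) v → update (word ν) a 0 v b 0 ≡ word ν b 0
    keep-b ν v rewrite dec-false (a Fin.≟ b) a≢b = refl
    body : ℕ → Memory → Memory
    body j = exec κ inp (write ρ d j) (branch (loop (fromℕ d) ≺ get b) (a [ lit 0 ]≔ get a ⊞ con 0) nop)
    step : ∀ {j ν} → j < n → I j ν → I (suc j) (body j ν)
    step {j} {ν} j<n (b≡ , a≡)
      rewrite Fin.toℕ-fromℕ d | write-same ρ d j {d} refl | b≡
      with j <ᵇ B | <ᵇ-reflects-< j B | a≡
    ... | _ | ofʸ j<B | inj₁ (_ , a≡) =
          trans (keep-b ν _) b≡ ,
          inj₁ (j<B , trans (set-a ν _) (trans (cong (_+ n) a≡) (+-comm (j * n) n)))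
    ... | _ | ofʸ j<B | inj₂ (B≤j , _) = contradiction j<B (≤⇒≯ B≤j)
    ... | _ | ofⁿ j≮B | inj₁ (j≤B , a≡) = b≡ , inj₂ (m≤n⇒m≤1+n (≮⇒≥ j≮B) ,
            trans a≡ (cong (_* n) (≤-antisym j≤B (≮⇒≥ j≮B))))
    ... | _ | ofⁿ _   | inj₂ (B≤j , a≡) = b≡ , inj₂ (m≤n⇒m≤1+n B≤j , a≡)
    final : word (iter body n start′) a 0 ≡ B * n
    final with iter-induction I n (keep-b μ 0 , inj₁ (z≤n , set-a μ 0)) (λ {j} {ν} → step {j} {ν})
    ... | _ , inj₂ (_ , eq)   = eq
    ... | _ , inj₁ (n≤B , eq) = trans eq (cong (_* n) (≤-antisym n≤B b≤n))

  Agree : {A : Set} → (ℕ → A) → (ℕ → A) → Set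
  Agree f g = ∀ x → x < n → f x ≡ g x

  pick-value : ∀ ρ μ {par ky} → Agree (word μ parent′) par → Agree (real μ key′) ky →
               word (exec κ inp ρ pickS μ) cur 0 ≡ pick par ky n
  pick-value ρ μ {par} {ky} par≡ ky≡ = proj₁
    (iter-relate R n (refl , refl , refl) (λ {j} {ν} {b} → step {j} {ν} {b}))
    where
    R : ℕ → Memory → ℕ → Set
    R j ν b = word ν cur 0 ≡ b × word ν parent′ ≡ word μ parent′ × real ν key′ ≡ real μ key′
    body : ℕ → Memory → Memory
    body j = exec κ inp (write ρ 3 j)
      (branch (parent′ [ x₃ ] ≺ con 0 & ! (get cur ≺ con 0 & key′ [ get cur ]≼ key′ [ x₃ ]))
              (cur [ lit 0 ]≔ x₃) nop)
    choice : ℕ → ℕ → ℕ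
    choice j b = when outer par j ∧ not (does (b <? n) ∧ does (ky b ≼? ky j)) then j else b
    step : ∀ {j ν b} → j < n → R j ν b → R (suc j) (body j ν) (choice j b)
    step {j} {ν} {b} j<n (refl , p , k) = when-relate (R (suc j))
      {x = exec κ inp (write ρ 3 j) (cur [ lit 0 ]≔ x₃) ν} {ν} {j} {b}
      (cong₂ (λ p q → (p <ᵇ n) ∧ not q) (trans (cong (λ f → f j) p) (par≡ j j<n)) test)
      (λ _ → refl , p , k) (λ _ → refl , p , k)
      where
      test : does (b <? n) ∧ does (real ν key′ b ≼? real ν key′ j) ≡
             does (b <? n) ∧ does (ky b ≼? ky j)
      test with b <ᵇ n | <ᵇ-reflects-< b n
      -- For the default `b = n` the key cells need not agree, but both conjunctions are already
      -- false.
      ... | _ | ofⁿ _   = refl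
      ... | _ | ofʸ b<n = cong₂ (λ x y → does (x ≼? y))
              (trans (cong (λ f → f b) k) (ky≡ b b<n)) (trans (cong (λ f → f j) k) (ky≡ j j<n))

  -- The machine updates an array in place where the specification forms a new function; this
  -- describes the array midway through the pass.
  Progress : {A : Set} → (ℕ → A) → (ℕ → A) → (ℕ → A) → ℕ → Set
  Progress f new old i = (∀ x → x < i → f x ≡ new x) × (∀ x → i ≤ x → x < n → f x ≡ old x)

  progress-skip : {A : Set} {f new old : ℕ → A} {i : ℕ} → i < n → old i ≡ new i →
                  Progress f new old i → Progress f new old (suc i)
  progress-skip {f = f} {new} {old} {i} i<n eq (done , todo) =
    below-suc _ done (trans (todo i ≤-refl i<n) eq) , λ x i<x → todo x (<⇒≤ i<x)

  progress-write : {A : Set} {f new old : ℕ → A} {i : ℕ} {v : A} → v ≡ new i →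
                   Progress f new old i → Progress (write f i v) new old (suc i)
  progress-write {f = f} {new} {old} {i} {v} eq (done , todo) =
    below-suc _ (λ x x<i → trans (write-other f i v (<⇒≢ x<i)) (done x x<i))
                (trans (write-same f i v refl) eq) ,
    λ x i<x x<n → trans (write-other f i v (≢-sym (<⇒≢ i<x))) (todo x (<⇒≤ i<x) x<n)

  Holds-matrix : (ℕ → C) → (ℕ → ℕ → C) → Set
  Holds-matrix f L = ∀ x y → x < n → y < n → f (x * n + y) ≡ L x y

  Holds-cong : ∀ {f g L} → f ≡ g → Holds-matrix g L → Holds-matrix f L
  Holds-cong refl g≡ = g≡

  Holds-conflict : Memory → Conflict → Set
  Holds-conflict μ c = real μ best 0 ≡ top c × word μ v₀ 0 ≡ c₀ c ×
                       word μ v₁ 0 ≡ c₁ c × word μ v₂ 0 ≡ c₂ c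

  module _ {L : ℕ → ℕ → C} (par : ℕ → ℕ) (ky : ℕ → C) (v : ℕ) (v<n : v < n) where

    private
      K = newKey L par ky v
      P = newParent L par ky v

    record Row (i : ℕ) (μ : Memory) (c : Conflict) : Set where
      constructor row-state
      field
        lo≡       : Holds-matrix (real μ lo) L
        cur≡      : word μ cur 0 ≡ v
        row≡      : word μ row 0 ≡ v * n
        pred≡     : word μ pred′ 0 ≡ par v
        attach≡   : real μ attach 0 ≡ ky v
        keys      : Progress (real μ key′) K ky i
        parents   : Progress (word μ parent′) P par i
        conflict≡ : Holds-conflict μ c

    lo-read : ∀ {i μ c j} → j < n → Row i μ c → real μ lo (word μ row 0 + j) ≡ L v j
    lo-read {μ = μ} {j = j} j<n r =
      trans (cong (λ m → real μ lo (m + j)) (Row.row≡ r)) (Row.lo≡ r v j v<n j<n)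

    outer-row : ∀ {ρ j μ c} → j < n → par j < n → Row j μ c →
                Row (suc j) (exec κ inp (write ρ 3 j) relaxOuter μ) c
    outer-row {ρ} {j} {μ} {c} j<n j∉ r@(row-state lo≡ cur≡ row≡ pred≡ attach≡ keys parents conf)
      rewrite lo-read j<n r | proj₂ keys j ≤-refl j<n
      with ky j ≼? L v j in eq
    ... | yes _ = row-state lo≡ cur≡ row≡ pred≡ attach≡
          (progress-skip j<n (sym (trans (when-true out) (when-true (cong does eq)))) keys)
          (progress-skip j<n (sym (trans (when-true out) (when-true (cong does eq)))) parents) conf
      where
      out : outer par j ≡ true
      out = dec-true (par j <? n) j∉
    ... | no _ = row-state lo≡ cur≡ row≡ pred≡ attach≡
          (progress-write (sym (trans (when-true out) (when-false (cong does eq)))) keys)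
          (progress-write (trans cur≡ (sym (trans (when-true out) (when-false (cong does eq)))))
                          parents) conf
      where
      out : outer par j ≡ true
      out = dec-true (par j <? n) j∉

    inner-row : ∀ {ρ j μ c} → j < n → n ≤ par j → Row j μ c →
                Row (suc j) (exec κ inp (write ρ 3 j) relaxInner μ) c
    inner-row {ρ} {j} {μ} {c} j<n j∈ r@(row-state lo≡ cur≡ row≡ pred≡ attach≡ keys parents conf)
      rewrite attach≡ | proj₂ keys j ≤-refl j<n
      with ky j ≼? ky v in eq
    ... | yes _ = row-state lo≡ cur≡ row≡ pred≡ attach≡
          (progress-write (sym (trans (when-false inn) (when-true (cong does eq)))) keys)
          (progress-skip j<n (sym (when-false inn)) parents) conf
      where
      inn : outer par j ≡ false
      inn = dec-false (par j <? n) (≤⇒≯ j∈)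
    ... | no _ = row-state lo≡ cur≡ row≡ pred≡ attach≡
          (progress-skip j<n (sym (trans (when-false inn) (when-false (cong does eq)))) keys)
          (progress-skip j<n (sym (when-false inn)) parents) conf
      where
      inn : outer par j ≡ false
      inn = dec-false (par j <? n) (≤⇒≯ j∈)

    scan-row : ∀ {ρ j μ c} → j < n → n ≤ par j → Row (suc j) μ c →
               Row (suc j) (exec κ inp (write ρ 3 j) scanS μ) (scan L par ky v K j c)
    scan-row {ρ} {j} {μ} {c} j<n j∈ r@(row-state lo≡ cur≡ row≡ pred≡ attach≡ keys parents conf) =
      subst (Row (suc j) _) (sym (when-false inn))
        (when-relate (Row (suc j))
          (cong₂ (λ a b → not a ∧ not b)
            (cong₂ (λ a b → does (a ≼? b)) (lo-read j<n r) (proj₁ keys j ≤-refl))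
            (cong₂ (λ a b → does (a ≼? b)) (lo-read j<n r) (proj₁ conf)))
          (λ _ → row-state lo≡ cur≡ row≡ pred≡ attach≡ keys parents
                   (lo-read j<n r , refl , pred≡ , cur≡))
          (λ _ → r))
      where
      inn : outer par j ≡ false
      inn = dec-false (par j <? n) (≤⇒≯ j∈)

    scan-outer : ∀ {j c} → par j < n → scan L par ky v K j c ≡ c
    scan-outer {j} j∉ = when-true (dec-true (par j <? n) j∉)

    visit-rows : ∀ {ρ μ c} → Row 0 μ c →
                 Row n (exec κ inp ρ visitLoop μ) (iter (scan L par ky v K) n c)
    visit-rows {ρ} r = iter-relate Row n r (λ {j} j<n r → step j<n r (par j <? n))
      where
      body : ℕ → Memory → Memory
      body j = exec κ inp (write ρ 3 j) (branch (parent′ [ x₃ ] ≺ con 0) relaxOuter (relaxInner ▹ scanS))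
      step : ∀ {j ν c} → j < n → Row j ν c → Dec (par j < n) →
             Row (suc j) (body j ν) (scan L par ky v K j c)
      step {j} {ν} {c} j<n r j∉? = subst (λ x → Row (suc j) x _) (sym same) (split j∉?)
        where
        same : body j ν ≡ (when does (par j <? n) then exec κ inp (write ρ 3 j) relaxOuter ν
                           else exec κ inp (write ρ 3 j) (relaxInner ▹ scanS) ν)
        same = cong (λ m → when m <ᵇ n then _ else _) (proj₂ (Row.parents r) j ≤-refl j<n)
        split : Dec (par j < n) → Row (suc j)
          (when does (par j <? n) then exec κ inp (write ρ 3 j) relaxOuter ν
           else exec κ inp (write ρ 3 j) (relaxInner ▹ scanS) ν) (scan L par ky v K j c)
        split (yes j∉) = subst₂ (Row (suc j)) (sym (when-true (dec-true (par j <? n) j∉)))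
          (sym (scan-outer j∉)) (outer-row {ρ} j<n j∉ r)
        split (no j∈) = subst (λ x → Row (suc j) x (scan L par ky v K j c))
          (sym (when-false (dec-false (par j <? n) j∈)))
          (scan-row {ρ} j<n (≮⇒≥ j∈) (inner-row {ρ} j<n (≮⇒≥ j∈) r))

  conflict-frame : ∀ μ ν c → real ν best ≡ real μ best → word ν v₀ ≡ word μ v₀ →
    word ν v₁ ≡ word μ v₁ → word ν v₂ ≡ word μ v₂ → Holds-conflict μ c → Holds-conflict ν c
  conflict-frame μ ν c b p q r (b≡ , p≡ , q≡ , r≡) =
    trans (cong-app b 0) b≡ , trans (cong-app p 0) p≡ ,
    trans (cong-app q 0) q≡ , trans (cong-app r 0) r≡

  record Prim-state (L : ℕ → ℕ → C) (μ : Memory) (s : Prim) : Set where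
    constructor prim-state
    field
      lo≡       : Holds-matrix (real μ lo) L
      keys      : Agree (real μ key′) (key s)
      parents   : Agree (word μ parent′) (parent s)
      conflict≡ : Holds-conflict μ (worst s)

  visit-state : ∀ {L ρ μ s v} → v < n → word μ cur 0 ≡ v → Prim-state L μ s →
                Prim-state L (exec κ inp ρ visitS μ) (visit L v s)
  visit-state {L} {ρ} {μ} {s} {v} v<n cur≡ (prim-state lo≡ keys parents conf) = record
    { lo≡       = Row.lo≡ rows
    ; keys      = λ x x<n → proj₁ (Row.keys rows) x x<n
    ; parents   = λ x x<n → trans
        (cong (λ m → write (word ν₃ parent′) m n x) (Row.cur≡ rows))
        (write-cong (word ν₃ parent′) (newParent L par ky v) v n
          (proj₁ (Row.parents rows) x x<n))
    ; conflict≡ = Row.conflict≡ rows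
    }
    where
    par = parent s
    ky  = key s
    ν₁ ν₂ ν₃ : Memory
    ν₁ = exec κ inp ρ (rowOf {3} row cur) μ
    ν₂ = exec κ inp {3} ρ (pred′ [ lit 0 ]≔ parent′ [ get cur ] ▹ attach [ lit 0 ]← key′ [ get cur ]) ν₁
    ν₃ = exec κ inp ρ visitLoop ν₂
    word₁ : ∀ a → writesWord a (rowOf {3} row cur) ≡ false → word ν₁ a ≡ word μ a
    word₁ a fr = word-frame ℝ κ inp a ρ (rowOf {3} row cur) μ fr
    real₁ : ∀ a → real ν₁ a ≡ real μ a
    real₁ a = real-frame ℝ κ inp a ρ (rowOf {3} row cur) μ refl
    cur₁ : word ν₁ cur 0 ≡ v
    cur₁ = trans (cong-app (word₁ cur refl) 0) cur≡
    row₁ : word ν₁ row 0 ≡ v * n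
    row₁ = trans (row-value {3} ρ row cur (λ ()) μ (subst (_≤ n) (sym cur≡) (<⇒≤ v<n)))
                 (cong (_* n) cur≡)
    rows : Row {L} par ky v v<n n ν₃ (iter (scan L par ky v (newKey L par ky v)) n (worst s))
    rows = visit-rows par ky v v<n {ρ} (row-state
      (Holds-cong (real₁ lo) lo≡)
      cur₁ row₁
      (trans (cong (word ν₁ parent′) cur₁) (trans (cong-app (word₁ parent′ refl) v) (parents v v<n)))
      (trans (cong (real ν₁ key′) cur₁) (trans (cong-app (real₁ key′) v) (keys v v<n)))
      ((λ _ ()) , λ x _ x<n → trans (cong-app (real₁ key′) x) (keys x x<n))
      ((λ _ ()) , λ x _ x<n → trans (cong-app (word₁ parent′ refl) x) (parents x x<n))
      (conflict-frame μ ν₁ (worst s) (real₁ best) (word₁ v₀ refl) (word₁ v₁ refl)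
                      (word₁ v₂ refl) conf))

  advance-state : ∀ {L ρ μ s} → Prim-state L μ s →
                  Prim-state L (exec κ inp ρ advanceS μ) (advance L s)
  advance-state {L} {ρ} {μ} {s} st@(prim-state lo≡ keys parents conf) =
    when-relate (Prim-state L) (cong (_<ᵇ n) picked)
      (λ found → visit-state {ρ = ρ} (<ᵇ⇒< _ _ (subst T (sym (trans (cong (_<ᵇ n) (sym picked)) found)) tt))
                             picked st₁)
      (λ _ → st₁)
    where
    ν₁ : Memory
    ν₁ = exec κ inp ρ pickS μ
    picked : word (exec κ inp ρ pickS μ) cur 0 ≡ pick (parent s) (key s) n
    picked = pick-value ρ μ parents keys
    word₁ : ∀ a → writesWord a pickS ≡ false → word (exec κ inp ρ pickS μ) a ≡ word μ a
    word₁ a fr = word-frame ℝ κ inp a ρ pickS μ fr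
    real₁ : ∀ a → real (exec κ inp ρ pickS μ) a ≡ real μ a
    real₁ a = real-frame ℝ κ inp a ρ pickS μ refl
    st₁ : Prim-state L (exec κ inp ρ pickS μ) s
    st₁ = prim-state
      (Holds-cong (real₁ lo) lo≡)
      (λ x x<n → trans (cong-app (real₁ key′) x) (keys x x<n))
      (λ x x<n → trans (cong-app (word₁ parent′ refl) x) (parents x x<n))
      (conflict-frame μ ν₁ (worst s) (real₁ best) (word₁ v₀ refl) (word₁ v₁ refl)
                      (word₁ v₂ refl) conf)

  -- For n = 0 nothing is known about the unused cells.
  record Detected (L : ℕ → ℕ → C) (μ : Memory) (c : Conflict) : Set where
    constructor detected
    field
      lo≡       : Holds-matrix (real μ lo) L
      test≡     : (word μ v₀ 0 <ᵇ n) ≡ (c₀ c <ᵇ n)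
      conflict≡ : 0 < n → Holds-conflict μ c

  detect-state : ∀ {L ρ μ} → Holds-matrix (real μ lo) L →
                 Detected L (exec κ inp ρ detectCode μ) (detect L)
  detect-state {L} {ρ} {μ} lo≡ = by-size (n ≟ 0)
    where
    after : Memory
    after = exec κ inp ρ detectCode μ
    ν₁ ν₂ : Memory
    ν₁ = exec κ inp ρ (for 0 (parent′ [ x₂ ]≔ lit 0 ▹ key′ [ x₂ ]← lo [ x₂ ])) μ
    ν₂ = exec κ inp {2} ρ (parent′ [ lit 0 ]≔ con 0 ▹ best [ lit 0 ]← lo [ lit 0 ] ▹
                v₀ [ lit 0 ]≔ con 0 ▹ v₁ [ lit 0 ]≔ lit 0 ▹ v₂ [ lit 0 ]≔ lit 0) ν₁
    I : ℕ → Memory → Set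
    I j ν = real ν lo ≡ real μ lo × (∀ x → x < j → word ν parent′ x ≡ 0 × real ν key′ x ≡ real μ lo x)
    cleared : I n ν₁
    cleared = iter-induction I n (refl , λ _ ()) (λ {j} {ν} _ → step {j} {ν})
      where
      step : ∀ {j ν} → I j ν → I (suc j)
             (exec κ inp (write ρ 2 j) (parent′ [ x₂ ]≔ lit 0 ▹ key′ [ x₂ ]← lo [ x₂ ]) ν)
      step {j} {ν} (lo-eq , below) = lo-eq , at
        where
        at : ∀ x → x < suc j → write (word ν parent′) j 0 x ≡ 0 ×
                               write (real ν key′) j (real ν lo j) x ≡ real μ lo x
        at x x<1+j with x ≟ j
        ... | yes refl = refl , cong-app lo-eq j
        ... | no x≢j   = below x (≤∧≢⇒< (s≤s⁻¹ x<1+j) x≢j)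
    begun : 0 < n → Prim-state L ν₂ (start L)
    begun 0<n = prim-state
      (Holds-cong (proj₁ cleared) lo≡)
      (λ x x<n → trans (proj₂ (proj₂ cleared x x<n)) (lo≡ 0 x 0<n x<n))
      (λ x x<n → write-cong (word ν₁ parent′) (λ _ → 0) 0 n (proj₁ (proj₂ cleared x x<n)))
      (trans (cong-app (proj₁ cleared) 0) (lo≡ 0 0 0<n 0<n) , refl , refl , refl)
    done : 0 < n → Prim-state L after (iter (λ _ → advance L) n (start L))
    done 0<n = iter-relate (λ _ → Prim-state L) n (begun 0<n) (λ {j} _ → advance-state {L} {write ρ 2 j})
    found : 0 < n → Holds-conflict after (detect L)
    found 0<n = subst (Holds-conflict after) (sym (detect-≡ L)) (Prim-state.conflict≡ (done 0<n))
    by-size : Dec (n ≡ 0) → Detected L after (detect L)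
    by-size (no n≢0) = detected (Prim-state.lo≡ (done 0<n))
      (cong (_<ᵇ n) (proj₁ (proj₂ (found 0<n)))) found
      where
      0<n : 0 < n
      0<n = n≢0⇒n>0 n≢0
    by-size (yes n≡0) = detected (λ x y x<n → contradiction (subst (x <_) n≡0 x<n) λ ())
      (trans (none (word after v₀ 0)) (sym (none (c₀ (detect L))))) found
      where
      none : ∀ m → (m <ᵇ n) ≡ false
      none m = dec-false (m <? n) λ m<n → contradiction (subst (m <_) n≡0 m<n) λ ()

-- Statements for repairing, checking and counting

x₁ : Term 2
x₁ = loop (# 1)

edge₁ edge₂ : Term 2
edge₁ = get row ⊞ get end₂′
edge₂ = get row₂ ⊞ get end₁′

chooseS storeS repairCode : Stmt 2
chooseS =
  end₁′ [ lit 0 ]≔ get v₀ ▹ end₂′ [ lit 0 ]≔ get v₁ ▹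
  branch (lit 1 ≺ digit [ x₁ ]) (end₂′ [ lit 0 ]≔ get v₂)
    (branch (lit 0 ≺ digit [ x₁ ]) (end₁′ [ lit 0 ]≔ get v₂) nop)
storeS = branch (lit 1 ≺ digit [ x₁ ])
  (lo [ edge₁ ]← lower′ [ edge₁ ] ▹ lo [ edge₂ ]← lower′ [ edge₂ ])
  (lo [ edge₁ ]← best [ lit 0 ] ▹ lo [ edge₂ ]← best [ lit 0 ])
repairCode = chooseS ▹ rowOf row end₁′ ▹ rowOf row₂ end₂′ ▹ storeS

initCell : Stmt 2
initCell = branch (lower′ [ x₁ ]≼ dist′ [ x₁ ] & dist′ [ x₁ ]≼ upper′ [ x₁ ])
                  (lo [ x₁ ]← dist′ [ x₁ ]) (lo [ x₁ ]← lower′ [ x₁ ])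

initCode : Stmt 1
initCode = for 2 initCell

cell₂ : Term 3
cell₂ = get row ⊞ loop (# 2)

distinctC badC flaggedC : Cond 3
distinctC = ! (! (loop (# 1) ≺ loop (# 2)) & ! (loop (# 2) ≺ loop (# 1)))
badC = ! (lower′ [ cell₂ ]≼ lo [ cell₂ ] & lo [ cell₂ ]≼ upper′ [ cell₂ ] &
          ! (distinctC & upper′ [ cell₂ ]≼ dist′ [ lit 0 ]))
flaggedC = ! ((lo [ cell₂ ]≼ dist′ [ cell₂ ] & dist′ [ cell₂ ]≼ lo [ cell₂ ]) &
              ! (distinctC & dist′ [ cell₂ ]≼ dist′ [ lit 0 ]))

tallyBad tallyFlagged tallyCell : Stmt 3
tallyBad     = branch badC (bads [ lit 0 ]≔ get bads ⊞ lit 1) nop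
tallyFlagged = branch flaggedC (count [ lit 0 ]≔ get count ⊞ lit 1) nop
tallyCell    = tallyBad ▹ tallyFlagged

tallyRow : Stmt 2
tallyRow = for 0 tallyCell ▹ row [ lit 0 ]≔ get row ⊞ con 0

incrementCell : Stmt 2
incrementCell = branch (lit 0 ≺ get carry)
  (branch (digit [ x₁ ] ≺ lit 2)
          (digit [ x₁ ]≔ digit [ x₁ ] ⊞ lit 1 ▹ carry [ lit 0 ]≔ lit 0)
          (digit [ x₁ ]≔ lit 0))
  nop

tallyS verdictS checkCode incrementCode : Stmt 1
tallyS = bads [ lit 0 ]≔ lit 0 ▹ count [ lit 0 ]≔ lit 0 ▹ row [ lit 0 ]≔ lit 0 ▹ for 0 tallyRow
verdictS = branch (get bads ≺ lit 1 & get count ≺ con 3 & ! (get v₀ ≺ con 0))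
                  (output [ lit 0 ]≔ lit 1) nop
checkCode = tallyS ▹ verdictS
incrementCode = carry [ lit 0 ]≔ lit 1 ▹ for 3 incrementCell

-- Opaque, so that the memory after one of these statements is not unfolded
-- in conversion checks.
opaque

  initS checkS incrementS : Stmt 1
  initS      = initCode
  checkS     = checkCode
  incrementS = incrementCode

  detectS repairS : Stmt 2
  detectS = detectCode
  repairS = repairCode

  initS-≡ : initS ≡ initCode
  initS-≡ = refl

  checkS-≡ : checkS ≡ checkCode
  checkS-≡ = refl

  incrementS-≡ : incrementS ≡ incrementCode
  incrementS-≡ = refl

  detectS-≡ : detectS ≡ detectCode
  detectS-≡ = refl

  repairS-≡ : repairS ≡ repairCode
  repairS-≡ = refl

repairIf roundS : Stmt 2
repairIf = branch (get v₀ ≺ con 0) repairS nop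
roundS   = detectS ▹ repairIf

attemptS : Stmt 1
attemptS = initS ▹ for 3 roundS ▹ checkS ▹ incrementS

mainS : Stmt 0
mainS = for 4 attemptS

x₀ : Term 1
x₀ = loop (# 0)

-- The matrices arrive contiguously, whereas arrays are interleaved with stride 8. After one copy
-- all accesses go through arrays.
loadCell : Stmt 1
loadCell = dist′ [ x₀ ]←input x₀ ▹ lower′ [ x₀ ]←input (con 2 ⊞ x₀) ▹
           upper′ [ x₀ ]←input (con 2 ⊞ con 2 ⊞ x₀)

loadS : Stmt 0
loadS = for 2 loadCell

module _ {A : Set} where

  write-edge : ∀ {n a b} {f : ℕ → A} {L g : ℕ → ℕ → A} →
    (∀ x y → x < n → y < n → f (x * n + y) ≡ L x y) → a < n → b < n →
    ∀ {p q} → p ≡ g a b → q ≡ g b a → ∀ x y → x < n → y < n →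
    write (write f (a * n + b) p) (b * n + a) q (x * n + y) ≡ overwrite a b g L x y
  write-edge {n} {a} {b} {f} {L} {g} f≡ a<n b<n refl refl x y x<n y<n with edge? a b x y
  ... | yes (inj₂ (refl , refl)) = write-same (write f (a * n + b) (g a b)) (b * n + a) (g b a) refl
  ... | no ¬e = trans
        (write-other (write f (a * n + b) (g a b)) (b * n + a) (g b a)
          (λ eq → ¬e (inj₂ (index-injective y<n a<n eq))))
        (trans (write-other f (a * n + b) (g a b) (λ eq → ¬e (inj₁ (index-injective y<n b<n eq))))
               (f≡ x y x<n y<n))
  ... | yes (inj₁ (refl , refl)) with a * n + b ≟ b * n + a
  ...   | no _  = write-same f (a * n + b) (g a b) refl
  -- The two addresses coincide only if `a` equals `b`, and then both writes store the same value.
  ...   | yes eq with refl , refl ← index-injective {n} {a} {b} {b} {a} b<n a<n eq = refl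

-- Initialization and repairs on the machine

module Execution₂ (ℝ : RealNumbers) (κ : ℕ → ℕ) (inp : ℕ → RealNumbers.Carrier ℝ)
  (k : ℕ) (κ₂ : κ 2 ≡ κ 0 * κ 0) (κ₃ : κ 3 ≡ suc (2 * k)) where

  open Order ℝ
  open Semantics ℝ
  open Execution ℝ κ inp

  private
    n = κ 0

  D l u : ℕ → ℕ → C
  D x y = inp (x * n + y)
  l x y = inp (κ 2 + (x * n + y))
  u x y = inp (κ 2 + κ 2 + (x * n + y))

  open Detection ℝ n
  open Search ℝ n k D l u

  record Loaded (μ : Memory) : Set where
    constructor loaded
    field
      dist≡  : Holds-matrix (real μ dist′) D
      lower≡ : Holds-matrix (real μ lower′) l
      upper≡ : Holds-matrix (real μ upper′) u

  index< : ∀ {x y} → x < n → y < n → x * n + y < κ 2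
  index< {x} {y} x<n y<n = subst (x * n + y <_) (sym κ₂) (begin-strict
    x * n + y   <⟨ +-monoʳ-< (x * n) y<n ⟩
    x * n + n   ≡⟨ +-comm (x * n) n ⟩
    suc x * n   ≤⟨ *-monoˡ-≤ n x<n ⟩
    n * n       ∎)
    where open ≤-Reasoning

  init-state : ∀ {ρ μ} → Loaded μ → Holds-matrix (real (exec κ inp ρ initCode μ) lo) initial
  init-state {ρ} {μ} (loaded dist≡ lower≡ upper≡) x y x<n y<n =
    trans (proj₂ (proj₂ (proj₂ final)) (x * n + y) (index< x<n y<n))
      (cong₂ (λ a b → when does (proj₁ a ≼? b) ∧ does (b ≼? proj₂ a) then b else proj₁ a)
        (cong₂ _,_ (lower≡ x y x<n y<n) (upper≡ x y x<n y<n)) (dist≡ x y x<n y<n))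
    where
    chosen : ℕ → C
    chosen e = when does (real μ lower′ e ≼? real μ dist′ e) ∧ does (real μ dist′ e ≼? real μ upper′ e)
               then real μ dist′ e else real μ lower′ e
    I : ℕ → Memory → Set
    I j ν = real ν dist′ ≡ real μ dist′ × real ν lower′ ≡ real μ lower′ ×
            real ν upper′ ≡ real μ upper′ × (∀ e → e < j → real ν lo e ≡ chosen e)
    step : ∀ {j ν} → I j ν → I (suc j) (exec κ inp (write ρ 1 j) initCell ν)
    step {j} {ν} (p , q , r , below) rewrite p | q | r
      with does (real μ lower′ j ≼? real μ dist′ j) ∧ does (real μ dist′ j ≼? real μ upper′ j) in eq
    ... | true  = p , q , r , λ e e<1+j → at e e<1+j
      where
      at : ∀ e → e < suc j → write (real ν lo) j (real μ dist′ j) e ≡ chosen e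
      at e e<1+j with e ≟ j
      ... | yes refl = sym (when-true eq)
      ... | no e≢j   = below e (≤∧≢⇒< (s≤s⁻¹ e<1+j) e≢j)
    ... | false = p , q , r , λ e e<1+j → at e e<1+j
      where
      at : ∀ e → e < suc j → write (real ν lo) j (real μ lower′ j) e ≡ chosen e
      at e e<1+j with e ≟ j
      ... | yes refl = sym (when-false eq)
      ... | no e≢j   = below e (≤∧≢⇒< (s≤s⁻¹ e<1+j) e≢j)
    final : I (κ 2) (exec κ inp ρ initCode μ)
    final = iter-induction I (κ 2) (refl , refl , refl , λ _ ()) (λ {j} {ν} _ → step {j} {ν})

  choose-value : ∀ {ρ μ c} → Holds-conflict μ c → let q = word μ digit (ρ 1) in
    word (exec κ inp ρ chooseS μ) end₁′ 0 ≡ end₁ q c × word (exec κ inp ρ chooseS μ) end₂′ 0 ≡ end₂ q c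
  choose-value {ρ} {μ} (_ , c₀≡ , c₁≡ , c₂≡)
    with 1 <ᵇ word μ digit (ρ 1) | 0 <ᵇ word μ digit (ρ 1)
  ... | true  | _     = c₀≡ , c₂≡
  ... | false | true  = c₂≡ , c₁≡
  ... | false | false = c₀≡ , c₁≡

  store-state : ∀ {ρ μ L a b h} → a < n → b < n →
    word μ end₁′ 0 ≡ a → word μ end₂′ 0 ≡ b → word μ row 0 ≡ a * n → word μ row₂ 0 ≡ b * n →
    Holds-matrix (real μ lo) L → Holds-matrix (real μ lower′) l → real μ best 0 ≡ h →
    Holds-matrix (real (exec κ inp ρ storeS μ) lo)
      (overwrite a b (λ x y → when does (1 <? word μ digit (ρ 1)) then l x y else h) L)
  store-state {ρ} {μ} {L} {a} {b} {h} a<n b<n e₁≡ e₂≡ r₁≡ r₂≡ lo≡ l≡ h≡ x y x<n y<n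
    rewrite e₁≡ | e₂≡ | r₁≡ | r₂≡
    with 1 <ᵇ word μ digit (ρ 1)
  ... | true  = write-edge {g = l} lo≡ a<n b<n (l≡ a b a<n b<n) (l≡ b a b<n a<n) x y x<n y<n
  ... | false = write-edge {g = λ _ _ → h} lo≡ a<n b<n h≡ h≡ x y x<n y<n

  end₁< : ∀ q {c} → c₀ c < n → c₂ c < n → end₁ q c < n
  end₁< zero          p₀ p₂ = p₀
  end₁< (suc zero)    p₀ p₂ = p₂
  end₁< (suc (suc q)) p₀ p₂ = p₀

  end₂< : ∀ q {c} → c₁ c < n → c₂ c < n → end₂ q c < n
  end₂< zero          p₁ p₂ = p₁
  end₂< (suc zero)    p₁ p₂ = p₁
  end₂< (suc (suc q)) p₁ p₂ = p₂

  repair-state : ∀ {ρ μ L c} → Holds-matrix (real μ lower′) l → Holds-matrix (real μ lo) L →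
    Holds-conflict μ c → c₀ c < n → c₁ c < n → c₂ c < n →
    Holds-matrix (real (exec κ inp ρ repairCode μ) lo) (repair (word μ digit (ρ 1)) L c)
  repair-state {ρ} {μ} {L} {c} l≡ lo≡ conf c₀<n c₁<n c₂<n =
    subst (λ m → Holds-matrix (real (exec κ inp ρ repairCode μ) lo)
                   (overwrite a b (λ x y → when does (1 <? m) then l x y else top c) L))
      (cong-app (trans (word₃ digit refl) (trans (word₂ digit refl) (word₁ digit refl))) (ρ 1))
      (store-state {ρ} {μ₃} a<n b<n
        (trans (cong-app (trans (word₃ end₁′ refl) (word₂ end₁′ refl)) 0) e₁≡)
        (trans (cong-app (word₃ end₂′ refl) 0) e₂≡)
        (trans (cong-app (word₃ row refl) 0)
          (trans (row-value {2} ρ row end₁′ (λ ()) μ₁ (subst (_≤ n) (sym e₁≡) (<⇒≤ a<n)))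
                 (cong (_* n) e₁≡)))
        (trans (row-value {2} ρ row₂ end₂′ (λ ()) μ₂ (subst (_≤ n) (sym e₂≡) (<⇒≤ b<n)))
               (cong (_* n) e₂≡))
        (Holds-cong (real₃ lo) lo≡)
        (Holds-cong (real₃ lower′) l≡)
        (trans (cong-app (real₃ best) 0) (proj₁ conf)))
    where
    q a b : ℕ
    q = word μ digit (ρ 1)
    a = end₁ q c
    b = end₂ q c
    a<n : a < n
    a<n = end₁< q {c} c₀<n c₂<n
    b<n : b < n
    b<n = end₂< q {c} c₁<n c₂<n
    μ₁ μ₂ μ₃ : Memory
    μ₁ = exec κ inp ρ chooseS μ
    μ₂ = exec κ inp ρ (rowOf {2} row end₁′) μ₁
    μ₃ = exec κ inp ρ (rowOf {2} row₂ end₂′) μ₂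
    word₁ : ∀ a → writesWord a chooseS ≡ false → word μ₁ a ≡ word μ a
    word₁ a fr = word-frame ℝ κ inp a ρ chooseS μ fr
    word₂ : ∀ a → writesWord a (rowOf {2} row end₁′) ≡ false → word μ₂ a ≡ word μ₁ a
    word₂ a fr = word-frame ℝ κ inp a ρ (rowOf {2} row end₁′) μ₁ fr
    word₃ : ∀ a → writesWord a (rowOf {2} row₂ end₂′) ≡ false → word μ₃ a ≡ word μ₂ a
    word₃ a fr = word-frame ℝ κ inp a ρ (rowOf {2} row₂ end₂′) μ₂ fr
    real₃ : ∀ a → real μ₃ a ≡ real μ a
    real₃ a = trans (real-frame ℝ κ inp a ρ (rowOf {2} row₂ end₂′) μ₂ refl)
      (trans (real-frame ℝ κ inp a ρ (rowOf {2} row end₁′) μ₁ refl)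
             (real-frame ℝ κ inp a ρ chooseS μ refl))
    e₁≡ : word μ₁ end₁′ 0 ≡ a
    e₁≡ = proj₁ (choose-value {ρ} {μ} {c} conf)
    e₂≡ : word μ₂ end₂′ 0 ≡ b
    e₂≡ = trans (cong-app (word₂ end₂′ refl) 0) (proj₂ (choose-value {ρ} {μ} {c} conf))

-- Ternary numerals

numeral : ℕ → (ℕ → ℕ) → ℕ
numeral zero    f = 0
numeral (suc m) f = f m * 3 ^ m + numeral m f

numeral-cong : ∀ m {f g} → (∀ i → i < m → f i ≡ g i) → numeral m f ≡ numeral m g
numeral-cong zero    eq = refl
numeral-cong (suc m) eq = cong₂ (λ a b → a * 3 ^ m + b) (eq m ≤-refl)
                                (numeral-cong m (λ i i<m → eq i (m≤n⇒m≤1+n i<m)))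

numeral-< : ∀ m {f} → (∀ i → i < m → f i < 3) → numeral m f < 3 ^ m
numeral-< zero        f<3 = z<s
numeral-< (suc m) {f} f<3 = begin-strict
  f m * 3 ^ m + numeral m f <⟨ +-monoʳ-< (f m * 3 ^ m) (numeral-< m (λ i i<m → f<3 i (m≤n⇒m≤1+n i<m))) ⟩
  f m * 3 ^ m + 3 ^ m       ≡⟨ +-comm (f m * 3 ^ m) (3 ^ m) ⟩
  suc (f m) * 3 ^ m         ≤⟨ *-monoˡ-≤ (3 ^ m) (f<3 m ≤-refl) ⟩
  3 ^ suc m                 ∎
  where open ≤-Reasoning

numeral-injective : ∀ m {f g} → (∀ i → i < m → f i < 3) → (∀ i → i < m → g i < 3) →
  numeral m f ≡ numeral m g → ∀ i → i < m → f i ≡ g i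
numeral-injective (suc m) {f} {g} f<3 g<3 eq i i<1+m
  with top , rest ← index-injective {3 ^ m} {f m} {numeral m f} {g m} {numeral m g}
                                    (numeral-< m (λ i i<m → f<3 i (m≤n⇒m≤1+n i<m)))
                                    (numeral-< m (λ i i<m → g<3 i (m≤n⇒m≤1+n i<m))) eq
  with m≤n⇒m<n∨m≡n (s≤s⁻¹ i<1+m)
... | inj₂ refl = top
... | inj₁ i<m  = numeral-injective m (λ i i<m → f<3 i (m≤n⇒m≤1+n i<m))
                                      (λ i i<m → g<3 i (m≤n⇒m≤1+n i<m)) rest i i<m

numeral-zeros : ∀ m f → f m ≡ 0 → numeral (suc m) f ≡ numeral m f
numeral-zeros m f eq = cong (λ a → a * 3 ^ m + numeral m f) eq

-- The check, the counter and the loop over all attempts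

module Execution₃ (ℝ : RealNumbers) (κ : ℕ → ℕ) (inp : ℕ → RealNumbers.Carrier ℝ)
  (k : ℕ) (κ₂ : κ 2 ≡ κ 0 * κ 0) (κ₃ : κ 3 ≡ suc (2 * k)) where

  open Order ℝ
  open Semantics ℝ
  open Execution ℝ κ inp
  open Execution₂ ℝ κ inp k κ₂ κ₃

  private
    n = κ 0

  open Detection ℝ n
  open Search ℝ n k D l u

  module _ {μ L} (ld : Loaded μ) (lo≡ : Holds-matrix (real μ lo) L) where

    open Loaded ld

    bads-after : ∀ ρ ν → word (exec κ inp ρ tallyCell ν) bads 0 ≡ word ν bads 0 + ⟦ holds κ inp ρ badC ν ⟧
    bads-after ρ ν = trans
      (cong-app (word-frame ℝ κ inp bads ρ tallyFlagged _ refl) 0)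
      bump
      where
      bump : word (exec κ inp ρ tallyBad ν) bads 0 ≡
             word ν bads 0 + ⟦ holds κ inp ρ badC ν ⟧
      bump with holds κ inp ρ badC ν
      ... | true  = refl
      ... | false = sym (+-identityʳ _)

    count-after : ∀ ρ ν → word (exec κ inp ρ tallyCell ν) count 0 ≡
      word ν count 0 + ⟦ holds κ inp ρ flaggedC (exec κ inp ρ tallyBad ν) ⟧
    count-after ρ ν = trans (bump (exec κ inp ρ tallyBad ν))
      (cong (_+ ⟦ holds κ inp ρ flaggedC (exec κ inp ρ tallyBad ν) ⟧)
      (cong-app (word-frame ℝ κ inp count ρ tallyBad ν refl) 0))
      where
      bump : ∀ ν → word (exec κ inp ρ tallyFlagged ν) count 0 ≡
             word ν count 0 + ⟦ holds κ inp ρ flaggedC ν ⟧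
      bump ν with holds κ inp ρ flaggedC ν
      ... | true  = refl
      ... | false = sym (+-identityʳ _)

    module _ {ρ : ℕ → ℕ} {x y : ℕ} {ν : Memory} (x<n : x < n) (y<n : y < n)
             (real≡ : ∀ a → real ν a ≡ real μ a) (row≡ : word ν row 0 ≡ x * n) where

      private
        ρ′ = write (write ρ 1 x) 2 y

        read : ∀ a {M : ℕ → ℕ → C} → Holds-matrix (real μ a) M → real ν a (word ν row 0 + y) ≡ M x y
        read a M≡ = trans (cong-app (real≡ a) _) (trans (cong (λ m → real μ a (m + y)) row≡) (M≡ x y x<n y<n))

        origin : real ν dist′ 0 ≡ D 0 0
        origin = trans (cong-app (real≡ dist′) 0) (dist≡ 0 0 (≤-<-trans z≤n x<n) (≤-<-trans z≤n x<n))

      holds-bad : holds κ inp ρ′ badC ν ≡ bad L x y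
      holds-bad rewrite read lower′ lower≡ | read lo lo≡ | read upper′ upper≡ | origin = refl

      holds-flagged : holds κ inp ρ′ flaggedC ν ≡ flagged L x y
      holds-flagged rewrite read lo lo≡ | read dist′ dist≡ | origin = refl

    Tallied : ℕ → ℕ → ℕ → Memory → Set
    Tallied x b f ν = (∀ a → real ν a ≡ real μ a) × word ν row 0 ≡ x * n ×
                      word ν bads 0 ≡ b × word ν count 0 ≡ f

    tally-cell : ∀ {ρ x y b f ν} → x < n → y < n → Tallied x b f ν →
      Tallied x (b + ⟦ bad L x y ⟧) (f + ⟦ flagged L x y ⟧)
              (exec κ inp (write (write ρ 1 x) 2 y) tallyCell ν)
    tally-cell {ρ} {x} {y} {b} {f} {ν} x<n y<n (real≡ , row≡ , bads≡ , count≡) =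
      (λ a → trans (real-frame ℝ κ inp a ρ′ tallyCell ν refl) (real≡ a)) ,
      trans (cong-app (word-frame ℝ κ inp row ρ′ tallyCell ν refl) 0) row≡ ,
      trans (bads-after ρ′ ν) (cong₂ (λ b c → b + ⟦ c ⟧) bads≡ (holds-bad {ρ} {ν = ν} x<n y<n real≡ row≡)) ,
      trans (count-after ρ′ ν) (cong₂ (λ b c → b + ⟦ c ⟧) count≡
        (holds-flagged {ρ} {ν = exec κ inp ρ′ tallyBad ν} x<n y<n
          (λ a → trans (real-frame ℝ κ inp a ρ′ tallyBad ν refl) (real≡ a))
          (trans (cong-app (word-frame ℝ κ inp row ρ′ tallyBad ν refl) 0) row≡)))
      where
      ρ′ : ℕ → ℕ
      ρ′ = write (write ρ 1 x) 2 y

    tally-row : ∀ {ρ x b f ν} → x < n → Tallied x b f ν →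
      Tallied (suc x) (b + sum n (λ y → ⟦ bad L x y ⟧)) (f + sum n (λ y → ⟦ flagged L x y ⟧))
              (exec κ inp (write ρ 1 x) tallyRow ν)
    tally-row {ρ} {x} {b} {f} {ν} x<n t@(real≡ , row≡ , bads≡ , count≡) =
      proj₁ cells , trans (cong (_+ n) (proj₁ (proj₂ cells))) (+-comm (x * n) n) ,
      proj₁ (proj₂ (proj₂ cells)) , proj₂ (proj₂ (proj₂ cells))
      where
      I : ℕ → Memory → Set
      I j = Tallied x (b + sum j (λ y → ⟦ bad L x y ⟧)) (f + sum j (λ y → ⟦ flagged L x y ⟧))
      more : ∀ b j (g : ℕ → ℕ) → b + sum j g + g j ≡ b + sum (suc j) g
      more b j g = trans (+-assoc b (sum j g) (g j)) (cong (b +_) (sym (sum-last j g)))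
      cells : I n (exec κ inp (write ρ 1 x) (for 0 tallyCell) ν)
      cells = iter-induction I n
        (real≡ , row≡ , trans bads≡ (sym (+-identityʳ b)) , trans count≡ (sym (+-identityʳ f)))
        (λ {j} {ν} j<n i → let (p , q , r , s) = tally-cell {ρ} {ν = ν} x<n j<n i in
          p , q , trans r (more b j _) , trans s (more f j _))

    tally-state : ∀ {ρ} → let ν = exec κ inp ρ tallyS μ in
      word ν bads 0 ≡ sum² n (λ x y → ⟦ bad L x y ⟧) ×
      word ν count 0 ≡ sum² n (λ x y → ⟦ flagged L x y ⟧)
    tally-state {ρ} = proj₂ (proj₂ rows)
      where
      I : ℕ → Memory → Set
      I j = Tallied j (sum j (λ x → sum n (λ y → ⟦ bad L x y ⟧)))
                      (sum j (λ x → sum n (λ y → ⟦ flagged L x y ⟧)))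
      rows : I n (exec κ inp ρ tallyS μ)
      rows = iter-induction I n ((λ _ → refl) , refl , refl , refl)
        (λ {j} {ν} j<n i → let (p , q , r , s) = tally-row {ρ} {ν = ν} j<n i in
          p , q , trans r (sym (sum-last j _)) , trans s (sym (sum-last j _)))

  verdict : (ℕ → ℕ) → Bool
  verdict w =
    does (sum² n (λ x y → ⟦ bad (simulate w (suc (2 * k))) x y ⟧) <? 1) ∧
    does (sum² n (λ x y → ⟦ flagged (simulate w (suc (2 * k))) x y ⟧) <? suc (2 * k)) ∧
    not (does (c₀ (detect (simulate w (2 * k))) <? n))

  verdict-complete : ∀ {w} → Accepted w → verdict w ≡ true
  verdict-complete {w} (none , p , q) = cong₂ _∧_ (dec-true (_ <? _) p)
    (cong₂ _∧_ (dec-true (_ <? _) q) (cong not (dec-false (_ <? _) (≤⇒≯ none))))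

  verdict-sound : ∀ {w} → verdict w ≡ true → Accepted w
  verdict-sound {w} eq = split _ _ _ _ _ _ eq
    where
    split : ∀ a b c d e f → (a <ᵇ b) ∧ (c <ᵇ d) ∧ not (e <ᵇ f) ≡ true → f ≤ e × a < b × c < d
    split a b c d e f eq with a <ᵇ b | <ᵇ-reflects-< a b | c <ᵇ d | <ᵇ-reflects-< c d
                            | e <ᵇ f | <ᵇ-reflects-< e f
    ... | true | ofʸ p | true | ofʸ q | false | ofⁿ r = ≮⇒≥ r , p , q

  check-state : ∀ {ρ μ w} → Loaded μ →
    Holds-matrix (real μ lo) (simulate w (suc (2 * k))) →
    (word μ v₀ 0 <ᵇ n) ≡ (c₀ (detect (simulate w (2 * k))) <ᵇ n) →
    word (exec κ inp ρ checkCode μ) output 0 ≡ (when verdict w then 1 else word μ output 0)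
  check-state {ρ} {μ} {w} ld lo≡ test≡ = when-relate (λ ν m → word ν output 0 ≡ m)
    (cong₂ _∧_ (cong (_<ᵇ 1) (proj₁ tallied))
      (cong₂ _∧_ (cong₂ _<ᵇ_ (proj₂ tallied) κ₃)
        (cong not (trans (cong (λ f → f 0 <ᵇ n) (word-frame ℝ κ inp v₀ ρ tallyS μ refl)) test≡))))
    (λ _ → refl)
    (λ _ → cong-app (word-frame ℝ κ inp output ρ tallyS μ refl) 0)
    where
    tallied = tally-state ld lo≡ {ρ}

  module _ (ρ : ℕ → ℕ) (μ : Memory) where

    private
      f : ℕ → ℕ
      f = word μ digit

    -- The invariant of ripple-carry addition: the carry, weighted by its position, and the digits
    -- already passed together represent the successor of the old prefix.
    record Carried (i : ℕ) (ν : Memory) : Set where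
      constructor carried
      field
        ternary  : ∀ j → j < κ 3 → word ν digit j < 3
        beyond   : ∀ j → i ≤ j → word ν digit j ≡ f j
        carry≤1  : word ν carry 0 ≤ 1
        numeral≡ : word ν carry 0 * 3 ^ i + numeral i (word ν digit) ≡ suc (numeral i f)

    increment-cell : ∀ {i ν} → i < κ 3 → Carried i ν →
                     Carried (suc i) (exec κ inp (write ρ 1 i) incrementCell ν)
    increment-cell {i} {ν} i<κ (carried ternary beyond carry≤1 numeral≡)
      with word ν carry 0 in eq
    ... | zero = carried ternary (λ j i<j → beyond j (<⇒≤ i<j))
                   (subst (_≤ 1) (sym eq) z≤n)
                   (trans (cong₂ (λ c d → c * 3 ^ suc i + (d * 3 ^ i + numeral i (word ν digit)))
                            eq (beyond i ≤-refl))
                          (trans (cong (f i * 3 ^ i +_) numeral≡) (+-suc _ _)))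
    ... | suc (suc _) = contradiction carry≤1 λ { (s≤s ()) }
    ... | suc zero with word ν digit i <ᵇ 2 | <ᵇ-reflects-< (word ν digit i) 2
    ...   | _ | ofʸ d<2 = carried ternary′ beyond′ z≤n
            (trans (cong₂ (λ a b → a * 3 ^ i + b)
                      (trans (write-same g i (g i + 1) refl) (cong (_+ 1) (beyond i ≤-refl)))
                      (numeral-cong i (λ j j<i → write-other g i (g i + 1) (<⇒≢ j<i))))
                   (trans (shift (f i) (3 ^ i) (numeral i g))
                          (trans (cong (f i * 3 ^ i +_) numeral≡) (+-suc _ _))))
      where
      g : ℕ → ℕ
      g = word ν digit
      shift : ∀ a b c → (a + 1) * b + c ≡ a * b + (1 * b + c)
      shift = solve-∀
      ternary′ : ∀ j → j < κ 3 → write g i (g i + 1) j < 3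
      ternary′ j j<κ with j ≟ i
      ... | yes refl = subst (_< 3) (+-comm 1 (g j)) (s<s d<2)
      ... | no  _    = ternary j j<κ
      beyond′ : ∀ j → i < j → write g i (g i + 1) j ≡ f j
      beyond′ j i<j = trans (write-other g i (g i + 1) (≢-sym (<⇒≢ i<j))) (beyond j (<⇒≤ i<j))
    ...   | _ | ofⁿ d≮2 = carried ternary′ beyond′ (subst (_≤ 1) (sym eq) ≤-refl)
            (trans (cong₂ _+_ (cong (_* 3 ^ suc i) eq)
                      (cong₂ (λ a b → a * 3 ^ i + b) (write-same g i 0 refl)
                        (numeral-cong i (λ j j<i → write-other g i 0 (<⇒≢ j<i)))))
                   (trans (shift (3 ^ i) (numeral i g))
                          (trans (cong₂ (λ a b → a * 3 ^ i + b) (sym two) numeral≡) (+-suc _ _))))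
      where
      g : ℕ → ℕ
      g = word ν digit
      shift : ∀ b c → 1 * (3 * b) + (0 * b + c) ≡ 2 * b + (1 * b + c)
      shift = solve-∀
      two : f i ≡ 2
      two = trans (sym (beyond i ≤-refl)) (≤-antisym (s≤s⁻¹ (ternary i i<κ)) (≮⇒≥ d≮2))
      ternary′ : ∀ j → j < κ 3 → write g i 0 j < 3
      ternary′ j j<κ with j ≟ i
      ... | yes refl = z<s
      ... | no  _    = ternary j j<κ
      beyond′ : ∀ j → i < j → write g i 0 j ≡ f j
      beyond′ j i<j = trans (write-other g i 0 (≢-sym (<⇒≢ i<j))) (beyond j (<⇒≤ i<j))

    -- A carry out of the leading digit would by itself be worth 3 ^ κ 3, more than the successor is
    -- assumed to be.
    increment-state : (∀ j → j < κ 3 → f j < 3) → suc (numeral (κ 3) f) < 3 ^ κ 3 →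
      let g = word (exec κ inp ρ incrementCode μ) digit in
      (∀ j → j < κ 3 → g j < 3) × numeral (κ 3) g ≡ suc (numeral (κ 3) f)
    increment-state f<3 small with iter-induction
        {f = λ i → exec κ inp (write ρ 1 i) incrementCell} {exec κ inp {1} ρ (carry [ lit 0 ]≔ lit 1) μ} Carried (κ 3)
        (carried f<3 (λ _ _ → refl) ≤-refl refl) (λ {i} {ν} → increment-cell {i} {ν})
    ... | carried ternary _ carry≤1 numeral≡ = ternary ,
      trans (cong (λ c → c * 3 ^ κ 3 + numeral (κ 3) (word (exec κ inp ρ incrementCode μ) digit)) (sym none)) numeral≡
      where
      none : word (exec κ inp ρ incrementCode μ) carry 0 ≡ 0
      none = zero-carry (word (exec κ inp ρ incrementCode μ) carry 0)
                        {numeral (κ 3) (word (exec κ inp ρ incrementCode μ) digit)} numeral≡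
        where
        zero-carry : ∀ c {r} → c * 3 ^ κ 3 + r ≡ suc (numeral (κ 3) f) → c ≡ 0
        zero-carry zero    _  = refl
        zero-carry (suc c) {r} eq = contradiction
          (≤-<-trans (≤-trans (m≤m+n (3 ^ κ 3) (c * 3 ^ κ 3))
                       (≤-trans (m≤m+n (suc c * 3 ^ κ 3) r) (≤-reflexive eq))) small)
          (<-irrefl refl)

  -- An opaque statement does not reduce, so the frame condition is evaluated on the transparent
  -- code it equals.
  kept-word : ∀ a {d} ρ {s code : Stmt d} → s ≡ code → writesWord a code ≡ false → ∀ μ →
              word (exec κ inp ρ s μ) a ≡ word μ a
  kept-word a ρ {code = code} refl fr μ = word-frame ℝ κ inp a ρ code μ fr

  kept-real : ∀ a {d} ρ {s code : Stmt d} → s ≡ code → writesReal a code ≡ false → ∀ μ →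
              real (exec κ inp ρ s μ) a ≡ real μ a
  kept-real a ρ {code = code} refl fr μ = real-frame ℝ κ inp a ρ code μ fr

  repairIf-≡ : repairIf ≡ branch (get v₀ ≺ con 0) repairCode nop
  repairIf-≡ = cong (λ s → branch (get v₀ ≺ con 0) s nop) repairS-≡

  record Round (s : ℕ) (w : ℕ → ℕ) (μ ν : Memory) : Set where
    constructor round
    field
      lo≡     : Holds-matrix (real ν lo) (simulate w s)
      digits≡ : word ν digit ≡ w
      reals≡  : real ν dist′ ≡ real μ dist′ × real ν lower′ ≡ real μ lower′ ×
                real ν upper′ ≡ real μ upper′
      output≡ : word ν output 0 ≡ word μ output 0
      -- `v₀` is one round behind `lo`: it stems from the detection before the latest repair, and
      -- nothing is claimed about it before the first round.
      test≡   : ∀ {r} → s ≡ suc r →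
                (word ν v₀ 0 <ᵇ n) ≡ (c₀ (detect (simulate w r)) <ᵇ n)

  module _ (D-dis : Dissimilarity D) (l-dis : Dissimilarity l) (u-dis : Dissimilarity u) where

    repairIf-exec : ∀ ρ ν → exec κ inp ρ repairIf ν ≡
                    (when word ν v₀ 0 <ᵇ n then exec κ inp ρ repairS ν else ν)
    repairIf-exec ρ ν = refl

    child-state : ∀ {s w ν₁ ν₂ ξ} → let L = simulate w s in
      Detected L ν₁ (detect L) →
      (Valid L (detect L) → Holds-matrix (real ν₂ lo) (repair (w s) L (detect L))) →
      ξ ≡ (when word ν₁ v₀ 0 <ᵇ n then ν₂ else ν₁) →
      Holds-matrix (real ξ lo) (simulate w (suc s))
    child-state {s} {w} {ν₁} {ν₂} (detected lo≡ test≡ _) repaired refl =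
      when-relate (λ ξ M → Holds-matrix (real ξ lo) M) {ν₂} {ν₁} {repair (w s) L (detect L)} {L}
        test≡ (λ found → from found (proj₂ (detect-correct L (symmetric dis)))) (λ _ → lo≡)
      where
      L : ℕ → ℕ → C
      L = simulate w s
      dis : Dissimilarity L
      dis = simulate-dissimilarity D-dis l-dis u-dis w s
      from : (word ν₁ v₀ 0 <ᵇ n) ≡ true → Sound L (detect L) →
             Holds-matrix (real ν₂ lo) (repair (w s) L (detect L))
      from found (inj₁ v) = repaired v
      from found (inj₂ (n≤c₀ , _)) = contradiction
        (trans (sym found) (trans test≡ (dec-false (c₀ (detect L) <? n) (≤⇒≯ n≤c₀)))) λ ()

    module _ {ρ₁ : ℕ → ℕ} {s : ℕ} {w : ℕ → ℕ} {μ ν : Memory} (ρ₁-s : ρ₁ 1 ≡ s)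
             (ld : Loaded μ) (rnd : Round s w μ ν) where

      private
        L : ℕ → ℕ → C
        L = simulate w s
        ν₁ ν₂ ξ : Memory
        ν₁ = exec κ inp ρ₁ detectS ν
        ν₂ = exec κ inp ρ₁ repairS ν₁
        ξ  = exec κ inp ρ₁ repairIf ν₁

      round-detected : Detected L ν₁ (detect L)
      round-detected = subst (λ s → Detected L (exec κ inp ρ₁ s ν) (detect L)) (sym detectS-≡)
        (detect-state {L} {ρ₁} {ν} (Round.lo≡ rnd))

      round-lower : Holds-matrix (real ν₁ lower′) l
      round-lower = Holds-cong (trans (kept-real lower′ ρ₁ detectS-≡ refl ν)
        (proj₁ (proj₂ (Round.reals≡ rnd)))) (Loaded.lower≡ ld)

      round-digit : word ν₁ digit (ρ₁ 1) ≡ w s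
      round-digit = trans
        (cong-app (trans (kept-word digit ρ₁ detectS-≡ refl ν) (Round.digits≡ rnd)) (ρ₁ 1))
        (cong w ρ₁-s)

      round-repaired : Valid L (detect L) → Holds-matrix (real ν₂ lo) (repair (w s) L (detect L))
      round-repaired v = subst (λ q → Holds-matrix (real ν₂ lo) (repair q L (detect L))) round-digit
        (subst (λ c → Holds-matrix (real (exec κ inp ρ₁ c ν₁) lo)
                        (repair (word ν₁ digit (ρ₁ 1)) L (detect L))) (sym repairS-≡)
          (repair-state {ρ₁} {ν₁} {L} {detect L} round-lower (Detected.lo≡ round-detected)
            (Detected.conflict≡ round-detected (≤-<-trans z≤n (Valid.c₀<n v)))
            (Valid.c₀<n v) (Valid.c₁<n v) (Valid.c₂<n v)))

      round-test : (word ξ v₀ 0 <ᵇ n) ≡ (c₀ (detect L) <ᵇ n)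
      round-test = trans (cong (λ f → f 0 <ᵇ n)
        (kept-word v₀ ρ₁ repairIf-≡ refl ν₁))
        (Detected.test≡ round-detected)

      round-real : ∀ a → writesReal a (branch (get v₀ ≺ con 0) repairCode nop) ≡ false →
                   writesReal a detectCode ≡ false → real ξ a ≡ real ν a
      round-real a fr fr′ = trans (kept-real a ρ₁ repairIf-≡ fr ν₁)
                                  (kept-real a ρ₁ detectS-≡ fr′ ν)

      round-state : Round (suc s) w μ (exec κ inp ρ₁ repairIf (exec κ inp ρ₁ detectS ν))
      round-state = record
        { lo≡     = child-state {s} {w} {ν₁} {ν₂} {ξ} round-detected round-repaired
                      (repairIf-exec ρ₁ ν₁)
        ; digits≡ = trans (kept-word digit ρ₁ repairIf-≡ refl ν₁)
                      (trans (kept-word digit ρ₁ detectS-≡ refl ν) (Round.digits≡ rnd))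
        ; reals≡  = trans (round-real dist′ refl refl) (proj₁ (Round.reals≡ rnd)) ,
                    trans (round-real lower′ refl refl) (proj₁ (proj₂ (Round.reals≡ rnd))) ,
                    trans (round-real upper′ refl refl) (proj₂ (proj₂ (Round.reals≡ rnd)))
        ; output≡ = trans (cong-app (trans (kept-word output ρ₁ repairIf-≡ refl ν₁)
                      (kept-word output ρ₁ detectS-≡ refl ν)) 0) (Round.output≡ rnd)
        ; test≡   = λ eq → subst (λ r → (word ξ v₀ 0 <ᵇ n) ≡ (c₀ (detect (simulate w r)) <ᵇ n))
                                 (suc-injective eq) round-test
        }

    -- The digits spell the number `c` of finished attempts, so the words tried so far are those of
    -- smaller value, and `complete` covers exactly these.
    record Progressed (c : ℕ) (ν : Memory) : Set where
      field
        loaded′  : Loaded ν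
        ternary  : ∀ j → j < κ 3 → word ν digit j < 3
        numeral≡ : numeral (κ 3) (word ν digit) ≡ c
        sound    : word ν output 0 ≡ 1 → ∃[ w ] Accepted w
        complete : ∀ w → (∀ j → j < κ 3 → w j < 3) → numeral (κ 3) w < c → Accepted w →
                   word ν output 0 ≡ 1

    Accepted-cong : ∀ {w w′} → (∀ i → i < κ 3 → w i ≡ w′ i) → Accepted w → Accepted w′
    Accepted-cong {w} {w′} eq acc =
      subst₂ (λ L L′ → n ≤ c₀ (detect L) × sum² n (λ x y → ⟦ bad L′ x y ⟧) < 1 ×
                       sum² n (λ x y → ⟦ flagged L′ x y ⟧) < suc (2 * k))
        (simulate-cong {w} {w′} (2 * k) (λ i i< → eq i (subst (i <_) (sym κ₃) (m≤n⇒m≤1+n i<))))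
        (simulate-cong {w} {w′} (suc (2 * k)) (λ i i< → eq i (subst (i <_) (sym κ₃) i<)))
        acc

    init-round : ∀ {ρ ν} → Loaded ν → Round 0 (word ν digit) ν (exec κ inp ρ initS ν)
    init-round {ρ} {ν} ld = record
      { lo≡     = subst (λ s → Holds-matrix (real (exec κ inp ρ s ν) lo) initial) (sym initS-≡)
                    (init-state {ρ} {ν} ld)
      ; digits≡ = kept-word digit ρ initS-≡ refl ν
      ; reals≡  = kept-real dist′ ρ initS-≡ refl ν ,
                  kept-real lower′ ρ initS-≡ refl ν ,
                  kept-real upper′ ρ initS-≡ refl ν
      ; output≡ = cong-app (kept-word output ρ initS-≡ refl ν) 0
      ; test≡   = λ ()
      }

    rounds-state : ∀ {ρ w μ ν} → Loaded μ → Round 0 w μ ν →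
                   Round (κ 3) w μ (exec κ inp ρ (for 3 roundS) ν)
    rounds-state {ρ} {w} {μ} {ν} ld rnd = iter-induction (λ s → Round s w μ) (κ 3) rnd
      (λ {s} {ξ} _ r → round-state {write ρ 1 s} {s} {w} {μ} {ξ} refl ld r)

    record Checked (w : ℕ → ℕ) (μ ν : Memory) : Set where
      constructor checked
      field
        loaded≡ : Loaded ν
        digits≡ : word ν digit ≡ w
        output≡ : word ν output 0 ≡ (when verdict w then 1 else word μ output 0)

    Loaded-cong : ∀ {μ ν} → real ν dist′ ≡ real μ dist′ → real ν lower′ ≡ real μ lower′ →
                  real ν upper′ ≡ real μ upper′ → Loaded μ → Loaded ν
    Loaded-cong p q r (loaded dist≡ lower≡ upper≡) = loaded
      (Holds-cong p dist≡) (Holds-cong q lower≡) (Holds-cong r upper≡)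

    checked-state : ∀ {ρ w μ ν} → Loaded μ → Round (κ 3) w μ ν →
                    Checked w μ (exec κ inp ρ checkS ν)
    checked-state {ρ} {w} {μ} {ν} ld (round lo≡ digits≡ (p , q , r) output≡ test≡) = record
      { loaded≡ = Loaded-cong {ν} (kept-real dist′ ρ checkS-≡ refl ν)
                    (kept-real lower′ ρ checkS-≡ refl ν)
                    (kept-real upper′ ρ checkS-≡ refl ν) ld′
      ; digits≡ = trans (kept-word digit ρ checkS-≡ refl ν) digits≡
      ; output≡ = trans
          (subst (λ s → word (exec κ inp ρ s ν) output 0 ≡ (when verdict w then 1 else word ν output 0))
            (sym checkS-≡)
            (check-state {ρ} {ν} {w} ld′
              (subst (λ s → Holds-matrix (real ν lo) (simulate w s)) κ₃ lo≡) (test≡ κ₃)))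
          (cong (λ m → when verdict w then 1 else m) output≡)
      }
      where
      ld′ : Loaded ν
      ld′ = Loaded-cong {μ} {ν} p q r ld

    increment-progress : ∀ {ρ c μ ν} → suc c < 3 ^ κ 3 → Progressed c μ →
      Checked (word μ digit) μ ν → Progressed (suc c) (exec κ inp ρ incrementS ν)
    increment-progress {ρ} {c} {μ} {ν} c< pr (checked ld digits≡ output≡) = record
      { loaded′  = Loaded-cong {ν} (kept-real dist′ ρ incrementS-≡ refl ν)
                     (kept-real lower′ ρ incrementS-≡ refl ν)
                     (kept-real upper′ ρ incrementS-≡ refl ν) ld
      ; ternary  = proj₁ incremented
      ; numeral≡ = trans (proj₂ incremented) (cong suc same)
      ; sound    = λ out → sound′ (verdict w) refl (trans (sym frame) out)
      ; complete = λ w′ w′<3 val< acc → trans frame (complete′ w′ w′<3 val< acc)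
      }
      where
      open Progressed pr
      w : ℕ → ℕ
      w = word μ digit
      frame : word (exec κ inp ρ incrementS ν) output 0 ≡ word ν output 0
      frame = cong-app (kept-word output ρ incrementS-≡ refl ν) 0
      same : numeral (κ 3) (word ν digit) ≡ c
      same = trans (cong (numeral (κ 3)) digits≡) numeral≡
      g : ℕ → ℕ
      g = word (exec κ inp ρ incrementS ν) digit
      incremented : (∀ j → j < κ 3 → g j < 3) × numeral (κ 3) g ≡ suc (numeral (κ 3) (word ν digit))
      incremented = subst
        (λ s → (∀ j → j < κ 3 → word (exec κ inp ρ s ν) digit j < 3) ×
               numeral (κ 3) (word (exec κ inp ρ s ν) digit) ≡ suc (numeral (κ 3) (word ν digit)))
        (sym incrementS-≡)
        (increment-state ρ ν
          (λ j j<κ → subst (λ f → f j < 3) (sym digits≡) (ternary j j<κ))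
          (subst (λ m → suc m < 3 ^ κ 3) (sym same) c<))
      sound′ : ∀ b → verdict w ≡ b → word ν output 0 ≡ 1 → ∃[ w ] Accepted w
      sound′ true  eq out = w , verdict-sound {w} eq
      sound′ false eq out = sound (trans (sym (trans output≡ (when-false eq))) out)
      complete′ : ∀ w′ → (∀ j → j < κ 3 → w′ j < 3) → numeral (κ 3) w′ < suc c →
                  Accepted w′ → word ν output 0 ≡ 1
      complete′ w′ w′<3 val< acc = trans output≡ (accept (m≤n⇒m<n∨m≡n (s≤s⁻¹ val<)))
        where
        keep : word μ output 0 ≡ 1 → ∀ b → (when b then 1 else word μ output 0) ≡ 1
        keep out true  = refl
        keep out false = out
        accept : numeral (κ 3) w′ < c ⊎ numeral (κ 3) w′ ≡ c →
                 (when verdict w then 1 else word μ output 0) ≡ 1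
        accept (inj₁ val<c) = keep (complete w′ w′<3 val<c acc) (verdict w)
        -- Numerals are injective on ternary words, so a word of value `c` has the digits that were
        -- just tried.
        accept (inj₂ val≡)  = when-true (verdict-complete {w} (Accepted-cong {w′} {w}
          (numeral-injective (κ 3) w′<3 ternary (trans val≡ (sym numeral≡))) acc))

    attempt-state : ∀ {ρ c ν} → suc c < 3 ^ κ 3 → Progressed c ν →
                    Progressed (suc c) (exec κ inp ρ attemptS ν)
    attempt-state {ρ} {c} {ν} c< pr =
      increment-progress {ρ} c< pr (checked-state {ρ} (loaded′ pr)
        (rounds-state {ρ} (loaded′ pr) (init-round {ρ} (loaded′ pr))))
      where open Progressed

    main-state : ∀ {ρ μ} → κ 4 < 3 ^ κ 3 → Progressed 0 μ → Progressed (κ 4) (exec κ inp ρ mainS μ)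
    main-state {ρ} {μ} κ₄< pr = iter-induction Progressed (κ 4) pr
      (λ {c} {ν} c<κ → attempt-state {write ρ 0 c} {c} {ν} (≤-<-trans c<κ κ₄<))

-- The whole program

-- The bounds of the later loops are produced by additions alone: the square of |X| in |X| passes,
-- and 9 ^ k by adding nine copies in each of k passes.
squareS powerS finishS setupS : Stmt 0
squareS = row [ lit 0 ]≔ lit 0 ▹ for 0 (row [ lit 0 ]≔ get row ⊞ con 0)
powerS = count [ lit 0 ]≔ lit 1 ▹
  for 1 (count [ lit 0 ]≔ get count ⊞ get count ⊞ get count ⊞ get count ⊞ get count ⊞
                          get count ⊞ get count ⊞ get count ⊞ get count)
-- Cell 0 of `output` is word 0, the register that held |X|, so it has to be cleared before the
-- search.
finishS = cur [ lit 0 ]≔ lit 1 ⊞ (con 1 ⊞ con 1) ▹ output [ lit 0 ]≔ lit 0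
setupS = squareS ▹ powerS ▹ finishS

searchS : Stmt 0
searchS = loadS ▹ mainS

constant : ℕ → Expr
constant c = ` slot 14 c

program : Program
program =
  -- Words 0 and 1 are also the first cells of `output` and `carry`, so the input registers are
  -- moved to safety at once.
  W[ constant 0 ]≔ W[ ` 0 ] ︔ W[ constant 1 ]≔ W[ ` 1 ] ︔
  compile setupS ︔
  W[ constant 2 ]≔ W[ ` slot (toℕ row) 0 ] ︔
  W[ constant 3 ]≔ W[ ` slot (toℕ cur) 0 ] ︔
  W[ constant 4 ]≔ W[ ` slot (toℕ count) 0 ] ︔
  compile searchS

opaque
  unfolding initS

  -- By evaluation: the attempts contribute 9 ^ k, the rounds k, and a detection two nested loops
  -- over the points. Loading, checking and counting are dominated.
  searchDegree : degree searchS ≡ (2 , 1 , 1)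
  searchDegree = refl

factorₚ : ℕ
-- The 20 pays for the five copies into constants, at 4 steps each.
factorₚ = 20 + (factor setupS + factor searchS)

-- The compiler theorem fixes the constants, but those from 2 on are only computed by the setup;
-- hence it is applied twice. During setup constant 2 is 0, so the work area for reals begins at
-- address 0 and the real arrays overlie the input, which `setupS` never writes.
setupConstants searchConstants : ℕ → ℕ → ℕ → ℕ
setupConstants n k 0             = n
setupConstants n k 1             = k
setupConstants n k (suc (suc _)) = 0
searchConstants n k 0 = n
searchConstants n k 1 = k
searchConstants n k 2 = n * n
searchConstants n k 3 = suc (2 * k)
searchConstants n k 4 = 9 ^ k
searchConstants n k (suc (suc (suc (suc (suc _))))) = 0

module _ (n k : ℕ) where

  private
    instance
      9^k≢0 : NonZero (9 ^ k)
      9^k≢0 = m^n≢0 9 k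
      1⊔n≢0 : NonZero (1 ⊔ n)
      1⊔n≢0 = >-nonZero (m≤m⊔n 1 n)
      1⊔k≢0 : NonZero (1 ⊔ k)
      1⊔k≢0 = >-nonZero (m≤m⊔n 1 k)

    bound : Degree → ℕ
    bound = monomial (1 ⊔ n) (1 ⊔ k) (9 ^ k)

    n≤ : n ≤ 1 * bound (1 , 0 , 0)
    n≤ = ≤-trans (m≤n⊔m 1 n) (≤-reflexive (simplify (1 ⊔ n)))
      where
      simplify : ∀ a → a ≡ 1 * (a * 1 * 1 * 1)
      simplify = solve-∀

    k≤ : k ≤ 1 * bound (0 , 1 , 0)
    k≤ = ≤-trans (m≤n⊔m 1 k) (≤-reflexive (simplify (1 ⊔ k)))
      where
      simplify : ∀ b → b ≡ 1 * (1 * (b * 1) * 1)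
      simplify = solve-∀

  setupConstants≤ : ∀ c → setupConstants n k c ≤ conFactor c * bound (conDegree c)
  setupConstants≤ 0             = n≤
  setupConstants≤ 1             = k≤
  setupConstants≤ (suc (suc _)) = z≤n

  searchConstants≤ : ∀ c → searchConstants n k c ≤ conFactor c * bound (conDegree c)
  searchConstants≤ 0 = n≤
  searchConstants≤ 1 = k≤
  searchConstants≤ 2 = ≤-trans (*-mono-≤ (m≤n⊔m 1 n) (m≤n⊔m 1 n)) (≤-reflexive (simplify (1 ⊔ n)))
    where
    simplify : ∀ a → a * a ≡ 1 * (a * (a * 1) * 1 * 1)
    simplify = solve-∀
  searchConstants≤ 3 = ≤-trans (+-mono-≤ (m≤m⊔n 1 k) (*-monoʳ-≤ 2 (m≤n⊔m 1 k)))
                               (≤-reflexive (simplify (1 ⊔ k)))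
    where
    simplify : ∀ b → b + 2 * b ≡ 3 * (1 * (b * 1) * 1)
    simplify = solve-∀
  searchConstants≤ 4 = ≤-reflexive (simplify (9 ^ k))
    where
    simplify : ∀ p → p ≡ 1 * (1 * 1 * (p * 1))
    simplify = solve-∀
  searchConstants≤ (suc (suc (suc (suc (suc _))))) = z≤n

  program-time : ∀ {t₁ t₂} → t₁ ≤ time (setupConstants n k) setupS →
    t₂ ≤ time (searchConstants n k) searchS →
    4 + (4 + (t₁ + (4 + (4 + (4 + t₂))))) ≤ factorₚ * (9 ^ k * (1 ⊔ k) * (1 ⊔ n) ^ 2)
  program-time {t₁} {t₂} t₁≤ t₂≤ = begin
    4 + (4 + (t₁ + (4 + (4 + (4 + t₂))))) ≡⟨ collect t₁ t₂ ⟩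
    20 + (t₁ + t₂) ≤⟨ +-mono-≤ (m≤m*n 20 M {{M≢0}}) (+-mono-≤ t₁≤M t₂≤M) ⟩
    20 * M + (factor setupS * M + factor searchS * M)
      ≡⟨ distribute (factor setupS) (factor searchS) M ⟩
    factorₚ * M ≡⟨ cong (factorₚ *_) (rearrange (1 ⊔ n) (1 ⊔ k) (9 ^ k)) ⟩
    factorₚ * (9 ^ k * (1 ⊔ k) * (1 ⊔ n) ^ 2) ∎
    where
    open ≤-Reasoning
    M : ℕ
    M = bound (2 , 1 , 1)
    M≢0 : NonZero M
    M≢0 = >-nonZero (1≤monomial (1 ⊔ n) (1 ⊔ k) (9 ^ k) (2 , 1 , 1))
    t₁≤M : t₁ ≤ factor setupS * M
    t₁≤M = ≤-trans t₁≤ (≤-trans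
      (time≤ (1 ⊔ n) (1 ⊔ k) (9 ^ k) (setupConstants n k) setupConstants≤ setupS)
      (*-monoʳ-≤ (factor setupS)
        (monomial-mono (1 ⊔ n) (1 ⊔ k) (9 ^ k) {1} {1} {0} {2} {1} {1} (n≤1+n 1) ≤-refl z≤n)))
    t₂≤M : t₂ ≤ factor searchS * M
    t₂≤M = ≤-trans t₂≤ (subst (λ δ → time (searchConstants n k) searchS ≤ factor searchS * bound δ)
      searchDegree
      (time≤ (1 ⊔ n) (1 ⊔ k) (9 ^ k) (searchConstants n k) searchConstants≤ searchS))
    collect : ∀ t₁ t₂ → 4 + (4 + (t₁ + (4 + (4 + (4 + t₂))))) ≡ 20 + (t₁ + t₂)
    collect = solve-∀
    distribute : ∀ f g m → 20 * m + (f * m + g * m) ≡ (20 + (f + g)) * m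
    distribute = solve-∀
    rearrange : ∀ a b p → a * (a * 1) * (b * 1) * (p * 1) ≡ p * b * (a * (a * 1))
    rearrange = solve-∀

-- The run of the whole program

module Loading (ℝ : RealNumbers) (κ : ℕ → ℕ) (inp : ℕ → RealNumbers.Carrier ℝ)
  (k : ℕ) (κ₂ : κ 2 ≡ κ 0 * κ 0) (κ₃ : κ 3 ≡ suc (2 * k)) where

  open Semantics ℝ
  open Execution₂ ℝ κ inp k κ₂ κ₃

  load-state : ∀ ρ μ → Loaded (exec κ inp ρ loadS μ)
  load-state ρ μ = loaded
    (λ x y x<n y<n → proj₁ (final (x * κ 0 + y) (index< x<n y<n)))
    (λ x y x<n y<n → proj₁ (proj₂ (final (x * κ 0 + y) (index< x<n y<n))))
    (λ x y x<n y<n → proj₂ (proj₂ (final (x * κ 0 + y) (index< x<n y<n))))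
    where
    I : ℕ → Memory → Set
    I j ν = ∀ e → e < j → real ν dist′ e ≡ inp e × real ν lower′ e ≡ inp (κ 2 + e) ×
                          real ν upper′ e ≡ inp (κ 2 + κ 2 + e)
    step : ∀ {j ν} → j < κ 2 → I j ν → I (suc j) (exec κ inp (write ρ 0 j) loadCell ν)
    step {j} {ν} j<κ below
      rewrite dec-true (j <? base κ) (<-≤-trans j<κ (m≤n+m (κ 2) (κ 2 + κ 2)))
            | dec-true (κ 2 + j <? base κ)
                (<-≤-trans (+-monoʳ-< (κ 2) j<κ) (m≤m+n (κ 2 + κ 2) (κ 2)))
            | dec-true (κ 2 + κ 2 + j <? base κ) (+-monoʳ-< (κ 2 + κ 2) j<κ) = at
      where
      at : ∀ e → e < suc j →
        write (real ν dist′) j (inp j) e ≡ inp e ×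
        write (real ν lower′) j (inp (κ 2 + j)) e ≡ inp (κ 2 + e) ×
        write (real ν upper′) j (inp (κ 2 + κ 2 + j)) e ≡ inp (κ 2 + κ 2 + e)
      at e e<1+j with e ≟ j
      ... | yes refl = refl , refl , refl
      ... | no e≢j   = below e (≤∧≢⇒< (s≤s⁻¹ e<1+j) e≢j)
    final : I (κ 2) (exec κ inp ρ loadS μ)
    final = iter-induction {f = λ j → exec κ inp (write ρ 0 j) loadCell} {μ} I (κ 2)
      (λ _ ()) (λ {j} {ν} → step {j} {ν})

module Setup (ℝ : RealNumbers) (κ : ℕ → ℕ) (inp : ℕ → RealNumbers.Carrier ℝ) where

  open Semantics ℝ

  setup-state : ∀ ρ μ → let ν = exec κ inp ρ setupS μ in
    word ν row 0 ≡ κ 0 * κ 0 × word ν cur 0 ≡ suc (2 * κ 1) × word ν count 0 ≡ 9 ^ κ 1 ×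
    word ν output 0 ≡ 0 × word ν digit ≡ word μ digit × (∀ a → real ν a ≡ real μ a)
  setup-state ρ μ =
    trans (cong-app (word-frame ℝ κ inp row ρ (powerS ▹ finishS) ν₁ refl) 0) square ,
    cong (λ m → suc (κ 1 + m)) (sym (+-identityʳ (κ 1))) , power , refl ,
    word-frame ℝ κ inp digit ρ setupS μ refl , λ a → real-frame ℝ κ inp a ρ setupS μ refl
    where
    ν₁ : Memory
    ν₁ = exec κ inp ρ squareS μ
    square : word ν₁ row 0 ≡ κ 0 * κ 0
    square = iter-induction (λ j ν → word ν row 0 ≡ j * κ 0) (κ 0) refl
      (λ {j} _ eq → trans (cong (_+ κ 0) eq) (+-comm (j * κ 0) (κ 0)))
    nine : ∀ m → m + m + m + m + m + m + m + m + m ≡ 9 * m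
    nine = solve-∀
    power : word (exec κ inp ρ powerS ν₁) count 0 ≡ 9 ^ κ 1
    power = iter-induction (λ j ν → word ν count 0 ≡ 9 ^ j) (κ 1) refl
      (λ {j} {ν} _ eq → trans (nine (word ν count 0)) (cong (9 *_) eq))

module _ (ℝ : RealNumbers) (n k : ℕ) (σ : State ℝ)
  (reg₀ : State.words σ 0 ≡ n) (reg₁ : State.words σ 1 ≡ k)
  (reg : ∀ i → State.words σ (suc (suc i)) ≡ 0) where

  open Semantics ℝ
  open State

  private
    inp = reals σ
    κ′ = setupConstants n k
    κ  = searchConstants n k
    ρ : ℕ → ℕ
    ρ _ = 0

    module E = Execution₃ ℝ κ inp k refl refl
    open Execution₂ ℝ κ inp k refl refl using (D; l; u)
    open Search ℝ n k D l u

    σ₁ : State ℝ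
    σ₁ = ⟪ write (write (words σ) 14 (words σ 0)) 30 (words σ 1) , reals σ ⟫

    other : ∀ {A : Set} (m : ℕ → A) x b j c → b < 16 → b ≢ 14 ⊎ j ≢ c →
            write m (slot 14 c) x (slot b j) ≡ m (slot b j)
    other m x b j c b<16 away = write-other m (slot 14 c) x λ eq →
      let (b≡ , j≡) = slot-injective b 14 j c b<16 14<16 eq in
      case away b≡ j≡
      where
      case : b ≢ 14 ⊎ j ≢ c → b ≡ 14 → j ≡ c → _
      case (inj₁ b≢) b≡ _ = b≢ b≡
      case (inj₂ j≢) _ j≡ = j≢ j≡

    μ₁ : Memory
    μ₁ = memory (λ a i → words σ₁ (slot (toℕ a) i)) (λ a i → reals σ (rslot (toℕ a) i))

    rep₁ : Represents κ′ inp 0 ρ σ₁ μ₁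
    rep₁ = record
      { constants = constants₁
      ; counters  = λ _ ()
      ; wordCells = λ _ _ → refl
      ; realCells = λ _ _ → refl
      ; inputs    = λ _ ()
      }
      where
      constants₁ : ∀ c → words σ₁ (slot 14 c) ≡ κ′ c
      constants₁ 0 = reg₀
      constants₁ 1 = reg₁
      constants₁ (suc (suc c)) = trans
        (other (write (words σ) 14 (words σ 0)) (words σ 1) 14 (2 + c) 1 14<16 (inj₂ λ ()))
        (trans (other (words σ) (words σ 0) 14 (2 + c) 0 14<16 (inj₂ λ ())) (reg _))

    setup : ∃[ τ ] ∃[ t ] Run ℝ (compile setupS) σ₁ τ t ×
              Represents κ′ inp 0 ρ τ (exec κ′ inp ρ setupS μ₁) × t ≤ time κ′ setupS
    setup = compile-correct κ′ inp setupS rep₁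

    τ₁ : State ℝ
    τ₁ = proj₁ setup

    rep₂ : Represents κ′ inp 0 ρ τ₁ (exec κ′ inp ρ setupS μ₁)
    rep₂ = proj₁ (proj₂ (proj₂ (proj₂ setup)))

    facts = Setup.setup-state ℝ κ′ inp ρ μ₁

    -- With base 0 the eight real arrays exhaust the addresses: division of `b` by 8 yields its
    -- array and cell, and the frame condition for arrays covers all reals.
    reals₁ : ∀ b → reals τ₁ b ≡ reals σ b
    reals₁ b = subst (λ b → reals τ₁ b ≡ reals σ b) split
      (trans (realCells rep₂ a (b / 8))
             (cong-app (proj₂ (proj₂ (proj₂ (proj₂ (proj₂ facts)))) a) (b / 8)))
      where
      a : Fin 8
      a = Fin.fromℕ< (m%n<n b 8)
      split : rslot (toℕ a) (b / 8) ≡ b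
      split = trans (cong₂ _+_ (Fin.toℕ-fromℕ< (m%n<n b 8)) (8i (b / 8)))
                    (sym (m≡m%n+[m/n]*n b 8))

    σ₂ σ₃ σ₄ : State ℝ
    -- Words 6, 4 and 13 are the first cells of `row`, `cur` and `count`, where the setup left the
    -- square of |X|, 2 k + 1 and 9 ^ k.
    σ₂ = ⟪ write (words τ₁) (slot 14 2) (words τ₁ 6) , reals τ₁ ⟫
    σ₃ = ⟪ write (words σ₂) (slot 14 3) (words σ₂ 4) , reals τ₁ ⟫
    σ₄ = ⟪ write (words σ₃) (slot 14 4) (words σ₃ 13) , reals τ₁ ⟫

    others : ∀ b j → b < 16 → b ≢ 14 ⊎ (j ≢ 2 × j ≢ 3 × j ≢ 4) →
             words σ₄ (slot b j) ≡ words τ₁ (slot b j)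
    others b j b<16 away = trans (other (words σ₃) (words σ₃ 13) b j 4 b<16
        (Sum.map₂ (λ p → proj₂ (proj₂ p)) away))
      (trans (other (words σ₂) (words σ₂ 4) b j 3 b<16
               (Sum.map₂ (λ p → proj₁ (proj₂ p)) away))
             (other (words τ₁) (words τ₁ 6) b j 2 b<16 (Sum.map₂ proj₁ away)))

    μ₃ : Memory
    μ₃ = memory (λ a i → words σ₄ (slot (toℕ a) i))
                (λ a i → reals τ₁ (base κ + rslot (toℕ a) i))

    rep₃ : Represents κ inp 0 ρ σ₄ μ₃
    rep₃ = record
      { constants = constants₃
      ; counters  = λ _ ()
      ; wordCells = λ _ _ → refl
      ; realCells = λ _ _ → refl
      ; inputs    = λ b _ → reals₁ b
      }
      where
      constants₃ : ∀ c → words σ₄ (slot 14 c) ≡ κ c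
      constants₃ 0 = constants rep₂ 0
      constants₃ 1 = constants rep₂ 1
      constants₃ 2 = trans (wordCells rep₂ row 0) (proj₁ facts)
      constants₃ 3 = trans (wordCells rep₂ cur 0) (proj₁ (proj₂ facts))
      constants₃ 4 = trans (wordCells rep₂ count 0) (proj₁ (proj₂ (proj₂ facts)))
      constants₃ (suc (suc (suc (suc (suc c))))) = trans
        (others 14 (5 + c) 14<16 (inj₂ ((λ ()) , (λ ()) , λ ()))) (constants rep₂ (5 + c))

    output₃ : word μ₃ output 0 ≡ 0
    output₃ = trans (wordCells rep₂ output 0) (proj₁ (proj₂ (proj₂ (proj₂ facts))))

    digit₃ : ∀ i → word μ₃ digit i ≡ 0
    digit₃ i = trans (others 2 i (s≤s (s≤s (s≤s z≤n))) (inj₁ λ ()))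
      (trans (wordCells rep₂ digit i)
        (trans (cong-app (proj₁ (proj₂ (proj₂ (proj₂ (proj₂ facts))))) i)
          (trans (other (write (words σ) 14 (words σ 0)) (words σ 1) 2 i 1 (s≤s (s≤s (s≤s z≤n))) (inj₁ λ ()))
            (trans (other (words σ) (words σ 0) 2 i 0 (s≤s (s≤s (s≤s z≤n))) (inj₁ λ ())) (reg _)))))

    loading : ∃[ τ ] ∃[ t ] Run ℝ (compile loadS) σ₄ τ t ×
                Represents κ inp 0 ρ τ (exec κ inp ρ loadS μ₃) × t ≤ time κ loadS
    loading = compile-correct κ inp loadS rep₃

    search : ∃[ τ ] ∃[ t ] Run ℝ (compile mainS) (proj₁ loading) τ t ×
               Represents κ inp 0 ρ τ (exec κ inp ρ mainS (exec κ inp ρ loadS μ₃)) ×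
               t ≤ time κ mainS
    search = compile-correct κ inp mainS (proj₁ (proj₂ (proj₂ (proj₂ loading))))

  final-state : State ℝ
  final-state = proj₁ search

  program-run : ∃[ t ] Run ℝ program σ final-state t ×
                       t ≤ factorₚ * (9 ^ k * (1 ⊔ k) * (1 ⊔ n) ^ 2)
  program-run = _ ,
    seq assignʷ (seq assignʷ (seq (proj₁ (proj₂ (proj₂ setup)))
      (seq assignʷ (seq assignʷ (seq assignʷ
        (seq (proj₁ (proj₂ (proj₂ loading))) (proj₁ (proj₂ (proj₂ search))))))))) ,
    program-time n k (proj₂ (proj₂ (proj₂ (proj₂ setup))))
      (+-mono-≤ (proj₂ (proj₂ (proj₂ (proj₂ loading)))) (proj₂ (proj₂ (proj₂ (proj₂ search)))))

  3^2k≡9^k : 3 ^ (2 * k) ≡ 9 ^ k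
  3^2k≡9^k = sym (^-*-assoc 3 2 k)

  module _ (D-dis : Dissimilarity D) (l-dis : Dissimilarity l) (u-dis : Dissimilarity u) where

    private
      loaded₄ = Loading.load-state ℝ κ inp k refl refl ρ μ₃

      digit₄ : ∀ i → word (exec κ inp ρ loadS μ₃) digit i ≡ 0
      digit₄ i = trans (cong-app (word-frame ℝ κ inp digit ρ loadS μ₃ refl) i) (digit₃ i)

      output₄ : word (exec κ inp ρ loadS μ₃) output 0 ≡ 0
      output₄ = trans (cong-app (word-frame ℝ κ inp output ρ loadS μ₃ refl) 0) output₃

      begun : E.Progressed D-dis l-dis u-dis 0 (exec κ inp ρ loadS μ₃)
      begun = record
        { loaded′  = loaded₄
        ; ternary  = λ j _ → subst (_< 3) (sym (digit₄ j)) z<s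
        ; numeral≡ = zeros (suc (2 * k)) digit₄
        ; sound    = λ eq → contradiction (trans (sym output₄) eq) λ ()
        ; complete = λ _ _ ()
        }
        where
        zeros : ∀ m {f} → (∀ i → f i ≡ 0) → numeral m f ≡ 0
        zeros zero    f≡0 = refl
        zeros (suc m) f≡0 = cong₂ (λ a b → a * 3 ^ m + b) (f≡0 m) (zeros m f≡0)

      -- There is one digit per round, hence one more than the 2 k choices. The spare digit lets the
      -- counter reach 9 ^ k after the last attempt without overflow.
      attempts< : 9 ^ k < 3 ^ suc (2 * k)
      attempts< = subst (_< 3 ^ suc (2 * k)) 3^2k≡9^k
        (m<m+n (3 ^ (2 * k)) (≤-trans (m^n>0 3 (2 * k)) (m≤m+n (3 ^ (2 * k)) _)))

      module Done = E.Progressed (E.main-state D-dis l-dis u-dis {ρ} {exec κ inp ρ loadS μ₃} attempts< begun)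

      answer : words final-state 0 ≡ word (exec κ inp ρ mainS (exec κ inp ρ loadS μ₃)) output 0
      answer = wordCells (proj₁ (proj₂ (proj₂ (proj₂ search)))) output 0

    program-sound : Accepting ℝ final-state → ∃[ w ] Accepted w
    program-sound acc = Done.sound (trans (sym answer) acc)

    program-complete : ∀ w → (∀ i → w i < 3) → (∀ i → 2 * k ≤ i → w i ≡ 0) → Accepted w →
                       Accepting ℝ final-state
    program-complete w w<3 beyond acc = trans answer (Done.complete w (λ i _ → w<3 i)
      -- The spare digit of the word is 0, so its value is below 3 ^ (2 k), the number of attempts.
      (subst (_< 9 ^ k) (sym (numeral-zeros (2 * k) w (beyond (2 * k) ≤-refl)))
        (subst (numeral (2 * k) w <_) 3^2k≡9^k (numeral-< (2 * k) (λ i _ → w<3 i)))) acc)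

-- Instances

module _ {A : Set} {P : Pred A 0ℓ} (P? : Decidable P) where

  length-filter-∷ : ∀ x xs → length (filter P? (x ∷ xs)) ≡ ⟦ does (P? x) ⟧ + length (filter P? xs)
  length-filter-∷ x xs with does (P? x)
  ... | true  = refl
  ... | false = refl

  length-filter-++ : ∀ xs ys → length (filter P? (xs ++ ys)) ≡
                     length (filter P? xs) + length (filter P? ys)
  length-filter-++ xs ys = trans (cong length (List.filter-++ P? xs ys))
                                 (List.length-++ (filter P? xs))

  length-filter-tabulate : ∀ n (f : Fin n → A) {c : ℕ → Bool} →
    (∀ i → does (P? (f i)) ≡ c (toℕ i)) → length (filter P? (tabulate f)) ≡ sum n (λ i → ⟦ c i ⟧)
  length-filter-tabulate zero    f eq = refl
  length-filter-tabulate (suc n) f eq = trans (length-filter-∷ (f Fin.zero) _)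
    (cong₂ _+_ (cong ⟦_⟧ (eq Fin.zero))
               (length-filter-tabulate n (λ i → f (Fin.suc i)) (λ i → eq (Fin.suc i))))

length-filter-product : ∀ {A : Set} {m} {P : Pred (A × Fin m) 0ℓ} (P? : Decidable P)
  n (f : Fin n → A) {c : ℕ → ℕ → Bool} → (∀ i j → does (P? (f i , j)) ≡ c (toℕ i) (toℕ j)) →
  length (filter P? (cartesianProduct (tabulate f) (allFin m))) ≡
  sum n (λ x → sum m (λ y → ⟦ c x y ⟧))
length-filter-product P? zero f eq = refl
length-filter-product {m = m} P? (suc n) f {c} eq = trans
  (length-filter-++ P? (mapᴸ (f Fin.zero ,_) (allFin m)) _)
  (cong₂ _+_
    (trans (cong (λ xs → length (filter P? xs)) (List.map-tabulate (λ j → j) (f Fin.zero ,_)))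
           (length-filter-tabulate P? m (f Fin.zero ,_) (eq Fin.zero)))
    (length-filter-product P? n (λ i → f (Fin.suc i)) (λ i j → eq (Fin.suc i) j)))

on-Fin : ∀ {n} (P : ℕ → Set) → (∀ (i : Fin n) → P (toℕ i)) → ∀ {x} → x < n → P x
on-Fin P p x<n = subst P (Fin.toℕ-fromℕ< x<n) (p (Fin.fromℕ< x<n))

on-Fin² : ∀ {n} (P : ℕ → ℕ → Set) → (∀ (i j : Fin n) → P (toℕ i) (toℕ j)) →
          ∀ {x y} → x < n → y < n → P x y
on-Fin² P p {y = y} x<n y<n = on-Fin (λ x → P x y) (λ i → on-Fin (P (toℕ i)) (p i) y<n) x<n

concat-combine : ∀ {A : Set} {m n} (M : Fin m → Fin n → A) i j →
                 Vector.concat M (Fin.combine i j) ≡ M i j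
concat-combine {n = n} M i j =
  cong (λ p → M (proj₁ p) (proj₂ p)) (Fin.remQuot-combine {k = n} i j)

module _ (ℝ : RealNumbers) where

  open RealNumbers ℝ using (Carrier; 0#)

  load-toℕ : ∀ {m} (v : Vector.Vector Carrier m) i → load ℝ v (toℕ i) ≡ v i
  load-toℕ {m} v i with toℕ i <? m
  ... | yes i<m = cong v (Fin.fromℕ<-toℕ i i<m)
  ... | no  i≮m = contradiction (Fin.toℕ<n i) i≮m

  module _ {n} (M₁ M₂ M₃ : Matrix ℝ n) (i j : Fin n) where

    private
      cells : Vector.Vector Carrier (n * n + (n * n + n * n))
      cells = Vector._++_ (Vector.concat M₁) (Vector._++_ (Vector.concat M₂) (Vector.concat M₃))

      e : Fin (n * n)
      e = Fin.combine i j

      index : toℕ e ≡ toℕ i * n + toℕ j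
      index = trans (Fin.toℕ-combine i j) (cong (_+ toℕ j) (*-comm n (toℕ i)))

    load₁ : load ℝ cells (toℕ i * n + toℕ j) ≡ M₁ i j
    load₁ = trans (cong (load ℝ cells) (trans (sym index) (sym (Fin.toℕ-↑ˡ e (n * n + n * n)))))
      (trans (load-toℕ cells (e Fin.↑ˡ (n * n + n * n)))
        (trans (Vector.lookup-++ˡ (Vector.concat M₁) _ e) (concat-combine M₁ i j)))

    load₂ : load ℝ cells (n * n + (toℕ i * n + toℕ j)) ≡ M₂ i j
    load₂ = trans (cong (load ℝ cells) (trans
        (cong (n * n +_) (trans (sym index) (sym (Fin.toℕ-↑ˡ e (n * n)))))
        (sym (Fin.toℕ-↑ʳ (n * n) (e Fin.↑ˡ (n * n))))))
      (trans (load-toℕ cells ((n * n) Fin.↑ʳ (e Fin.↑ˡ (n * n))))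
        (trans (Vector.lookup-++ʳ (Vector.concat M₁) _ (e Fin.↑ˡ (n * n)))
          (trans (Vector.lookup-++ˡ (Vector.concat M₂) _ e) (concat-combine M₂ i j))))

    load₃ : load ℝ cells (n * n + n * n + (toℕ i * n + toℕ j)) ≡ M₃ i j
    load₃ = trans (cong (load ℝ cells) (trans (+-assoc (n * n) (n * n) _) (trans
        (cong (n * n +_) (trans (cong (n * n +_) (sym index)) (sym (Fin.toℕ-↑ʳ (n * n) e))))
        (sym (Fin.toℕ-↑ʳ (n * n) ((n * n) Fin.↑ʳ e))))))
      (trans (load-toℕ cells ((n * n) Fin.↑ʳ ((n * n) Fin.↑ʳ e)))
        (trans (Vector.lookup-++ʳ (Vector.concat M₁) _ ((n * n) Fin.↑ʳ e))
          (trans (Vector.lookup-++ʳ (Vector.concat M₂) _ e) (concat-combine M₃ i j))))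

  -- The value outside the matrix is irrelevant.
  extend : ∀ {n} → Matrix ℝ n → ℕ → ℕ → Carrier
  extend {n} M x y with x <? n | y <? n
  ... | yes x<n | yes y<n = M (Fin.fromℕ< x<n) (Fin.fromℕ< y<n)
  ... | yes _   | no _    = 0#
  ... | no _    | _       = 0#

  extend-toℕ : ∀ {n} (M : Matrix ℝ n) i j → extend M (toℕ i) (toℕ j) ≡ M i j
  extend-toℕ {n} M i j with toℕ i <? n | toℕ j <? n
  ... | yes p | yes q = cong₂ M (Fin.fromℕ<-toℕ i p) (Fin.fromℕ<-toℕ j q)
  ... | yes _ | no ¬q = contradiction (Fin.toℕ<n j) ¬q
  ... | no ¬p | _     = contradiction (Fin.toℕ<n i) ¬p

module _ (ℝ : RealNumbers) (I : Instance ℝ) where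

  open Instance I
  open RealNumbers ℝ using (_≈_; 0#; _-_; isDecTotalOrder)
    renaming (Carrier to C; _≤_ to _≼_; _+_ to _+ʳ_; _≟_ to _≈?_; +-monoʳ-≤ to +ʳ-mono)
  open Order ℝ using (commutativeRing; ≼-refl; ≼-trans; ≼-antisym; ≼-reflexive; ≼-total; _≼?_)

  private
    module ring = CommutativeRing commutativeRing

    inp : ℕ → C
    inp = State.reals (input ℝ I)

    κ : ℕ → ℕ
    κ = searchConstants n k

  open Execution₂ ℝ κ inp k refl refl using (D; l; u)
  open Search ℝ n k D l u

  private
    D≡ : ∀ i j → D (toℕ i) (toℕ j) ≡ dist i j
    D≡ = load₁ ℝ dist τₗ τᵤ

    l≡ : ∀ i j → l (toℕ i) (toℕ j) ≡ τₗ i j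
    l≡ = load₂ ℝ dist τₗ τᵤ

    u≡ : ∀ i j → u (toℕ i) (toℕ j) ≡ τᵤ i j
    u≡ = load₃ ℝ dist τₗ τᵤ

  dissimilarity-on-ℕ : ∀ {M : Matrix ℝ n} {f} → (∀ i j → f (toℕ i) (toℕ j) ≡ M i j) →
    (∀ i j → 0# ≼ M i j) → (∀ i j → M i j ≼ M j i) → (∀ i → M i i ≼ 0#) → Dissimilarity f
  dissimilarity-on-ℕ {M} {f} f≡ nonneg symm diag = record
    { 0≼    = on-Fin² (λ x y → 0# ≼ f x y) (λ i j → subst (0# ≼_) (sym (f≡ i j)) (nonneg i j))
    ; sym≼  = on-Fin² (λ x y → f x y ≼ f y x)
                (λ i j → subst₂ _≼_ (sym (f≡ i j)) (sym (f≡ j i)) (symm i j))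
    ; diag≼ = on-Fin (λ x → f x x ≼ 0#) (λ i → subst (_≼ 0#) (sym (f≡ i i)) (diag i))
    }

  from-dissimilarity : ∀ {M : Matrix ℝ n} {f} → (∀ i j → f (toℕ i) (toℕ j) ≡ M i j) →
                       IsDissimilarity ℝ M → Dissimilarity f
  from-dissimilarity f≡ dis = dissimilarity-on-ℕ f≡ M.nonNegative
    (λ i j → ≼-reflexive (M.symmetric i j)) (λ i → ≼-reflexive (M.diagonal i))
    where module M = IsDissimilarity dis

  D-dis : Dissimilarity D
  D-dis = from-dissimilarity D≡ dist-dissimilarity

  l-dis : Dissimilarity l
  l-dis = from-dissimilarity l≡ τₗ-dissimilarity

  u-dis : Dissimilarity u
  u-dis = from-dissimilarity u≡ τᵤ-dissimilarity

  -- The norm tests a difference for zero, while the machine can only compare; antisymmetry and the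
  -- group laws identify the two.
  changed-does : ∀ {d} {M : Matrix ℝ n} → (∀ i j → d (toℕ i) (toℕ j) ≡ M i j) → ∀ i j →
    not (does (dist i j - M i j ≈? 0#)) ≡ changed d (toℕ i) (toℕ j)
  changed-does {d} {M} d≡ i j rewrite D≡ i j | d≡ i j
    with dist i j - M i j ≈? 0# | dist i j ≼? M i j | M i j ≼? dist i j
  ... | yes _  | yes _ | yes _ = refl
  ... | no _   | no _  | _     = refl
  ... | no _   | yes _ | no _  = refl
  ... | no ≉0  | yes p | yes q = contradiction
        (ring.trans (ring.+-congʳ (≼-antisym p q)) (ring.-‿inverseʳ (M i j))) ≉0
  ... | yes ≈0 | no ¬p | _     = contradiction
        (≼-reflexive (GroupProperties.x∙y⁻¹≈ε⇒x≈y ring.+-group (dist i j) (M i j) ≈0)) ¬p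
  ... | yes ≈0 | yes _ | no ¬q = contradiction
        (≼-reflexive (ring.sym (GroupProperties.x∙y⁻¹≈ε⇒x≈y ring.+-group (dist i j) (M i j) ≈0))) ¬q

  norm≡ : ∀ {d} {M : Matrix ℝ n} → (∀ i j → d (toℕ i) (toℕ j) ≡ M i j) →
    ‖_‖₀ ℝ (_⊖ᴹ_ ℝ dist M) ≡ sum² n (λ x y → ⟦ changed d x y ⟧)
  norm≡ {d} {M} d≡ = length-filter-product _ n (λ i → i) (changed-does {d} {M} d≡)

  solution⇒yes : ∀ {d} → Solution d → YesInstance ℝ I
  solution⇒yes {d} sol = M , ultrametric , (λ i j → τₗ≼ i j , ≼τᵤ i j) ,
    ≤-trans (≤-reflexive (norm≡ {d} {M} (λ _ _ → refl))) few
    where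
    open Solution sol
    open Dissimilarity dissimilarity
    M : Matrix ℝ n
    M i j = d (toℕ i) (toℕ j)
    bounded : ∀ i → toℕ i < n
    bounded = Fin.toℕ<n
    τₗ≼ : ∀ i j → τₗ i j ≼ M i j
    τₗ≼ i j = subst (_≼ M i j) (l≡ i j) (lower (bounded i) (bounded j))
    ≼τᵤ : ∀ i j → M i j ≼ τᵤ i j
    ≼τᵤ i j = subst (M i j ≼_) (u≡ i j) (upper (bounded i) (bounded j))
    strong : ∀ i j m → M i m ≼ RealNumbers._⊔_ ℝ (M i j) (M j m)
    strong i j m = ultra (bounded i) (bounded j) (bounded m)
      (Max.x≤x⊔y (RealNumbers.totalOrder ℝ) _ _) (Max.x≤y⊔x (RealNumbers.totalOrder ℝ) _ _)
    ≼-+ˡ : ∀ a {b} → 0# ≼ b → a ≼ a +ʳ b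
    ≼-+ˡ a 0≼b = ≼-trans (≼-reflexive (ring.sym (ring.+-identityʳ a))) (+ʳ-mono a 0≼b)
    ≼-+ʳ : ∀ a {b} → 0# ≼ b → a ≼ b +ʳ a
    ≼-+ʳ a 0≼b = ≼-trans (≼-+ˡ a 0≼b) (≼-reflexive (ring.+-comm a _))
    ultrametric : IsUltrametric ℝ M
    ultrametric = record
      { isMetric = record
        { isSemiMetric = record
          { isQuasiSemiMetric = record
            { isPreMetric = record
              { isProtoMetric = record
                { isPartialOrder  = IsDecTotalOrder.isPartialOrder isDecTotalOrder
                ; ≈-isEquivalence = isEquivalence
                ; cong            = λ { refl refl → ring.refl }
                ; nonNegative     = 0≼ (bounded _) (bounded _)
                }
              ; ≈⇒0 = λ { {i} refl → ≼-antisym (diag≼ (bounded i)) (0≼ (bounded i) (bounded i)) }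
              }
            ; 0⇒≈ = λ {i} {j} eq → indiscernible i j eq
            }
          ; sym = λ i j → ≼-antisym (sym≼ (bounded i) (bounded j)) (sym≼ (bounded j) (bounded i))
          }
        ; triangle = λ i j m → ultra (bounded i) (bounded j) (bounded m)
            (≼-+ˡ (M i j) (0≼ (bounded j) (bounded m)))
            (≼-+ʳ (M j m) (0≼ (bounded i) (bounded j)))
        }
      ; strong = λ {i} {j} {m} _ _ _ → strong i j m
      }
      where
      indiscernible : ∀ i j → M i j ≈ 0# → i ≡ j
      indiscernible i j eq with i Fin.≟ j
      ... | yes i≡j = i≡j
      ... | no  i≢j = contradiction (≼-reflexive eq)
              (positive (bounded i) (bounded j) (λ p → i≢j (Fin.toℕ-injective p)))

  yes⇒solution : ((dist′ , _) : YesInstance ℝ I) → Solution (extend ℝ dist′)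
  yes⇒solution (dist′ , ultrametric , bounds , few) = record
    { dissimilarity = dissimilarity-on-ℕ {dist′} d≡ (λ i j → metric.nonNegative {i} {j})
        (λ i j → ≼-reflexive (metric.sym i j)) (λ i → ≼-reflexive (metric.≈⇒0 {i} refl))
    ; positive = on-Fin² (λ x y → x ≢ y → ¬ d x y ≼ 0#) (λ i j i≢j p → i≢j (cong toℕ
        (metric.0⇒≈ (≼-antisym (subst (_≼ 0#) (d≡ i j) p) metric.nonNegative))))
    ; ultra    = λ {x} {y} {z} x<n y<n z<n {t} →
        on-Fin² (λ x y → d x y ≼ t → d y z ≼ t → d x z ≼ t)
          (λ i j → on-Fin (λ z → d (toℕ i) (toℕ j) ≼ t → d (toℕ j) z ≼ t → d (toℕ i) z ≼ t)
            (λ m p q → subst (_≼ t) (sym (d≡ i m))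
              (ultra i j m (subst (_≼ t) (d≡ i j) p) (subst (_≼ t) (d≡ j m) q))) z<n)
          x<n y<n
    ; lower    = on-Fin² (λ x y → l x y ≼ d x y)
        (λ i j → subst₂ _≼_ (sym (l≡ i j)) (sym (d≡ i j)) (proj₁ (bounds i j)))
    ; upper    = on-Fin² (λ x y → d x y ≼ u x y)
        (λ i j → subst₂ _≼_ (sym (d≡ i j)) (sym (u≡ i j)) (proj₂ (bounds i j)))
    ; few      = ≤-trans (≤-reflexive (sym (norm≡ {d} {dist′} d≡))) few
    }
    where
    d : ℕ → ℕ → C
    d = extend ℝ dist′
    d≡ : ∀ i j → d (toℕ i) (toℕ j) ≡ dist′ i j
    d≡ = extend-toℕ ℝ dist′
    module metric = Metric.IsGeneralMetric (IsUltrametric.isMetric ultrametric)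
    -- The strong inequality is given for distinct points only; when two of the points coincide, one
    -- of the premises or the zero diagonal does its work.
    ultra : ∀ i j m {t} → dist′ i j ≼ t → dist′ j m ≼ t → dist′ i m ≼ t
    ultra i j m p q with i Fin.≟ m | i Fin.≟ j | j Fin.≟ m
    ... | yes refl | _ | _ = ≼-trans (≼-reflexive (metric.≈⇒0 refl)) (≼-trans metric.nonNegative p)
    ... | no _ | yes refl | _ = q
    ... | no _ | no _ | yes refl = p
    ... | no i≢m | no i≢j | no j≢m =
      ≼-trans (IsUltrametric.strong ultrametric i≢j j≢m i≢m)
              (Max.⊔-lub (RealNumbers.totalOrder ℝ) p q)

  correct : Accepting ℝ (final-state ℝ n k (input ℝ I) refl refl (λ _ → refl)) ⇔ YesInstance ℝ I
  correct = mk⇔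
    (λ acc → let (w , accepted) = program-sound ℝ n k (input ℝ I) refl refl (λ _ → refl)
                                    D-dis l-dis u-dis acc
             in solution⇒yes (Soundness.sound D-dis l-dis u-dis {w} accepted))
    (λ yes → let (w , ternary , beyond , accepted) =
                   Completeness.complete D-dis l-dis u-dis (yes⇒solution yes)
             in program-complete ℝ n k (input ℝ I) refl refl (λ _ → refl)
                  D-dis l-dis u-dis w ternary beyond accepted)

theorem2 : ∃[ p ] ∃[ c ] ((ℝ : RealNumbers) (I : Instance ℝ) →
    let open Instance I in
    ∃[ σ ] ∃[ t ]
    Run ℝ p (input ℝ I) σ t
    × (Accepting ℝ σ ⇔ YesInstance ℝ I)
    × t ≤ c * (9 ^ k * (1 ⊔ k) * (1 ⊔ n) ^ 2))
theorem2 = program , factorₚ , λ ℝ I →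
  let open Instance I
      (t , run , t≤) = program-run ℝ n k (input ℝ I) refl refl (λ _ → refl)
  in final-state ℝ n k (input ℝ I) refl refl (λ _ → refl) , t , run , correct ℝ I , t≤
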